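{- Let $n\ge 2$, let $2 \le d \le n$ be even with $d=2e$, let $t=\lfloor n/2 \rfloor$, and let $1 \le k \le \frac{n(n-1)}{2t}(t-e+1)$. Then $$\delta_q^{\mathrm{Alt}}(n \times n, k, d) \in O\left(q^{n(n-1)/2-k+1-(d-2)n+(d-1)(d-2)/2}\right) \quad \text{as } q \to +\infty.$$ Moreover, $\lim_{q \to+\infty}\delta^{\mathrm{Alt}}_q(n \times n,k,d)=1$ if $k < \frac{n(n-1)}{2}+1-(d-2)n+\frac{(d-1)(d-2)}{2}$, and $=0$ if $k > \frac{n(n-1)}{2}+1-(d-2)n+\frac{(d-1)(d-2)}{2}$.
   Context: $\mathrm{Alt}_n(q)$ is the $\mathbb{F}_q$-space (of dimension $n(n-1)/2$) of alternating $n\times n$ matrices over $\mathbb{F}_q$ ($M_{ij}=-M_{ji}$, $M_{ii}=0$). $\delta^{\mathrm{Alt}}_q(n\times n,k,d)$ is the number of $k$-dimensional $\mathbb{F}_q$-subspaces of $\mathrm{Alt}_n(q)$ in which every nonzero matrix has rank at least $d$, divided by the number of all $k$-dimensional subspaces of $\mathrm{Alt}_n(q)$. Limits are over prime powers $q$ with $n,k,d$ fixed. -}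

module Defs where

open import Data.Bool using (Bool; true; false; _∧_; _∨_; not)
open import Data.Nat as ℕ using (ℕ; zero; suc)
open import Data.Integer as ℤ using (ℤ; +_; -[1+_])
open import Data.Rational as ℚ using (ℚ)
open import Data.Fin using (Fin; zero; suc)
open import Data.List using (List; []; _∷_; [_]; _++_; map; concatMap; allFin; filterᵇ; length; foldr)
open import Data.Bool.ListAction using (all; any)
open import Data.List.Membership.Propositional using (_∈_)
open import Data.List.Relation.Unary.Unique.Propositional using (Unique)
open import Data.Product using (∃)
open import Relation.Nullary using (¬_; ⌊_⌋)
open import Relation.Binary.PropositionalEquality using (_≡_)
open import Relation.Binary.Definitions using (DecidableEquality)
open import Algebra.Structures using (IsCommutativeRing)

record FiniteField : Set₁ where
  field
    Carrier  : Set
    _+_ _*_  : Carrier → Carrier → Carrier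
    -_       : Carrier → Carrier
    0# 1#    : Carrier
    isCommutativeRing : IsCommutativeRing _≡_ _+_ _*_ -_ 0# 1#
    0≢1      : ¬ (0# ≡ 1#)
    inverse  : ∀ x → ¬ (x ≡ 0#) → ∃ λ y → x * y ≡ 1#
    _≟_      : DecidableEquality Carrier
    elements : List Carrier
    complete : ∀ x → x ∈ elements
    unique   : Unique elements

card : FiniteField → ℕ
card F = length (FiniteField.elements F)

allFuns : {A : Set} → List A → (m : ℕ) → List (Fin m → A)
allFuns xs zero    = [ (λ ()) ]
allFuns xs (suc m) =
  concatMap (λ x → map (λ f → λ { zero → x ; (suc i) → f i }) (allFuns xs m)) xs

-- all sublists (= all subsets, when the list has no duplicates)
sublists : {A : Set} → List A → List (List A)
sublists []       = [ [] ]
sublists (x ∷ xs) = map (x ∷_) (sublists xs) ++ sublists xs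

module LinAlg (F : FiniteField) where
  open FiniteField F

  eqᵇ : Carrier → Carrier → Bool
  eqᵇ x y = ⌊ x ≟ y ⌋

  Vec : ℕ → Set
  Vec n = Fin n → Carrier

  Mat : ℕ → Set
  Mat n = Fin n → Fin n → Carrier

  sumFin : (k : ℕ) → (Fin k → Carrier) → Carrier
  sumFin k f = foldr (λ i acc → f i + acc) 0# (allFin k)

  eqVᵇ : {n : ℕ} → Vec n → Vec n → Bool
  eqVᵇ {n} u v = all (λ i → eqᵇ (u i) (v i)) (allFin n)

  isZeroVᵇ : {n : ℕ} → Vec n → Bool
  isZeroVᵇ {n} u = all (λ i → eqᵇ (u i) 0#) (allFin n)

  eqMᵇ : {n : ℕ} → Mat n → Mat n → Bool
  eqMᵇ {n} A B = all (λ i → eqVᵇ (A i) (B i)) (allFin n)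

  isZeroMᵇ : {n : ℕ} → Mat n → Bool
  isZeroMᵇ {n} A = all (λ i → isZeroVᵇ (A i)) (allFin n)

  lcV : {k n : ℕ} → (Fin k → Vec n) → (Fin k → Carrier) → Vec n
  lcV {k} v c j = sumFin k (λ l → c l * v l j)

  lcM : {k n : ℕ} → (Fin k → Mat n) → (Fin k → Carrier) → Mat n
  lcM v c i = lcV (λ l → v l i) c

  indepVᵇ : {k n : ℕ} → (Fin k → Vec n) → Bool
  indepVᵇ {k} v =
    all (λ c → isZeroVᵇ c ∨ not (isZeroVᵇ (lcV v c))) (allFuns elements k)

  indepMᵇ : {k n : ℕ} → (Fin k → Mat n) → Bool
  indepMᵇ {k} v =
    all (λ c → isZeroVᵇ c ∨ not (isZeroMᵇ (lcM v c))) (allFuns elements k)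

  rankAtLeastᵇ : {n : ℕ} → ℕ → Mat n → Bool
  rankAtLeastᵇ {n} d M =
    any (λ r → indepVᵇ (λ l → M (r l))) (allFuns (allFin n) d)

  isAltᵇ : {n : ℕ} → Mat n → Bool
  isAltᵇ {n} M =
    all (λ i → eqᵇ (M i i) 0# ∧ all (λ j → eqᵇ (M i j) (- (M j i))) (allFin n))
        (allFin n)

  -- the space Alt_n(q), as a list without duplicates
  Alt : (n : ℕ) → List (Mat n)
  Alt n = filterᵇ isAltᵇ (allFuns (allFuns elements n) n)

  memᵇ : {n : ℕ} → Mat n → List (Mat n) → Bool
  memᵇ M S = any (eqMᵇ M) S

  addM : {n : ℕ} → Mat n → Mat n → Mat n
  addM A B i j = A i j + B i j

  scaleM : {n : ℕ} → Carrier → Mat n → Mat n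
  scaleM c A i j = c * A i j

  zeroM : {n : ℕ} → Mat n
  zeroM i j = 0#

  isSubspaceᵇ : {n : ℕ} → List (Mat n) → Bool
  isSubspaceᵇ S =
    memᵇ zeroM S
    ∧ all (λ A → all (λ B → memᵇ (addM A B) S) S) S
    ∧ all (λ c → all (λ A → memᵇ (scaleM c A) S) S) elements

  hasDimᵇ : {n : ℕ} → ℕ → List (Mat n) → Bool
  hasDimᵇ k S =
    any (λ b → indepMᵇ b
               ∧ all (λ M → any (λ c → eqMᵇ (lcM b c) M) (allFuns elements k)) S)
        (allFuns S k)

  minRankAtLeastᵇ : {n : ℕ} → ℕ → List (Mat n) → Bool
  minRankAtLeastᵇ d S = all (λ M → isZeroMᵇ M ∨ rankAtLeastᵇ d M) S

  kSubspaces : (n k : ℕ) → List (List (Mat n))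
  kSubspaces n k =
    filterᵇ (λ S → isSubspaceᵇ S ∧ hasDimᵇ k S) (sublists (Alt n))

-- a / b as a rational (0 if b = 0; never used with b = 0 in the theorem)
ratio : ℕ → ℕ → ℚ
ratio a zero    = ℚ.0ℚ
ratio a (suc b) = (+ a) ℚ./ (suc b)

δAlt : FiniteField → (n k d : ℕ) → ℚ
δAlt F n k d =
  ratio (length (filterᵇ (minRankAtLeastᵇ d) (kSubspaces n k)))
        (length (kSubspaces n k))
  where open LinAlg F

powℤ : ℕ → ℤ → ℚ
powℤ q (+ m)     = ratio (q ℕ.^ m) 1
powℤ q -[1+ m ]  = ratio 1 (q ℕ.^ suc m)

threshold : (n d : ℕ) → ℤ
threshold n d =
  (+ (n ℕ.* (n ℕ.∸ 1) ℕ./ 2)) ℤ.+ (+ 1)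
  ℤ.- (+ ((d ℕ.∸ 2) ℕ.* n)) ℤ.+ (+ ((d ℕ.∸ 1) ℕ.* (d ℕ.∸ 2) ℕ./ 2))

{-# OPTIONS --safe #-}
module Submission where

-- Put q = |F|, N = n(n-1)/2, and let T be the set of alternating matrices of rank below d = 2(s+1), 0 included.
--
-- Every k-dimensional subspace of Alt_n has the same number of bases, so up to constant factors the density and its
-- complement are the proportions of k-tuples v of alternating matrices for which no, respectively some, nontrivial
-- linear combination lies in T; here combinations may be normalised to have leading coefficient 1.
-- * The expected number of normalised combinations in T is at most k q^(k-1) |T| / q^N. This bounds the complement,
--   and with T = {0} it shows that most tuples are independent.
-- * The combinations v₀ + Σ cᵢ vᵢ are uniformly distributed and pairwise independent for distinct c, so Chebyshev's
--   inequality bounds the proportion of tuples for which none of them lies in T by q^N / (q^(k-1) |T|).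
-- * Splitting off a nonzero entry of the first row by a Schur complement lowers the rank by 2 and the size by 2.
--   This recursion gives |T| ≍ q^r, where r = dimLow s n is the dimension of the corresponding determinantal variety,
--   and N + 1 - r is the threshold.

open import Defs
open import Algebra.Bundles using (CommutativeRing; AbelianGroup)
import Algebra.Properties.AbelianGroup as AbelianGroupₚ
import Algebra.Properties.CommutativeSemigroup as CommutativeSemigroupₚ
import Algebra.Properties.Ring as Ringₚ
open import Data.Bool using (Bool; true; false; not; T; T?; _∧_; _∨_)
open import Data.Bool.ListAction using (all; any)
open import Data.Bool.Properties using (T-∨; T-∧)
open import Data.Empty using (⊥; ⊥-elim)
open import Data.Fin as Fin using (Fin; zero; suc; punchIn; punchOut)
open import Data.Fin.Properties using (punchIn-punchOut; any?)
import Data.Integer.Properties as ℤₚ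
import Data.Integer.Solver as ℤSolver
open import Data.List using (List; []; _∷_; _++_; map; length; filterᵇ; allFin; foldr; cartesianProduct; cartesianProductWith)
open import Data.List.Membership.Propositional using (_∈_; find; lose)
open import Data.List.Membership.Propositional.Properties
import Data.List.Properties as Listₚ
open import Data.List.Relation.Unary.All as All using (All; []; _∷_)
import Data.List.Relation.Unary.All.Properties as Allₚ
open import Data.List.Relation.Unary.AllPairs as AllPairs using (AllPairs; []; _∷_)
import Data.List.Relation.Unary.AllPairs.Properties as AllPairsₚ
open import Data.List.Relation.Unary.Any as Any using (here; there; _─_)
import Data.List.Relation.Unary.Any.Properties as Anyₚ
open import Data.List.Relation.Unary.Unique.Propositional using (Unique)
import Data.List.Relation.Unary.Unique.Propositional.Properties as Uniqueₚ
open import Data.Nat as ℕ using (ℕ; zero; suc; _≤_; _<_; _/_; _∸_; _*_; _+_; _^_; z≤n; s≤s)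
open import Data.Nat.DivMod using (m*n/n≡m; /-monoˡ-≤)
open import Data.Nat.Properties hiding (_≟_)
open import Data.Nat.Solver using (module +-*-Solver)
open import Data.Product using (∃; _×_; _,_; proj₁; proj₂)
open import Data.Rational as ℚ using (ℚ; 0ℚ; 1ℚ; mkℚ; toℚᵘ)
import Data.Rational.Properties as ℚₚ
open import Data.Rational.Unnormalised as ℚᵘ using (mkℚᵘ; *≤*; *≡*)
import Data.Rational.Unnormalised.Properties as ℚᵘₚ
open import Data.Sum using (_⊎_; inj₁; inj₂; [_,_]′)
open import Data.Vec as Vec using (Vec; []; _∷_; lookup)
import Data.Vec.Properties as Vecₚ
open import Function using (_∘_; Equivalence)
open import Relation.Binary.PropositionalEquality
open import Relation.Nullary using (¬_; yes; no; Dec; ⌊_⌋)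
open import Relation.Nullary.Decidable using (toWitness; fromWitness; ¬?; _×-dec_; decidable-stable)

open Equivalence using (to; from)

-- All estimates are inequalities between natural numbers whose constants depend on n, k and d only,
-- so one bound on q serves every field; rationals and integer exponents appear only in the final
-- translation. The obstacle is that `Mat n` is a function type: without function extensionality,
-- `Alt n` and `kSubspaces n k` can be handled as complete and duplicate-free only up to pointwise
-- equality. The probabilistic part therefore lives in `Vec K (tri n)`, where equality is decidable
-- and every vector is listed exactly; subspaces enter through membership and through a double count
-- of pairs (subspace, basis). The first moment needs the upper bound for |T|, the second moment the
-- lower one. The second moment yields both the O-estimate and the limit 0, its bound being a
-- constant times q^(threshold - k); the first yields the limit 1, its bound being a constant times
-- q^(k - threshold). Passing from tuples to subspaces costs a factor 4 once q ≥ 2k, because then at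
-- least half of all k-tuples are independent, both in Alt_n and in a k-dimensional space.

private variable
  A₁ A₂ A₃ : Set

-- Finite sums over lists, indicators, and comparison of sums by matching.

∑ : List A₁ → (A₁ → ℕ) → ℕ
∑ []       f = 0
∑ (x ∷ xs) f = f x + ∑ xs f

𝟙 : Bool → ℕ
𝟙 true  = 1
𝟙 false = 0

𝟙≤1 : ∀ b → 𝟙 b ≤ 1
𝟙≤1 true  = ≤-refl
𝟙≤1 false = z≤n

𝟙-mono : ∀ {a b} → (T a → T b) → 𝟙 a ≤ 𝟙 b
𝟙-mono {false}         h = z≤n
𝟙-mono {true}  {true}  h = ≤-refl
𝟙-mono {true}  {false} h = ⊥-elim (h _)

∑-mono-∈ : ∀ (xs : List A₁) {f g : A₁ → ℕ} → (∀ {x} → x ∈ xs → f x ≤ g x) → ∑ xs f ≤ ∑ xs g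
∑-mono-∈ []       h = z≤n
∑-mono-∈ (x ∷ xs) h = +-mono-≤ (h (here refl)) (∑-mono-∈ xs (λ p → h (there p)))

∑-mono : ∀ (xs : List A₁) {f g : A₁ → ℕ} → (∀ x → f x ≤ g x) → ∑ xs f ≤ ∑ xs g
∑-mono xs h = ∑-mono-∈ xs (λ {x} _ → h x)

∑-cong : ∀ (xs : List A₁) {f g : A₁ → ℕ} → (∀ x → f x ≡ g x) → ∑ xs f ≡ ∑ xs g
∑-cong []       h = refl
∑-cong (x ∷ xs) h = cong₂ _+_ (h x) (∑-cong xs h)

∑-const : ∀ (xs : List A₁) c → ∑ xs (λ _ → c) ≡ length xs * c
∑-const []       c = refl
∑-const (x ∷ xs) c = cong (c +_) (∑-const xs c)

∑-+ : ∀ (xs : List A₁) (f g : A₁ → ℕ) → ∑ xs (λ x → f x + g x) ≡ ∑ xs f + ∑ xs g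
∑-+ []       f g = refl
∑-+ (x ∷ xs) f g = trans (cong (f x + g x +_) (∑-+ xs f g)) (CommutativeSemigroupₚ.interchange +-commutativeSemigroup (f x) (g x) (∑ xs f) (∑ xs g))

∑-*ˡ : ∀ (xs : List A₁) c (f : A₁ → ℕ) → ∑ xs (λ x → c * f x) ≡ c * ∑ xs f
∑-*ˡ []       c f = sym (*-zeroʳ c)
∑-*ˡ (x ∷ xs) c f = trans (cong (c * f x +_) (∑-*ˡ xs c f)) (sym (*-distribˡ-+ c (f x) (∑ xs f)))

∑-*ʳ : ∀ (xs : List A₁) c (f : A₁ → ℕ) → ∑ xs (λ x → f x * c) ≡ ∑ xs f * c
∑-*ʳ xs c f = trans (∑-cong xs (λ x → *-comm (f x) c)) (trans (∑-*ˡ xs c f) (*-comm c (∑ xs f)))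

∑-zero : ∀ (xs : List A₁) → ∑ xs (λ _ → 0) ≡ 0
∑-zero xs = trans (∑-const xs 0) (*-zeroʳ (length xs))

∑-swap : ∀ (xs : List A₁) (ys : List A₂) (f : A₁ → A₂ → ℕ) →
         ∑ xs (λ x → ∑ ys (f x)) ≡ ∑ ys (λ y → ∑ xs (λ x → f x y))
∑-swap []       ys f = sym (∑-zero ys)
∑-swap (x ∷ xs) ys f = trans (cong (∑ ys (f x) +_) (∑-swap xs ys f)) (sym (∑-+ ys (f x) _))

∑-++ : ∀ (xs ys : List A₁) (f : A₁ → ℕ) → ∑ (xs ++ ys) f ≡ ∑ xs f + ∑ ys f
∑-++ []       ys f = refl
∑-++ (x ∷ xs) ys f = trans (cong (f x +_) (∑-++ xs ys f)) (sym (+-assoc (f x) _ _))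

∑-map : ∀ (h : A₁ → A₂) (xs : List A₁) (f : A₂ → ℕ) → ∑ (map h xs) f ≡ ∑ xs (λ x → f (h x))
∑-map h []       f = refl
∑-map h (x ∷ xs) f = cong (f (h x) +_) (∑-map h xs f)

∑-product : ∀ (h : A₁ → A₂ → A₃) xs ys (f : A₃ → ℕ) →
            ∑ (cartesianProductWith h xs ys) f ≡ ∑ xs (λ x → ∑ ys (λ y → f (h x y)))
∑-product h []       ys f = refl
∑-product h (x ∷ xs) ys f =
  trans (∑-++ (map (h x) ys) _ f) (cong₂ _+_ (∑-map (h x) ys f) (∑-product h xs ys f))

∑-1 : ∀ (xs : List A₁) → ∑ xs (λ _ → 1) ≡ length xs
∑-1 xs = trans (∑-const xs 1) (*-identityʳ (length xs))

∑-filterᵇ : ∀ (p : A₁ → Bool) xs (f : A₁ → ℕ) → ∑ (filterᵇ p xs) f ≡ ∑ xs (λ x → 𝟙 (p x) * f x)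
∑-filterᵇ p []       f = refl
∑-filterᵇ p (x ∷ xs) f with p x
... | true  = cong₂ _+_ (sym (+-identityʳ (f x))) (∑-filterᵇ p xs f)
... | false = ∑-filterᵇ p xs f

length-filterᵇ : ∀ (p : A₁ → Bool) xs → length (filterᵇ p xs) ≡ ∑ xs (λ x → 𝟙 (p x))
length-filterᵇ p xs = trans (sym (∑-1 (filterᵇ p xs)))
  (trans (∑-filterᵇ p xs (λ _ → 1)) (∑-cong xs (λ x → *-identityʳ (𝟙 (p x)))))

𝟙-not : ∀ b → 𝟙 (not b) + 𝟙 b ≡ 1
𝟙-not true  = refl
𝟙-not false = refl

∑-complement : ∀ (xs : List A₁) (p : A₁ → Bool) →
               ∑ xs (λ x → 𝟙 (not (p x))) + ∑ xs (λ x → 𝟙 (p x)) ≡ length xs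
∑-complement xs p = trans (sym (∑-+ xs _ _)) (trans (∑-cong xs (λ x → 𝟙-not (p x))) (∑-1 xs))

∑-∈ : ∀ {xs : List A₁} (f : A₁ → ℕ) {x} → x ∈ xs → f x ≤ ∑ xs f
∑-∈ f (here refl)            = m≤m+n _ _
∑-∈ f (there {x = y} x∈xs) = ≤-trans (∑-∈ f x∈xs) (m≤n+m _ (f y))

∑-─ : ∀ {xs : List A₁} {x} (p : x ∈ xs) (f : A₁ → ℕ) → ∑ xs f ≡ f x + ∑ (xs ─ p) f
∑-─ (here refl) f = refl
∑-─ {xs = y ∷ xs} {x} (there p) f = trans (cong (f y +_) (∑-─ p f))
  (trans (sym (+-assoc (f y) (f x) _)) (trans (cong (_+ ∑ (xs ─ p) f) (+-comm (f y) (f x))) (+-assoc (f x) (f y) _)))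

∈-─ : ∀ {xs : List A₁} {x y} (p : x ∈ xs) → y ∈ xs → y ≡ x ⊎ y ∈ (xs ─ p)
∈-─ (here refl) (here refl) = inj₁ refl
∈-─ (here refl) (there q)   = inj₂ q
∈-─ (there p)   (here refl) = inj₂ (here refl)
∈-─ (there p)   (there q) with ∈-─ p q
... | inj₁ e = inj₁ e
... | inj₂ r = inj₂ (there r)

-- Greedy matching: the partner of the head is deleted from `ys`, and the `AllPairs` condition
-- guarantees that no later element wants it. A relation is used instead of a function, so only a
-- code that determines `x` is needed; elements of weight 0 may stay unmatched.
∑-inject : ∀ {A₁ A₂ : Set} (R : A₁ → A₂ → Set) (f : A₁ → ℕ) (g : A₂ → ℕ) xs ys →
           (∀ {x} → x ∈ xs → f x ≡ 0 ⊎ ∃ λ y → y ∈ ys × R x y × f x ≤ g y) →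
           AllPairs (λ x x′ → ∀ y → R x y → R x′ y → ⊥) xs →
           ∑ xs f ≤ ∑ ys g
∑-inject R f g []       ys match []       = z≤n
∑-inject R f g (x ∷ xs) ys match (d ∷ ds) with match (here refl)
... | inj₁ fx≡0 rewrite fx≡0 = ∑-inject R f g xs ys (λ p → match (there p)) ds
... | inj₂ (y , y∈ys , Rxy , fx≤gy) rewrite ∑-─ y∈ys g =
  +-mono-≤ fx≤gy (∑-inject R f g xs (ys ─ y∈ys) match′ ds)
  where
  match′ : ∀ {x′} → x′ ∈ xs → f x′ ≡ 0 ⊎ ∃ λ y′ → y′ ∈ (ys ─ y∈ys) × R x′ y′ × f x′ ≤ g y′
  match′ p with match (there p)
  ... | inj₁ e = inj₁ e
  ... | inj₂ (y′ , y′∈ys , Rx′y′ , le) with ∈-─ y∈ys y′∈ys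
  ...   | inj₁ refl = ⊥-elim (All.lookup d p y Rxy Rx′y′)
  ...   | inj₂ q    = inj₂ (y′ , q , Rx′y′ , le)

-- All elements satisfying `p` compete for the single entry of a one-element list.
∑-atMostOne : ∀ (xs : List A₁) (p : A₁ → Bool) →
              AllPairs (λ x y → T (p x) → T (p y) → ⊥) xs → ∑ xs (λ x → 𝟙 (p x)) ≤ 1
∑-atMostOne xs p d = ∑-inject {A₂ = ℕ} (λ x _ → T (p x)) (λ x → 𝟙 (p x)) (λ _ → 1) xs (0 ∷ []) match
  (AllPairs.map (λ h _ → h) d)
  where
  match : ∀ {x} → x ∈ xs → 𝟙 (p x) ≡ 0 ⊎ ∃ λ y → y ∈ (0 ∷ []) × T (p x) × 𝟙 (p x) ≤ 1
  match {x} _ with p x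
  ... | true  = inj₂ (0 , here refl , _ , ≤-refl)
  ... | false = inj₁ refl

-- Exact enumerations of finite types.

record Enum (A₁ : Set) : Set where
  field
    els      : List A₁
    complete : ∀ x → x ∈ els
    unique   : Unique els

open Enum

∑-injective : (E : Enum A₁) (E′ : Enum A₂) (f : A₁ → ℕ) (g : A₂ → ℕ) (φ : A₁ → A₂) →
              (∀ x y → φ x ≡ φ y → x ≡ y) → (∀ x → f x ≤ g (φ x)) →
              ∑ (els E) f ≤ ∑ (els E′) g
∑-injective E E′ f g φ inj le = ∑-inject (λ x y → φ x ≡ y) f g (els E) (els E′)
  (λ {x} _ → inj₂ (φ x , complete E′ (φ x) , refl , le x))
  (AllPairs.map (λ x≢y z p q → x≢y (inj _ _ (trans p (sym q)))) (unique E))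

∑-bijective : (E : Enum A₁) (f : A₁ → ℕ) (φ ψ : A₁ → A₁) →
              (∀ x → ψ (φ x) ≡ x) → (∀ x → φ (ψ x) ≡ x) → ∑ (els E) (λ x → f (φ x)) ≡ ∑ (els E) f
∑-bijective E f φ ψ ψφ φψ = ≤-antisym
  (∑-injective E E _ f φ (λ x y p → trans (sym (ψφ x)) (trans (cong ψ p) (ψφ y))) (λ _ → ≤-refl))
  (∑-injective E E f _ ψ (λ x y p → trans (sym (φψ x)) (trans (cong φ p) (φψ y)))
    (λ x → ≤-reflexive (cong f (sym (φψ x)))))

enumVec : Enum A₁ → ∀ n → Enum (Vec A₁ n)
enumVec E zero    = record
  { els = [] ∷ [] ; complete = λ { [] → here refl } ; unique = [] ∷ [] }
enumVec E (suc n) = record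
  { els      = cartesianProductWith _∷_ (els E) (els (enumVec E n))
  ; complete = λ { (x ∷ v) → ∈-cartesianProductWith⁺ _∷_ (complete E x) (complete (enumVec E n) v) }
  ; unique   = Uniqueₚ.cartesianProductWith⁺ _∷_ Vecₚ.∷-injective (unique E) (unique (enumVec E n))
  }

∑-Vec : (E : Enum A₁) → ∀ n (f : Vec A₁ (suc n) → ℕ) →
        ∑ (els (enumVec E (suc n))) f ≡ ∑ (els E) (λ x → ∑ (els (enumVec E n)) (λ v → f (x ∷ v)))
∑-Vec E n f = ∑-product _∷_ (els E) (els (enumVec E n)) f

size : Enum A₁ → ℕ
size E = length (els E)

size-Vec : (E : Enum A₁) → ∀ n → size (enumVec E n) ≡ size E ^ n
size-Vec E zero    = refl
size-Vec E (suc n) = begin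
  size (enumVec E (suc n))                      ≡⟨ ∑-1 (els (enumVec E (suc n))) ⟨
  ∑ (els (enumVec E (suc n))) (λ _ → 1)         ≡⟨ ∑-Vec E n _ ⟩
  ∑ (els E) (λ _ → ∑ (els (enumVec E n)) (λ _ → 1)) ≡⟨ ∑-cong (els E) (λ _ → trans (∑-1 (els (enumVec E n))) (size-Vec E n)) ⟩
  ∑ (els E) (λ _ → size E ^ n)                  ≡⟨ ∑-const (els E) _ ⟩
  size E * size E ^ n                           ∎
  where open ≡-Reasoning

-- Boolean quantifiers and the list `allFuns`.

T-all : ∀ (p : A₁ → Bool) xs → T (all p xs) → ∀ {x} → x ∈ xs → T (p x)
T-all p xs h = All.lookup (Allₚ.all⁺ p xs h)

all-T : ∀ (p : A₁ → Bool) xs → (∀ {x} → x ∈ xs → T (p x)) → T (all p xs)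
all-T p xs h = Allₚ.all⁻ p {xs} (All.tabulate h)

T-any : ∀ (p : A₁ → Bool) xs → T (any p xs) → ∃ λ x → x ∈ xs × T (p x)
T-any p xs h = find (Anyₚ.any⁻ p xs h)

any-T : ∀ (p : A₁ → Bool) {xs x} → x ∈ xs → T (p x) → T (any p xs)
any-T p x∈xs h = Anyₚ.any⁺ p (lose x∈xs h)

T-not : ∀ {b} → ¬ T b → T (not b)
T-not {true}  h = ⊥-elim (h _)
T-not {false} h = _

not-T : ∀ {b} → T (not b) → ¬ T b
not-T {true} ()

-- A function is listed only up to pointwise agreement. The relation `R` is arbitrary so that the
-- lemma can be iterated: for matrices it is applied to rows that are themselves only pointwise
-- equal.
allFuns-complete : ∀ {A₁ A₂ : Set} (R : A₁ → A₂ → Set) (xs : List A₁) m (f : Fin m → A₂) →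
                   (∀ i → ∃ λ a → a ∈ xs × R a (f i)) → ∃ λ g → g ∈ allFuns xs m × ∀ i → R (g i) (f i)
allFuns-complete R xs zero    f h = _ , here refl , λ ()
allFuns-complete R xs (suc m) f h =
  let a , a∈xs , Ra     = h zero
      g , g∈ , Rg       = allFuns-complete R xs m (f ∘ suc) (h ∘ suc)
  in _ , ∈-concatMap⁺ _ (lose a∈xs (∈-map⁺ _ g∈)) , λ { zero → Ra ; (suc i) → Rg i }

allFuns-sound : ∀ (xs : List A₁) m {g} → g ∈ allFuns xs m → ∀ i → g i ∈ xs
allFuns-sound xs zero    g∈ ()
allFuns-sound xs (suc m) g∈ i with find (∈-concatMap⁻ _ {xs = xs} g∈)
... | a , a∈xs , p with ∈-map⁻ _ p
... | f , f∈ , refl with i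
...   | zero  = a∈xs
...   | suc j = allFuns-sound xs m f∈ j

-- The binomial coefficient n(n-1)/2, in the recursive form that splits off the first row of an
-- alternating matrix.
tri : ℕ → ℕ
tri zero    = 0
tri (suc n) = n + tri n

-- `dbl (suc s)` unfolds to `2 + dbl s`, so the drop of the rank by 2 under a Schur complement is
-- visible to the type checker.
dbl : ℕ → ℕ
dbl zero    = 0
dbl (suc s) = 2 + dbl s

-- The dimension of the variety of alternating n × n matrices of rank at most 2 s, for 2 s ≤ n.
dimLow : ℕ → ℕ → ℕ
dimLow zero    n             = 0
dimLow (suc s) zero          = 0
dimLow (suc s) (suc zero)    = 0
dimLow (suc s) (suc (suc n)) = suc n + n + dimLow s n

dimLow-mono : ∀ s n → dimLow s n ≤ dimLow s (suc n)
dimLow-mono zero    n             = z≤n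
dimLow-mono (suc s) zero          = z≤n
dimLow-mono (suc s) (suc zero)    = z≤n
dimLow-mono (suc s) (suc (suc n)) = +-mono-≤ (+-mono-≤ (n≤1+n (suc n)) (n≤1+n n)) (dimLow-mono s n)

-- The number of involutions of n points. Its recurrence is that of `count-low-step` with the powers
-- of q removed, which makes it the constant of the upper bound for |T|.
involutions : ℕ → ℕ
involutions zero          = 1
involutions (suc zero)    = 1
involutions (suc (suc n)) = involutions (suc n) + suc n * involutions n

-- Vectors over a finite field and their linear combinations.

module Field (F : FiniteField) where

  open FiniteField F using (elements; _≟_; inverse; 0≢1)
    renaming (Carrier to K; _+_ to infixl 6 _⊕_; _*_ to infixl 7 _⊗_; -_ to infix 8 ⊖_; 0# to 𝟘; 1# to 𝟏)

  commutativeRing : CommutativeRing _ _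
  commutativeRing = record { isCommutativeRing = FiniteField.isCommutativeRing F }

  module R = CommutativeRing commutativeRing
  module Rₚ = Ringₚ R.ring

  enumK : Enum K
  enumK = record { els = elements ; complete = FiniteField.complete F ; unique = FiniteField.unique F }

  q : ℕ
  q = card F

  2≤q : 2 ≤ q
  2≤q = ≤-trans (≤-reflexive (sym (size-Vec₂))) (≤-trans le (≤-reflexive (∑-1 elements)))
    where
    enumBool : Enum Bool
    enumBool = record { els = true ∷ false ∷ []
                      ; complete = λ { true → here refl ; false → there (here refl) }
                      ; unique = ((λ ()) ∷ []) ∷ [] ∷ [] }
    size-Vec₂ : ∑ (els enumBool) (λ _ → 1) ≡ 2
    size-Vec₂ = refl
    embed : Bool → K
    embed true  = 𝟏
    embed false = 𝟘
    le : ∑ (els enumBool) (λ _ → 1) ≤ ∑ elements (λ _ → 1)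
    le = ∑-injective enumBool enumK _ _ embed
      (λ { true true _ → refl ; true false e → ⊥-elim (0≢1 (sym e))
         ; false true e → ⊥-elim (0≢1 e) ; false false _ → refl }) (λ _ → ≤-refl)

  -- Total, with the default value 𝟘 at 𝟘, so that Schur complements can be formed and compared
  -- without carrying a proof that the pivot is nonzero.
  inv : K → K
  inv x with x ≟ 𝟘
  ... | yes _  = 𝟘
  ... | no x≢0 = proj₁ (inverse x x≢0)

  inv-inverseʳ : ∀ {x} → x ≢ 𝟘 → x ⊗ inv x ≡ 𝟏
  inv-inverseʳ {x} x≢0 with x ≟ 𝟘
  ... | yes x≡0 = ⊥-elim (x≢0 x≡0)
  ... | no p    = proj₂ (inverse x p)

  inv-inverseˡ : ∀ {x} → x ≢ 𝟘 → inv x ⊗ x ≡ 𝟏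
  inv-inverseˡ {x} x≢0 = trans (R.*-comm (inv x) x) (inv-inverseʳ x≢0)

  ⊗-cancelˡ-𝟘 : ∀ {a x} → a ≢ 𝟘 → a ⊗ x ≡ 𝟘 → x ≡ 𝟘
  ⊗-cancelˡ-𝟘 {a} {x} a≢0 ax≡0 = begin
    x                 ≡⟨ R.*-identityˡ x ⟨
    𝟏 ⊗ x             ≡⟨ cong (_⊗ x) (inv-inverseˡ a≢0) ⟨
    inv a ⊗ a ⊗ x     ≡⟨ R.*-assoc _ _ _ ⟩
    inv a ⊗ (a ⊗ x)   ≡⟨ cong (inv a ⊗_) ax≡0 ⟩
    inv a ⊗ 𝟘         ≡⟨ R.zeroʳ _ ⟩
    𝟘                 ∎
    where open ≡-Reasoning

  infixl 6 _+ⱽ_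
  infixr 7 _·_

  _+ⱽ_ : ∀ {N} → Vec K N → Vec K N → Vec K N
  _+ⱽ_ = Vec.zipWith _⊕_

  -ⱽ_ : ∀ {N} → Vec K N → Vec K N
  -ⱽ_ = Vec.map ⊖_

  0ⱽ : ∀ {N} → Vec K N
  0ⱽ = Vec.replicate _ 𝟘

  _·_ : ∀ {N} → K → Vec K N → Vec K N
  c · x = Vec.map (c ⊗_) x

  +ⱽ-abelianGroup : ℕ → AbelianGroup _ _
  +ⱽ-abelianGroup N = record
    { Carrier = Vec K N ; _≈_ = _≡_ ; _∙_ = _+ⱽ_ ; ε = 0ⱽ ; _⁻¹ = -ⱽ_
    ; isAbelianGroup = record
      { isGroup = record
        { isMonoid = record
          { isSemigroup = record
            { isMagma = record { isEquivalence = isEquivalence ; ∙-cong = cong₂ _+ⱽ_ }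
            ; assoc = Vecₚ.zipWith-assoc R.+-assoc }
          ; identity = Vecₚ.zipWith-identityˡ R.+-identityˡ , Vecₚ.zipWith-identityʳ R.+-identityʳ }
        ; inverse = Vecₚ.zipWith-inverseˡ R.-‿inverseˡ , Vecₚ.zipWith-inverseʳ R.-‿inverseʳ
        ; ⁻¹-cong = cong -ⱽ_ }
      ; comm = Vecₚ.zipWith-comm R.+-comm } }

  module V {N : ℕ} = AbelianGroup (+ⱽ-abelianGroup N)
  module Vₚ {N : ℕ} = AbelianGroupₚ (+ⱽ-abelianGroup N)

  ·-distribˡ : ∀ {N} c (x y : Vec K N) → c · (x +ⱽ y) ≡ c · x +ⱽ c · y
  ·-distribˡ c []      []      = refl
  ·-distribˡ c (a ∷ x) (b ∷ y) = cong₂ _∷_ (R.distribˡ c a b) (·-distribˡ c x y)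

  ·-distribʳ : ∀ {N} c d (x : Vec K N) → (c ⊕ d) · x ≡ c · x +ⱽ d · x
  ·-distribʳ c d []      = refl
  ·-distribʳ c d (a ∷ x) = cong₂ _∷_ (R.distribʳ a c d) (·-distribʳ c d x)

  ·-assoc : ∀ {N} c d (x : Vec K N) → (c ⊗ d) · x ≡ c · (d · x)
  ·-assoc c d []      = refl
  ·-assoc c d (a ∷ x) = cong₂ _∷_ (R.*-assoc c d a) (·-assoc c d x)

  ·-identity : ∀ {N} (x : Vec K N) → 𝟏 · x ≡ x
  ·-identity []      = refl
  ·-identity (a ∷ x) = cong₂ _∷_ (R.*-identityˡ a) (·-identity x)

  ·-zeroˡ : ∀ {N} (x : Vec K N) → 𝟘 · x ≡ 0ⱽ
  ·-zeroˡ []      = refl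
  ·-zeroˡ (a ∷ x) = cong₂ _∷_ (R.zeroˡ a) (·-zeroˡ x)

  ·-zeroʳ : ∀ N c → c · 0ⱽ {N} ≡ 0ⱽ
  ·-zeroʳ zero    c = refl
  ·-zeroʳ (suc N) c = cong₂ _∷_ (R.zeroʳ c) (·-zeroʳ N c)

  ·-invˡ : ∀ {N c} → c ≢ 𝟘 → (x : Vec K N) → inv c · (c · x) ≡ x
  ·-invˡ {c = c} c≢0 x = trans (sym (·-assoc (inv c) c x)) (trans (cong (_· x) (inv-inverseˡ c≢0)) (·-identity x))

  ·-invʳ : ∀ {N c} → c ≢ 𝟘 → (x : Vec K N) → c · (inv c · x) ≡ x
  ·-invʳ {c = c} c≢0 x = trans (sym (·-assoc c (inv c) x)) (trans (cong (_· x) (inv-inverseʳ c≢0)) (·-identity x))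

  L : ∀ {N k} → Vec K k → Vec (Vec K N) k → Vec K N
  L []       []       = 0ⱽ
  L (c ∷ cs) (v ∷ vs) = c · v +ⱽ L cs vs

  L-zero : ∀ {N k} (v : Vec (Vec K N) k) → L 0ⱽ v ≡ 0ⱽ
  L-zero []       = refl
  L-zero (v ∷ vs) = trans (cong₂ _+ⱽ_ (·-zeroˡ v) (L-zero vs)) (V.identityˡ 0ⱽ)

  interchangeⱽ : ∀ {N} (a b c d : Vec K N) → (a +ⱽ b) +ⱽ (c +ⱽ d) ≡ (a +ⱽ c) +ⱽ (b +ⱽ d)
  interchangeⱽ a b c d = begin
    (a +ⱽ b) +ⱽ (c +ⱽ d) ≡⟨ V.assoc a b _ ⟩
    a +ⱽ (b +ⱽ (c +ⱽ d)) ≡⟨ cong (a +ⱽ_) (V.assoc b c d) ⟨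
    a +ⱽ ((b +ⱽ c) +ⱽ d) ≡⟨ cong (λ z → a +ⱽ (z +ⱽ d)) (V.comm b c) ⟩
    a +ⱽ ((c +ⱽ b) +ⱽ d) ≡⟨ cong (a +ⱽ_) (V.assoc c b d) ⟩
    a +ⱽ (c +ⱽ (b +ⱽ d)) ≡⟨ V.assoc a c _ ⟨
    (a +ⱽ c) +ⱽ (b +ⱽ d) ∎
    where open ≡-Reasoning

  L-+ : ∀ {N k} (c d : Vec K k) (v : Vec (Vec K N) k) → L (c +ⱽ d) v ≡ L c v +ⱽ L d v
  L-+ []       []       []       = sym (V.identityˡ 0ⱽ)
  L-+ (c ∷ cs) (d ∷ ds) (v ∷ vs) =
    trans (cong₂ _+ⱽ_ (·-distribʳ c d v) (L-+ cs ds vs)) (interchangeⱽ _ _ _ _)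

  L-· : ∀ {N k} a (c : Vec K k) (v : Vec (Vec K N) k) → L (a · c) v ≡ a · L c v
  L-· a []       []       = sym (·-zeroʳ _ a)
  L-· a (c ∷ cs) (v ∷ vs) =
    trans (cong₂ _+ⱽ_ (·-assoc a c v) (L-· a cs vs)) (sym (·-distribˡ a _ _))

  L-L : ∀ {N k l} (c : Vec K l) (A : Vec (Vec K k) l) (b : Vec (Vec K N) k) →
        L (L c A) b ≡ L c (Vec.map (λ a → L a b) A)
  L-L []       []      b = L-zero b
  L-L (c ∷ cs) (a ∷ A) b = trans (L-+ (c · a) (L cs A) b) (cong₂ _+ⱽ_ (L-· c a b) (L-L cs A b))

  -- Random tuples: first and second moment.

  _≟ⱽ_ : ∀ {N} (x y : Vec K N) → Dec (x ≡ y)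
  _≟ⱽ_ = Vecₚ.≡-dec _≟_

  enumK^ : ∀ N → Enum (Vec K N)
  enumK^ = enumVec enumK

  vectors : ∀ N → List (Vec K N)
  vectors N = els (enumK^ N)

  tuples : ∀ N k → List (Vec (Vec K N) k)
  tuples N k = els (enumVec (enumK^ N) k)

  ∑-translate : ∀ {N} (f : Vec K N → ℕ) a → ∑ (vectors N) (λ x → f (x +ⱽ a)) ≡ ∑ (vectors N) f
  ∑-translate f a = ∑-bijective (enumK^ _) f (_+ⱽ a) (_+ⱽ (-ⱽ a))
    (λ x → Vₚ.//-rightDividesʳ a x) (λ x → Vₚ.//-rightDividesˡ a x)

  ∑-scale : ∀ {N} (f : Vec K N → ℕ) {c} → c ≢ 𝟘 → ∑ (vectors N) (λ x → f (c · x)) ≡ ∑ (vectors N) f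
  ∑-scale f {c} c≢0 = ∑-bijective (enumK^ _) f (c ·_) (inv c ·_) (·-invˡ c≢0) (·-invʳ c≢0)

  -- The recursion runs over the position of the leading coefficient, which is fixed to 1. The empty
  -- tuple is never hit, so the zero combination is excluded.
  hits : ∀ {N k} → (Vec K N → Bool) → Vec (Vec K N) k → Bool
  hits p []       = false
  hits p (v ∷ vs) = hits p vs ∨ any (λ c → p (v +ⱽ L c vs)) (vectors _)

  -- A nonzero coefficient vector can be rescaled so that its first nonzero entry is 1.
  hits-complete : ∀ {N k} (p : Vec K N → Bool) → (∀ a x → T (p x) → T (p (a · x))) →
                  (v : Vec (Vec K N) k) (c : Vec K k) → c ≢ 0ⱽ → T (p (L c v)) → T (hits p v)
  hits-complete p closed []       []       c≢0 h = ⊥-elim (c≢0 refl)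
  hits-complete p closed (v ∷ vs) (c ∷ cs) c≢0 h with c ≟ 𝟘
  ... | yes refl = from (T-∨ {hits p vs}) (inj₁ (hits-complete p closed vs cs (λ e → c≢0 (cong (𝟘 ∷_) e))
        (subst (T ∘ p) (trans (cong (_+ⱽ L cs vs) (·-zeroˡ v)) (V.identityˡ _)) h)))
  ... | no c≢𝟘   = from (T-∨ {hits p vs}) (inj₂ (any-T _ (complete (enumK^ _) (inv c · cs))
        (subst (T ∘ p) eq (closed (inv c) _ h))))
    where
    eq : inv c · (c · v +ⱽ L cs vs) ≡ v +ⱽ L (inv c · cs) vs
    eq = trans (·-distribˡ (inv c) _ _) (cong₂ _+ⱽ_ (·-invˡ c≢𝟘 v) (sym (L-· (inv c) cs vs)))

  hits-sound : ∀ {N k} (p : Vec K N → Bool) (v : Vec (Vec K N) k) → T (hits p v) →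
               ∃ λ c → c ≢ 0ⱽ × T (p (L c v))
  hits-sound p (v ∷ vs) h with to (T-∨ {hits p vs}) h
  ... | inj₁ h₁ = let c , c≢0 , pc = hits-sound p vs h₁ in
        𝟘 ∷ c , (λ e → c≢0 (Vecₚ.∷-injectiveʳ e)) ,
        subst (T ∘ p) (sym (trans (cong (_+ⱽ L c vs) (·-zeroˡ v)) (V.identityˡ _))) pc
  ... | inj₂ h₂ = let c , _ , pc = T-any (λ c → p (v +ⱽ L c vs)) (vectors _) h₂ in
        𝟏 ∷ c , (λ e → 0≢1 (sym (Vecₚ.∷-injectiveˡ e))) ,
        subst (T ∘ p) (cong (_+ⱽ L c vs) (sym (·-identity v))) pc

  count : ∀ {N} → (Vec K N → Bool) → ℕ
  count {N} p = ∑ (vectors N) (λ x → 𝟙 (p x))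

  size-vectors : ∀ N → length (vectors N) ≡ q ^ N
  size-vectors = size-Vec enumK

  size-tuples : ∀ N k → length (tuples N k) ≡ (q ^ N) ^ k
  size-tuples N k = trans (size-Vec (enumK^ N) k) (cong (_^ k) (size-vectors N))

  𝟙-any : ∀ {A : Set} (p : A → Bool) xs → 𝟙 (any p xs) ≤ ∑ xs (λ x → 𝟙 (p x))
  𝟙-any p []       = z≤n
  𝟙-any p (x ∷ xs) with p x
  ... | true  = s≤s z≤n
  ... | false = 𝟙-any p xs

  𝟙-∨ : ∀ a b → 𝟙 (a ∨ b) ≤ 𝟙 a + 𝟙 b
  𝟙-∨ true  b = s≤s z≤n
  𝟙-∨ false b = ≤-refl

  -- For a fixed tail, the leading vector is merely translated by `L c vs`; the leading coefficient
  -- 1 makes this work for every `c`, including 0.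
  ∑-normalised : ∀ {N m} (p : Vec K N → Bool) (c : Vec K m) →
         ∑ (vectors N) (λ v → ∑ (tuples N m) (λ vs → 𝟙 (p (v +ⱽ L c vs)))) ≡ (q ^ N) ^ m * count p
  ∑-normalised {N} {m} p c = begin
    ∑ (vectors N) (λ v → ∑ (tuples N m) (λ vs → 𝟙 (p (v +ⱽ L c vs)))) ≡⟨ ∑-swap (vectors N) (tuples N m) _ ⟩
    ∑ (tuples N m) (λ vs → ∑ (vectors N) (λ v → 𝟙 (p (v +ⱽ L c vs)))) ≡⟨ ∑-cong (tuples N m) (λ vs → ∑-translate (λ x → 𝟙 (p x)) (L c vs)) ⟩
    ∑ (tuples N m) (λ _ → count p)  ≡⟨ ∑-const (tuples N m) _ ⟩
    length (tuples N m) * count p   ≡⟨ cong (_* count p) (size-tuples N m) ⟩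
    (q ^ N) ^ m * count p ∎
    where open ≡-Reasoning

  hits-step : ∀ {N} (p : Vec K N → Bool) m →
    ∑ (tuples N (suc m)) (λ v → 𝟙 (hits p v)) ≤
    q ^ N * ∑ (tuples N m) (λ v → 𝟙 (hits p v)) + q ^ m * ((q ^ N) ^ m * count p)
  hits-step {N} p m = begin
    ∑ (tuples N (suc m)) (λ v → 𝟙 (hits p v))
      ≡⟨ ∑-Vec (enumK^ N) m _ ⟩
    ∑ Vs (λ v → ∑ Ts (λ vs → 𝟙 (hits p (v ∷ vs))))
      ≤⟨ ∑-mono Vs (λ v → ∑-mono Ts (λ vs → ≤-trans (𝟙-∨ (hits p vs) _) (+-monoʳ-≤ (𝟙 (hits p vs)) (𝟙-any _ (vectors m))))) ⟩
    ∑ Vs (λ v → ∑ Ts (λ vs → 𝟙 (hits p vs) + ∑ (vectors m) (λ c → 𝟙 (p (v +ⱽ L c vs)))))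
      ≡⟨ ∑-cong Vs (λ v → trans (∑-+ Ts _ _) (cong (H +_) (∑-swap Ts (vectors m) _))) ⟩
    ∑ Vs (λ v → H + ∑ (vectors m) (λ c → ∑ Ts (λ vs → 𝟙 (p (v +ⱽ L c vs)))))
      ≡⟨ ∑-+ Vs _ _ ⟩
    ∑ Vs (λ _ → H) + ∑ Vs (λ v → ∑ (vectors m) (λ c → ∑ Ts (λ vs → 𝟙 (p (v +ⱽ L c vs)))))
      ≡⟨ cong₂ _+_ (trans (∑-const Vs H) (cong (_* H) (size-vectors N))) (∑-swap Vs (vectors m) _) ⟩
    q ^ N * H + ∑ (vectors m) (λ c → ∑ Vs (λ v → ∑ Ts (λ vs → 𝟙 (p (v +ⱽ L c vs)))))
      ≡⟨ cong (q ^ N * H +_) (trans (∑-cong (vectors m) (λ c → ∑-normalised p c)) (trans (∑-const (vectors m) _) (cong (_* W) (size-vectors m)))) ⟩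
    q ^ N * H + q ^ m * W ∎
    where
    open ≤-Reasoning
    Vs = vectors N
    Ts = tuples N m
    H = ∑ Ts (λ v → 𝟙 (hits p v))
    W = (q ^ N) ^ m * count p

  1≤q : 1 ≤ q
  1≤q = ≤-trans (s≤s z≤n) 2≤q

  -- Union bound: there are `suc m` positions for the leading coefficient, and each leaves at most
  -- q^m choices for the later coefficients.
  first-moment : ∀ {N} (p : Vec K N → Bool) m →
    ∑ (tuples N (suc m)) (λ v → 𝟙 (hits p v)) ≤ suc m * (q ^ m * ((q ^ N) ^ m * count p))
  first-moment {N} p zero = ≤-trans (hits-step p 0) (≤-reflexive
    (trans (cong (_+ (1 * (1 * count p))) (*-zeroʳ (q ^ N))) (sym (*-identityˡ (1 * (1 * count p))))))
  first-moment {N} p (suc m) = begin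
    ∑ (tuples N (2 + m)) (λ v → 𝟙 (hits p v)) ≤⟨ hits-step p (suc m) ⟩
    Q * ∑ (tuples N (suc m)) (λ v → 𝟙 (hits p v)) + Y
      ≤⟨ +-monoˡ-≤ Y (*-monoʳ-≤ Q (first-moment p m)) ⟩
    Q * (suc m * (q ^ m * (Q ^ m * t))) + Y
      ≡⟨ cong (_+ Y) (solve 5 (λ Q n a b t → Q :* (n :* (a :* (b :* t))) := n :* (a :* (Q :* b :* t))) refl Q (suc m) (q ^ m) (Q ^ m) t) ⟩
    suc m * (q ^ m * (Q ^ suc m * t)) + Y
      -- Combinations supported on the tail are charged q^(m+1) instead of q^m, which makes all
      -- terms equal.
      ≤⟨ +-monoˡ-≤ Y (*-monoʳ-≤ (suc m) (*-monoˡ-≤ _ (≤-trans (≤-reflexive (sym (*-identityˡ (q ^ m)))) (*-monoˡ-≤ (q ^ m) 1≤q)))) ⟩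
    suc m * Y + Y ≡⟨ +-comm (suc m * Y) Y ⟩
    suc (suc m) * Y ∎
    where
    open ≤-Reasoning
    open +-*-Solver
    Q = q ^ N
    t = count p
    Y = q ^ suc m * (Q ^ suc m * t)

  -- The vector at the first nonzero coefficient of `d` is scaled and translated, hence already
  -- makes `L d vs` uniform. The factor q^N on the left avoids the exponent m - 1 on the right.
  ∑-uniform : ∀ {N m} (g : Vec K N → ℕ) (d : Vec K m) → d ≢ 0ⱽ → ∀ x →
    q ^ N * ∑ (tuples N m) (λ vs → g (x +ⱽ L d vs)) ≡ (q ^ N) ^ m * ∑ (vectors N) g
  ∑-uniform g []       d≢0 x = ⊥-elim (d≢0 refl)
  ∑-uniform {N} {suc m} g (d ∷ ds) d≢0 x with d ≟ 𝟘
  ... | yes refl = begin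
    Q * ∑ (tuples N (suc m)) (λ vs → g (x +ⱽ L (𝟘 ∷ ds) vs))
      ≡⟨ cong (Q *_) (∑-Vec (enumK^ N) m _) ⟩
    Q * ∑ Vs (λ w → ∑ Ts (λ vs → g (x +ⱽ (𝟘 · w +ⱽ L ds vs))))
      ≡⟨ cong (Q *_) (∑-cong Vs (λ w → ∑-cong Ts (λ vs → cong (λ z → g (x +ⱽ z)) (trans (cong (_+ⱽ L ds vs) (·-zeroˡ w)) (V.identityˡ _))))) ⟩
    Q * ∑ Vs (λ _ → ∑ Ts (λ vs → g (x +ⱽ L ds vs)))
      ≡⟨ cong (Q *_) (trans (∑-const Vs _) (cong (_* ∑ Ts (λ vs → g (x +ⱽ L ds vs))) (size-vectors N))) ⟩
    Q * (Q * ∑ Ts (λ vs → g (x +ⱽ L ds vs)))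
      ≡⟨ cong (Q *_) (∑-uniform g ds (λ e → d≢0 (cong (𝟘 ∷_) e)) x) ⟩
    Q * (Q ^ m * ∑ Vs g) ≡⟨ *-assoc Q _ _ ⟨
    Q ^ suc m * ∑ Vs g ∎
    where
    open ≡-Reasoning
    Q = q ^ N
    Vs = vectors N
    Ts = tuples N m
  ... | no d≢𝟘 = begin
    Q * ∑ (tuples N (suc m)) (λ vs → g (x +ⱽ L (d ∷ ds) vs))
      ≡⟨ cong (Q *_) (trans (∑-Vec (enumK^ N) m _) (∑-swap Vs Ts _)) ⟩
    Q * ∑ Ts (λ vs → ∑ Vs (λ w → g (x +ⱽ (d · w +ⱽ L ds vs))))
      ≡⟨ cong (Q *_) (∑-cong Ts (λ vs → ∑-cong Vs (λ w → cong g (rearrange w (L ds vs))))) ⟩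
    Q * ∑ Ts (λ vs → ∑ Vs (λ w → g (d · w +ⱽ (x +ⱽ L ds vs))))
      ≡⟨ cong (Q *_) (∑-cong Ts (λ vs → trans (∑-scale (λ y → g (y +ⱽ (x +ⱽ L ds vs))) d≢𝟘) (∑-translate g _))) ⟩
    Q * ∑ Ts (λ _ → ∑ Vs g)
      ≡⟨ cong (Q *_) (trans (∑-const Ts _) (cong (_* ∑ Vs g) (size-tuples N m))) ⟩
    Q * (Q ^ m * ∑ Vs g) ≡⟨ *-assoc Q _ _ ⟨
    Q ^ suc m * ∑ Vs g ∎
    where
    open ≡-Reasoning
    Q = q ^ N
    Vs = vectors N
    Ts = tuples N m
    rearrange : ∀ w b → x +ⱽ (d · w +ⱽ b) ≡ d · w +ⱽ (x +ⱽ b)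
    rearrange w b = trans (sym (V.assoc x _ b)) (trans (cong (_+ⱽ b) (V.comm x _)) (V.assoc _ x b))

  -- Translating `v` by `L c vs` turns the pair of combinations into `v` and `v +ⱽ L d vs` with `d`
  -- the nonzero difference of the coefficients; by `∑-uniform` the second is then uniform for each
  -- fixed `v`.
  pairwise-independent : ∀ {N m} (f g : Vec K N → ℕ) (c c′ : Vec K m) → c ≢ c′ →
    q ^ N * ∑ (vectors N) (λ v → ∑ (tuples N m) (λ vs → f (v +ⱽ L c vs) * g (v +ⱽ L c′ vs)))
    ≡ (q ^ N) ^ m * (∑ (vectors N) f * ∑ (vectors N) g)
  pairwise-independent {N} {m} f g c c′ c≢c′ = begin
    Q * ∑ Vs (λ v → ∑ Ts (λ vs → f (v +ⱽ L c vs) * g (v +ⱽ L c′ vs)))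
      ≡⟨ cong (Q *_) (∑-swap Vs Ts _) ⟩
    Q * ∑ Ts (λ vs → ∑ Vs (λ v → f (v +ⱽ L c vs) * g (v +ⱽ L c′ vs)))
      ≡⟨ cong (Q *_) (∑-cong Ts (λ vs → trans (∑-cong Vs (λ v → cong (λ z → f (v +ⱽ L c vs) * g z) (split v vs)))
           (∑-translate (λ z → f z * g (z +ⱽ L d vs)) (L c vs)))) ⟩
    Q * ∑ Ts (λ vs → ∑ Vs (λ v → f v * g (v +ⱽ L d vs)))
      ≡⟨ cong (Q *_) (trans (∑-swap Ts Vs _) (∑-cong Vs (λ v → ∑-*ˡ Ts (f v) _))) ⟩
    Q * ∑ Vs (λ v → f v * ∑ Ts (λ vs → g (v +ⱽ L d vs)))
      ≡⟨ ∑-*ˡ Vs Q _ ⟨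
    ∑ Vs (λ v → Q * (f v * ∑ Ts (λ vs → g (v +ⱽ L d vs))))
      ≡⟨ ∑-cong Vs (λ v → solve 3 (λ Q a b → Q :* (a :* b) := a :* (Q :* b)) refl Q (f v) _) ⟩
    ∑ Vs (λ v → f v * (Q * ∑ Ts (λ vs → g (v +ⱽ L d vs))))
      ≡⟨ ∑-cong Vs (λ v → cong (f v *_) (∑-uniform g d d≢0 v)) ⟩
    ∑ Vs (λ v → f v * (Q ^ m * ∑ Vs g))
      ≡⟨ ∑-*ʳ Vs _ f ⟩
    ∑ Vs f * (Q ^ m * ∑ Vs g)
      ≡⟨ solve 3 (λ a b c → a :* (b :* c) := b :* (a :* c)) refl (∑ Vs f) (Q ^ m) (∑ Vs g) ⟩
    Q ^ m * (∑ Vs f * ∑ Vs g) ∎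
    where
    open ≡-Reasoning
    open +-*-Solver
    Q = q ^ N
    Vs = vectors N
    Ts = tuples N m
    d : Vec K m
    d = c′ +ⱽ (-ⱽ c)
    d≢0 : d ≢ 0ⱽ
    d≢0 e = c≢c′ (sym (Vₚ.x∙y⁻¹≈ε⇒x≈y c′ c e))
    split : ∀ v vs → v +ⱽ L c′ vs ≡ (v +ⱽ L c vs) +ⱽ L d vs
    split v vs = trans (cong (v +ⱽ_) (trans (cong (λ z → L z vs)
      (sym (trans (V.comm c d) (Vₚ.//-rightDividesˡ c c′)))) (L-+ c d vs))) (sym (V.assoc v _ _))

  2xy≤x²+y² : ∀ x y → 2 * (x * y) ≤ x * x + y * y
  2xy≤x²+y² zero    y       = z≤n
  2xy≤x²+y² (suc x) zero    = ≤-trans (≤-reflexive (cong (2 *_) (*-zeroʳ x))) z≤n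
  2xy≤x²+y² (suc x) (suc y) = begin
    2 * (suc x * suc y)
      ≡⟨ solve 2 (λ x y → con 2 :* ((con 1 :+ x) :* (con 1 :+ y)) := con 2 :* (x :* y) :+ (con 2 :+ con 2 :* x :+ con 2 :* y)) refl x y ⟩
    2 * (x * y) + (2 + 2 * x + 2 * y) ≤⟨ +-monoˡ-≤ _ (2xy≤x²+y² x y) ⟩
    x * x + y * y + (2 + 2 * x + 2 * y)
      ≡⟨ solve 2 (λ x y → x :* x :+ y :* y :+ (con 2 :+ con 2 :* x :+ con 2 :* y) := (con 1 :+ x) :* (con 1 :+ x) :+ (con 1 :+ y) :* (con 1 :+ y)) refl x y ⟩
    suc x * suc x + suc y * suc y ∎
    where
    open ≤-Reasoning
    open +-*-Solver

  -- Chebyshev's inequality for the random variable Q X with mean μ, with the expanded square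
  -- (Q X − μ)² ≥ [X = 0] μ² moved to avoid subtraction.
  chebyshev : ∀ {A : Set} (xs : List A) (X : A → ℕ) (z : A → Bool) (Q μ : ℕ) →
    (∀ x → T (z x) → X x ≡ 0) →
    ∑ xs (λ x → 𝟙 (z x)) * (μ * μ) + 2 * (Q * μ) * ∑ xs X
    ≤ Q * Q * ∑ xs (λ x → X x * X x) + length xs * (μ * μ)
  chebyshev xs X z Q μ X≡0 = begin
    ∑ xs (λ x → 𝟙 (z x)) * (μ * μ) + 2 * (Q * μ) * ∑ xs X
      ≡⟨ cong₂ _+_ (sym (∑-*ʳ xs _ _)) (sym (∑-*ˡ xs (2 * (Q * μ)) X)) ⟩
    ∑ xs (λ x → 𝟙 (z x) * (μ * μ)) + ∑ xs (λ x → 2 * (Q * μ) * X x)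
      ≡⟨ ∑-+ xs _ _ ⟨
    ∑ xs (λ x → 𝟙 (z x) * (μ * μ) + 2 * (Q * μ) * X x)
      ≤⟨ ∑-mono xs pointwise ⟩
    ∑ xs (λ x → Q * Q * (X x * X x) + μ * μ)
      ≡⟨ ∑-+ xs _ _ ⟩
    ∑ xs (λ x → Q * Q * (X x * X x)) + ∑ xs (λ _ → μ * μ)
      ≡⟨ cong₂ _+_ (∑-*ˡ xs (Q * Q) _) (∑-const xs _) ⟩
    Q * Q * ∑ xs (λ x → X x * X x) + length xs * (μ * μ) ∎
    where
    open ≤-Reasoning
    pointwise : ∀ x → 𝟙 (z x) * (μ * μ) + 2 * (Q * μ) * X x ≤ Q * Q * (X x * X x) + μ * μ
    pointwise x with z x | X≡0 x
    ... | true  | h rewrite h _ | *-zeroʳ (2 * (Q * μ)) | +-identityʳ (μ * μ) | +-identityʳ (μ * μ) = m≤n+m _ _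
    ... | false | _ = begin
      2 * (Q * μ) * X x            ≡⟨ solve 3 (λ Q m x → con 2 :* (Q :* m) :* x := con 2 :* (Q :* x :* m)) refl Q μ (X x) ⟩
      2 * (Q * X x * μ)            ≤⟨ 2xy≤x²+y² (Q * X x) μ ⟩
      Q * X x * (Q * X x) + μ * μ  ≡⟨ cong (_+ μ * μ) (solve 2 (λ Q x → Q :* x :* (Q :* x) := Q :* Q :* (x :* x)) refl Q (X x)) ⟩
      Q * Q * (X x * X x) + μ * μ  ∎
      where open +-*-Solver

  square-∑ : ∀ {A : Set} (xs : List A) (f : A → ℕ) → ∑ xs f * ∑ xs f ≡ ∑ xs (λ x → ∑ xs (λ y → f x * f y))
  square-∑ xs f = trans (sym (∑-*ʳ xs _ f)) (∑-cong xs (λ x → sym (∑-*ˡ xs (f x) f)))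

  𝟙-sq : ∀ b → 𝟙 b * 𝟙 b ≡ 𝟙 b
  𝟙-sq true  = refl
  𝟙-sq false = refl

  module _ {N : ℕ} (m : ℕ) (p : Vec K N → Bool) where
    private
      Q t P : ℕ
      Q = q ^ N
      t = count p
      P = q ^ m
      Ω = tuples N (suc m)

      I : Vec K m → Vec (Vec K N) (suc m) → ℕ
      I c (v ∷ vs) = 𝟙 (p (v +ⱽ L c vs))

      X : Vec (Vec K N) (suc m) → ℕ
      X v = ∑ (vectors m) (λ c → I c v)

      ∑I : ∀ c → ∑ Ω (I c) ≡ Q ^ m * t
      ∑I c = trans (∑-Vec (enumK^ N) m _) (∑-normalised p c)

      ∑X : ∑ Ω X ≡ P * (Q ^ m * t)
      ∑X = trans (∑-swap Ω (vectors m) _) (trans (∑-cong (vectors m) ∑I)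
        (trans (∑-const (vectors m) _) (cong (_* (Q ^ m * t)) (size-vectors m))))

      -- Equal coefficient vectors give the same indicator, whose square is itself; this diagonal
      -- term is the whole source of the variance.
      pair-bound : ∀ c c′ → Q * ∑ Ω (λ v → I c v * I c′ v) ≤
                   𝟙 ⌊ c ≟ⱽ c′ ⌋ * (Q ^ suc m * t) + Q ^ m * (t * t)
      pair-bound c c′ with c ≟ⱽ c′
      ... | yes refl = begin
        Q * ∑ Ω (λ v → I c v * I c v)  ≡⟨ cong (Q *_) (trans (∑-cong Ω (λ { (v ∷ vs) → 𝟙-sq (p (v +ⱽ L c vs)) })) (∑I c)) ⟩
        Q * (Q ^ m * t)                ≡⟨ trans (sym (*-assoc Q _ t)) (sym (+-identityʳ _)) ⟩
        1 * (Q ^ suc m * t)            ≤⟨ m≤m+n _ _ ⟩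
        1 * (Q ^ suc m * t) + Q ^ m * (t * t) ∎
        where open ≤-Reasoning
      ... | no c≢c′ = ≤-reflexive (trans (cong (Q *_) (∑-Vec (enumK^ N) m _))
                        (pairwise-independent (λ x → 𝟙 (p x)) (λ x → 𝟙 (p x)) c c′ c≢c′))

      ∑X² : Q * ∑ Ω (λ v → X v * X v) ≤ P * (Q ^ suc m * t) + P * P * (Q ^ m * (t * t))
      ∑X² = begin
        Q * ∑ Ω (λ v → X v * X v)
          ≡⟨ cong (Q *_) (trans (∑-cong Ω (λ v → square-∑ Cs (λ c → I c v))) (trans (∑-swap Ω Cs _) (∑-cong Cs (λ c → ∑-swap Ω Cs _)))) ⟩
        Q * ∑ Cs (λ c → ∑ Cs (λ c′ → ∑ Ω (λ v → I c v * I c′ v)))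
          ≡⟨ trans (sym (∑-*ˡ Cs Q _)) (∑-cong Cs (λ c → sym (∑-*ˡ Cs Q _))) ⟩
        ∑ Cs (λ c → ∑ Cs (λ c′ → Q * ∑ Ω (λ v → I c v * I c′ v)))
          ≤⟨ ∑-mono Cs (λ c → ∑-mono Cs (λ c′ → pair-bound c c′)) ⟩
        ∑ Cs (λ c → ∑ Cs (λ c′ → 𝟙 ⌊ c ≟ⱽ c′ ⌋ * U + W))
          ≡⟨ ∑-cong Cs (λ c → trans (∑-+ Cs _ _) (cong₂ _+_ (∑-*ʳ Cs U _) (trans (∑-const Cs W) (cong (_* W) (size-vectors m))))) ⟩
        ∑ Cs (λ c → ∑ Cs (λ c′ → 𝟙 ⌊ c ≟ⱽ c′ ⌋) * U + P * W)
          ≤⟨ ∑-mono Cs (λ c → +-monoˡ-≤ (P * W) (≤-trans (*-monoˡ-≤ U (diagonal c)) (≤-reflexive (*-identityˡ U)))) ⟩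
        ∑ Cs (λ c → U + P * W)
          ≡⟨ trans (∑-const Cs _) (cong (_* (U + P * W)) (size-vectors m)) ⟩
        P * (U + P * W)
          ≡⟨ trans (*-distribˡ-+ P U _) (cong (P * U +_) (sym (*-assoc P P W))) ⟩
        P * U + P * P * W ∎
        where
        open ≤-Reasoning
        Cs = vectors m
        U = Q ^ suc m * t
        W = Q ^ m * (t * t)
        diagonal : ∀ c → ∑ Cs (λ c′ → 𝟙 ⌊ c ≟ⱽ c′ ⌋) ≤ 1
        diagonal c = ∑-atMostOne Cs (λ c′ → ⌊ c ≟ⱽ c′ ⌋) (AllPairs.map conflict (unique (enumK^ m)))
          where
          conflict : ∀ {a b} → a ≢ b → T ⌊ c ≟ⱽ a ⌋ → T ⌊ c ≟ⱽ b ⌋ → ⊥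
          conflict {a} {b} a≢b h h′ with c ≟ⱽ a | c ≟ⱽ b
          ... | yes refl | yes refl = a≢b refl

      miss⇒X≡0 : ∀ v → T (not (hits p v)) → X v ≡ 0
      miss⇒X≡0 (v ∷ vs) h = trans (∑-cong (vectors m) zero-term) (∑-zero (vectors m))
        where
        zero-term : ∀ c → 𝟙 (p (v +ⱽ L c vs)) ≡ 0
        zero-term c with p (v +ⱽ L c vs) in eq
        ... | false = refl
        ... | true  = ⊥-elim (not-T {hits p (v ∷ vs)} h (from (T-∨ {hits p vs})
                (inj₂ (any-T _ (complete (enumK^ m) c) (subst T (sym eq) _)))))

    -- `X` counts only the combinations led by the first vector; a tuple that is not hit has `X`
    -- equal to 0. The mean of Q X is μ = P t and its variance is at most Q μ, so after the common
    -- term 2 μ² Q^(m+1) and one factor μ > 0 are cancelled, Chebyshev leaves G μ ≤ Q^(m+2).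
    second-moment : 1 ≤ t → ∑ Ω (λ v → 𝟙 (not (hits p v))) * (P * t) ≤ Q ^ (2 + m)
    second-moment 1≤t = *-cancelʳ-≤ _ _ μ (+-cancelʳ-≤ (2 * (μ * μ * Q ^ suc m)) _ _ (begin
      G * μ * μ + 2 * (μ * μ * Q ^ suc m)
        ≡⟨ solve 5 (λ G P t Q Qm → G :* (P :* t) :* (P :* t) :+ con 2 :* (P :* t :* (P :* t) :* (Q :* Qm))
                := G :* (P :* t :* (P :* t)) :+ con 2 :* (Q :* (P :* t)) :* (P :* (Qm :* t))) refl G P t Q (Q ^ m) ⟩
      G * (μ * μ) + 2 * (Q * μ) * (P * (Q ^ m * t))
        ≡⟨ cong (λ z → G * (μ * μ) + 2 * (Q * μ) * z) ∑X ⟨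
      G * (μ * μ) + 2 * (Q * μ) * ∑ Ω X
        ≤⟨ chebyshev Ω X (λ v → not (hits p v)) Q μ miss⇒X≡0 ⟩
      Q * Q * ∑ Ω (λ v → X v * X v) + length Ω * (μ * μ)
        ≡⟨ cong₂ _+_ (*-assoc Q Q _) (cong (_* (μ * μ)) (size-tuples N (suc m))) ⟩
      Q * (Q * ∑ Ω (λ v → X v * X v)) + Q ^ suc m * (μ * μ)
        ≤⟨ +-monoˡ-≤ (Q ^ suc m * (μ * μ)) (*-monoʳ-≤ Q ∑X²) ⟩
      Q * (P * (Q ^ suc m * t) + P * P * (Q ^ m * (t * t))) + Q ^ suc m * (μ * μ)
        ≡⟨ solve 4 (λ P t Q Qm → Q :* (P :* (Q :* Qm :* t) :+ P :* P :* (Qm :* (t :* t))) :+ Q :* Qm :* (P :* t :* (P :* t))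
                := Q :* (Q :* Qm) :* (P :* t) :+ con 2 :* (P :* t :* (P :* t) :* (Q :* Qm))) refl P t Q (Q ^ m) ⟩
      Q ^ (2 + m) * μ + 2 * (μ * μ * Q ^ suc m) ∎))
      where
      open ≤-Reasoning
      open +-*-Solver
      μ = P * t
      G = ∑ Ω (λ v → 𝟙 (not (hits p v)))
      instance
        μ≢0 : ℕ.NonZero μ
        μ≢0 = ℕ.>-nonZero (*-mono-≤ (m^n>0 q {{ℕ.>-nonZero 1≤q}} m) 1≤t)

  -- The Boolean tests of the statement and their propositional meaning.

  open LinAlg F renaming (Vec to Row)

  L-injective : ∀ {N k} (v : Vec (Vec K N) k) → (∀ c → L c v ≡ 0ⱽ → c ≡ 0ⱽ) →
                ∀ c d → L c v ≡ L d v → c ≡ d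
  L-injective v ker c d e = Vₚ.x∙y⁻¹≈ε⇒x≈y c d (ker (c +ⱽ (-ⱽ d)) (Vₚ.identityˡ-unique _ (L d v) (begin
    L (c +ⱽ (-ⱽ d)) v +ⱽ L d v  ≡⟨ L-+ (c +ⱽ (-ⱽ d)) d v ⟨
    L (c +ⱽ (-ⱽ d) +ⱽ d) v      ≡⟨ cong (λ z → L z v) (Vₚ.//-rightDividesˡ d c) ⟩
    L c v                       ≡⟨ e ⟩
    L d v                       ∎)))
    where open ≡-Reasoning

  -- Otherwise c ↦ L c v would embed K^k into K^N.
  dependent : ∀ {N k} (v : Vec (Vec K N) k) → N < k → ∃ λ c → c ≢ 0ⱽ × L c v ≡ 0ⱽ
  dependent {N} {k} v N<k with Any.any? (λ c → ¬? (c ≟ⱽ 0ⱽ) ×-dec (L c v ≟ⱽ 0ⱽ)) (vectors k)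
  ... | yes h = let c , _ , r = find h in c , r
  ... | no h  = ⊥-elim (<⇒≱ (^-monoʳ-< q 2≤q N<k) (begin
    q ^ k                    ≡⟨ trans (∑-1 (vectors k)) (size-vectors k) ⟨
    ∑ (vectors k) (λ _ → 1)  ≤⟨ ∑-injective (enumK^ k) (enumK^ N) _ _ (λ c → L c v) (L-injective v ker) (λ _ → ≤-refl) ⟩
    ∑ (vectors N) (λ _ → 1)  ≡⟨ trans (∑-1 (vectors N)) (size-vectors N) ⟩
    q ^ N                    ∎))
    where
    open ≤-Reasoning
    ker : ∀ c → L c v ≡ 0ⱽ → c ≡ 0ⱽ
    ker c e with c ≟ⱽ 0ⱽ
    ... | yes p = p
    ... | no ¬p = ⊥-elim (h (lose (complete (enumK^ k) c) (¬p , e)))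

  Vec-ext : ∀ {A : Set} {n} {x y : Vec A n} → (∀ i → lookup x i ≡ lookup y i) → x ≡ y
  Vec-ext {x = []}    {[]}    h = refl
  Vec-ext {x = a ∷ x} {b ∷ y} h = cong₂ _∷_ (h zero) (Vec-ext (λ i → h (suc i)))

  lookup-0ⱽ : ∀ {N} (i : Fin N) → lookup 0ⱽ i ≡ 𝟘
  lookup-0ⱽ i = Vecₚ.lookup-replicate i 𝟘

  sumFin-suc : ∀ k (f : Fin (suc k) → K) → sumFin (suc k) f ≡ f zero ⊕ sumFin k (f ∘ suc)
  sumFin-suc k f = cong (f zero ⊕_) (trans (cong (foldr (λ i acc → f i ⊕ acc) 𝟘) (sym (Listₚ.map-tabulate (λ i → i) suc)))
    (Listₚ.foldr-map (λ i acc → f i ⊕ acc) suc 𝟘 (allFin k)))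

  sumFin-cong : ∀ k {f g : Fin k → K} → (∀ i → f i ≡ g i) → sumFin k f ≡ sumFin k g
  sumFin-cong zero    h = refl
  sumFin-cong (suc k) {f} {g} h = trans (sumFin-suc k f)
    (trans (cong₂ _⊕_ (h zero) (sumFin-cong k (h ∘ suc))) (sym (sumFin-suc k g)))

  sumFin-zero : ∀ k {f : Fin k → K} → (∀ i → f i ≡ 𝟘) → sumFin k f ≡ 𝟘
  sumFin-zero zero    h = refl
  sumFin-zero (suc k) {f} h = trans (sumFin-suc k f)
    (trans (cong₂ _⊕_ (h zero) (sumFin-zero k (h ∘ suc))) (R.+-identityˡ 𝟘))

  sumFin-+ : ∀ k (f g : Fin k → K) → sumFin k (λ i → f i ⊕ g i) ≡ sumFin k f ⊕ sumFin k g
  sumFin-+ zero    f g = sym (R.+-identityˡ 𝟘)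
  sumFin-+ (suc k) f g = begin
    sumFin (suc k) (λ i → f i ⊕ g i)                                ≡⟨ sumFin-suc k _ ⟩
    (f zero ⊕ g zero) ⊕ sumFin k (λ i → f (suc i) ⊕ g (suc i))      ≡⟨ cong (f zero ⊕ g zero ⊕_) (sumFin-+ k (f ∘ suc) (g ∘ suc)) ⟩
    (f zero ⊕ g zero) ⊕ (sumFin k (f ∘ suc) ⊕ sumFin k (g ∘ suc))   ≡⟨ CommutativeSemigroupₚ.interchange R.+-commutativeSemigroup _ _ _ _ ⟩
    (f zero ⊕ sumFin k (f ∘ suc)) ⊕ (g zero ⊕ sumFin k (g ∘ suc))   ≡⟨ cong₂ _⊕_ (sumFin-suc k f) (sumFin-suc k g) ⟨
    sumFin (suc k) f ⊕ sumFin (suc k) g                             ∎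
    where open ≡-Reasoning

  sumFin-*ʳ : ∀ k (f : Fin k → K) a → sumFin k (λ i → f i ⊗ a) ≡ sumFin k f ⊗ a
  sumFin-*ʳ zero    f a = sym (R.zeroˡ a)
  sumFin-*ʳ (suc k) f a = trans (sumFin-suc k _) (trans (cong (f zero ⊗ a ⊕_) (sumFin-*ʳ k (f ∘ suc) a))
    (trans (sym (R.distribʳ a _ _)) (cong (_⊗ a) (sym (sumFin-suc k f)))))

  lookup-+ⱽ : ∀ {N} (i : Fin N) x y → lookup (x +ⱽ y) i ≡ lookup x i ⊕ lookup y i
  lookup-+ⱽ i x y = Vecₚ.lookup-zipWith _⊕_ i x y

  lookup-· : ∀ {N} (i : Fin N) c x → lookup (c · x) i ≡ c ⊗ lookup x i
  lookup-· i c x = Vecₚ.lookup-map i (c ⊗_) x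

  lookup-L : ∀ {N k} (c : Vec K k) (v : Vec (Vec K N) k) j →
             lookup (L c v) j ≡ sumFin k (λ l → lookup c l ⊗ lookup (lookup v l) j)
  lookup-L []       []       j = lookup-0ⱽ j
  lookup-L (c ∷ cs) (v ∷ vs) j = trans (lookup-+ⱽ j (c · v) (L cs vs))
    (trans (cong₂ _⊕_ (lookup-· j c v) (lookup-L cs vs j)) (sym (sumFin-suc _ (λ l → lookup (c ∷ cs) l ⊗ lookup (lookup (v ∷ vs) l) j))))

  eqᵇ⇒≡ : ∀ {x y} → T (eqᵇ x y) → x ≡ y
  eqᵇ⇒≡ {x} {y} = toWitness {a? = x ≟ y}

  ≡⇒eqᵇ : ∀ {x y} → x ≡ y → T (eqᵇ x y)
  ≡⇒eqᵇ {x} {y} = fromWitness {a? = x ≟ y}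

  isZeroV⇒ : ∀ {n} {u : Row n} → T (isZeroVᵇ u) → ∀ i → u i ≡ 𝟘
  isZeroV⇒ {n} h i = eqᵇ⇒≡ (T-all _ (allFin n) h (∈-allFin i))

  ⇒isZeroV : ∀ {n} {u : Row n} → (∀ i → u i ≡ 𝟘) → T (isZeroVᵇ u)
  ⇒isZeroV {n} h = all-T _ (allFin n) (λ {i} _ → ≡⇒eqᵇ (h i))

  infix 4 _≈_
  -- The working equality of matrices: propositional equality of functions would be too fine.
  _≈_ : ∀ {n} → Mat n → Mat n → Set
  A ≈ B = ∀ i j → A i j ≡ B i j

  isZeroM⇒ : ∀ {n} {A : Mat n} → T (isZeroMᵇ A) → ∀ i j → A i j ≡ 𝟘
  isZeroM⇒ {n} {A} h i = isZeroV⇒ {u = A i} (T-all _ (allFin n) h (∈-allFin i))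

  ⇒isZeroM : ∀ {n} {A : Mat n} → (∀ i j → A i j ≡ 𝟘) → T (isZeroMᵇ A)
  ⇒isZeroM {n} {A} h = all-T _ (allFin n) (λ {i} _ → ⇒isZeroV {u = A i} (h i))

  eqM⇒≈ : ∀ {n} {A B : Mat n} → T (eqMᵇ A B) → A ≈ B
  eqM⇒≈ {n} h i j = eqᵇ⇒≡ (T-all _ (allFin n) (T-all _ (allFin n) h (∈-allFin i)) (∈-allFin j))

  ≈⇒eqM : ∀ {n} {A B : Mat n} → A ≈ B → T (eqMᵇ A B)
  ≈⇒eqM {n} h = all-T _ (allFin n) (λ {i} _ → all-T _ (allFin n) (λ {j} _ → ≡⇒eqᵇ (h i j)))

  allFuns-K : ∀ {k} (c : Row k) → ∃ λ c′ → c′ ∈ allFuns elements k × ∀ i → c′ i ≡ c i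
  allFuns-K {k} c = allFuns-complete _≡_ elements k c (λ i → c i , complete enumK (c i) , refl)

  Indep : ∀ {k n} → (Fin k → Row n) → Set
  Indep {k} v = ∀ (c : Row k) → (∀ j → lcV v c j ≡ 𝟘) → ∀ l → c l ≡ 𝟘

  indepV⇒ : ∀ {k n} (v : Fin k → Row n) → T (indepVᵇ v) → Indep v
  indepV⇒ {k} v h c lc≡0 l with allFuns-K c
  ... | c′ , c′∈ , eq with to (T-∨ {isZeroVᵇ c′}) (T-all _ _ h c′∈)
  ... | inj₁ z  = trans (sym (eq l)) (isZeroV⇒ {u = c′} z l)
  ... | inj₂ nz = ⊥-elim (not-T nz (⇒isZeroV {u = lcV v c′}
        (λ j → trans (sumFin-cong k (λ i → cong (_⊗ v i j) (eq i))) (lc≡0 j))))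

  ⇒indepV : ∀ {k n} (v : Fin k → Row n) → Indep v → T (indepVᵇ v)
  ⇒indepV {k} v ind = all-T _ (allFuns elements k) (λ {c} _ → step c)
    where
    step : ∀ c → T (isZeroVᵇ c ∨ not (isZeroVᵇ (lcV v c)))
    step c with isZeroVᵇ (lcV v c) in eq
    ... | false = from (T-∨ {isZeroVᵇ c}) (inj₂ _)
    ... | true  = from (T-∨ {isZeroVᵇ c}) (inj₁ (⇒isZeroV {u = c} (ind c (isZeroV⇒ {u = lcV v c} (subst T (sym eq) _)))))

  RankAtLeast : ∀ {n} → ℕ → Mat n → Set
  RankAtLeast {n} d M = ∃ λ (r : Fin d → Fin n) → Indep (λ l → M (r l))

  rankAtLeast⇒ : ∀ {n} d (M : Mat n) → T (rankAtLeastᵇ d M) → RankAtLeast d M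
  rankAtLeast⇒ {n} d M h = let r , _ , ind = T-any (λ r → indepVᵇ (λ l → M (r l))) (allFuns (allFin n) d) h in r , indepV⇒ _ ind

  Indep-cong : ∀ {k n n′} {v : Fin k → Row n} {w : Fin k → Row n′} →
               (∀ c → (∀ j → lcV w c j ≡ 𝟘) → ∀ j → lcV v c j ≡ 𝟘) → Indep v → Indep w
  Indep-cong h ind c lc≡0 = ind c (h c lc≡0)

  ⇒rankAtLeast : ∀ {n} d (M : Mat n) → RankAtLeast d M → T (rankAtLeastᵇ d M)
  ⇒rankAtLeast {n} d M (r , ind) =
    let r′ , r′∈ , eq = allFuns-complete _≡_ (allFin n) d r (λ i → r i , ∈-allFin (r i) , refl)
    in any-T _ r′∈ (⇒indepV _ (Indep-cong
         (λ c e j → trans (sumFin-cong d (λ l → cong (λ z → c l ⊗ M z j) (sym (eq l)))) (e j)) ind))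

  -- Coordinates on alternating matrices.

  -- A linear isomorphism, up to `≈`, from K^(n(n-1)/2) onto Alt_n: the coordinates are the entries
  -- above the diagonal, row by row.
  toM : ∀ n → Vec K (tri n) → Mat n
  toM (suc n) z zero    zero    = 𝟘
  toM (suc n) z zero    (suc j) = lookup (Vec.take n z) j
  toM (suc n) z (suc i) zero    = ⊖ lookup (Vec.take n z) i
  toM (suc n) z (suc i) (suc j) = toM n (Vec.drop n z) i j

  fromM : ∀ n → Mat n → Vec K (tri n)
  fromM zero    M = []
  fromM (suc n) M = Vec.tabulate (λ j → M zero (suc j)) Vec.++ fromM n (λ i j → M (suc i) (suc j))

  IsAlt : ∀ {n} → Mat n → Set
  IsAlt M = (∀ i → M i i ≡ 𝟘) × (∀ i j → M i j ≡ ⊖ M j i)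

  toM-diagonal : ∀ n (z : Vec K (tri n)) i → toM n z i i ≡ 𝟘
  toM-diagonal (suc n) z zero    = refl
  toM-diagonal (suc n) z (suc i) = toM-diagonal n (Vec.drop n z) i

  toM-antisym : ∀ n (z : Vec K (tri n)) i j → toM n z i j ≡ ⊖ toM n z j i
  toM-antisym (suc n) z zero    zero    = sym Rₚ.-0#≈0#
  toM-antisym (suc n) z zero    (suc j) = sym (Rₚ.-‿involutive _)
  toM-antisym (suc n) z (suc i) zero    = refl
  toM-antisym (suc n) z (suc i) (suc j) = toM-antisym n (Vec.drop n z) i j

  take-++ : ∀ {A : Set} {m n} (x : Vec A m) (y : Vec A n) → Vec.take m (x Vec.++ y) ≡ x
  take-++ []      y = refl
  take-++ (a ∷ x) y = cong (a ∷_) (take-++ x y)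

  drop-++ : ∀ {A : Set} {m n} (x : Vec A m) (y : Vec A n) → Vec.drop m (x Vec.++ y) ≡ y
  drop-++ []      y = refl
  drop-++ (a ∷ x) y = drop-++ x y

  toM-fromM : ∀ n (M : Mat n) → IsAlt M → toM n (fromM n M) ≈ M
  toM-fromM (suc n) M (diag , anti) = go
    where
    row : Vec K n
    row = Vec.tabulate (λ j → M zero (suc j))
    rest : Vec K (tri n)
    rest = fromM n (λ i j → M (suc i) (suc j))
    row-eq : ∀ j → lookup (Vec.take n (row Vec.++ rest)) j ≡ M zero (suc j)
    row-eq j = trans (cong (λ z → lookup z j) (take-++ row rest)) (Vecₚ.lookup∘tabulate _ j)
    go : toM (suc n) (fromM (suc n) M) ≈ M
    go zero    zero    = sym (diag zero)
    go zero    (suc j) = row-eq j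
    go (suc i) zero    = trans (cong ⊖_ (row-eq i)) (sym (anti (suc i) zero))
    go (suc i) (suc j) = trans (cong (λ z → toM n z i j) (drop-++ row rest))
      (toM-fromM n (λ i j → M (suc i) (suc j)) ((λ i → diag (suc i)) , (λ i j → anti (suc i) (suc j))) i j)

  toM-injective : ∀ n (y z : Vec K (tri n)) → toM n y ≈ toM n z → y ≡ z
  toM-injective zero    []  []  h = refl
  toM-injective (suc n) y z h = begin
    y                                 ≡⟨ Vecₚ.take++drop≡id n y ⟨
    Vec.take n y Vec.++ Vec.drop n y  ≡⟨ cong₂ Vec._++_ (Vec-ext {x = Vec.take n y} {Vec.take n z} (λ j → h zero (suc j)))
                                           (toM-injective n _ _ (λ i j → h (suc i) (suc j))) ⟩
    Vec.take n z Vec.++ Vec.drop n z  ≡⟨ Vecₚ.take++drop≡id n z ⟩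
    z                                 ∎
    where open ≡-Reasoning

  toM-+ : ∀ n (y z : Vec K (tri n)) i j → toM n (y +ⱽ z) i j ≡ toM n y i j ⊕ toM n z i j
  toM-+ (suc n) y z zero    zero    = sym (R.+-identityˡ 𝟘)
  toM-+ (suc n) y z zero    (suc j) = trans (cong (λ x → lookup x j) (Vecₚ.take-zipWith {m = n} _⊕_ y z)) (lookup-+ⱽ j (Vec.take n y) (Vec.take n z))
  toM-+ (suc n) y z (suc i) zero    = trans (cong ⊖_ (toM-+ (suc n) y z zero (suc i))) (sym (Rₚ.-‿+-comm _ _))
  toM-+ (suc n) y z (suc i) (suc j) = trans (cong (λ x → toM n x i j) (Vecₚ.drop-zipWith {m = n} _⊕_ y z)) (toM-+ n _ _ i j)

  toM-· : ∀ n c (z : Vec K (tri n)) i j → toM n (c · z) i j ≡ c ⊗ toM n z i j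
  toM-· (suc n) c z zero    zero    = sym (R.zeroʳ c)
  toM-· (suc n) c z zero    (suc j) = trans (cong (λ x → lookup x j) (Vecₚ.take-map (c ⊗_) n z)) (lookup-· j c (Vec.take n z))
  toM-· (suc n) c z (suc i) zero    = trans (cong ⊖_ (toM-· (suc n) c z zero (suc i))) (Rₚ.-‿distribʳ-* c _)
  toM-· (suc n) c z (suc i) (suc j) = trans (cong (λ x → toM n x i j) (Vecₚ.drop-map (c ⊗_) n z)) (toM-· n c _ i j)

  toM-0 : ∀ n i j → toM n 0ⱽ i j ≡ 𝟘
  toM-0 n i j = trans (cong (λ z → toM n z i j) (sym (·-zeroˡ 0ⱽ))) (trans (toM-· n 𝟘 0ⱽ i j) (R.zeroˡ _))

  toM-L : ∀ n {k} (c : Vec K k) (v : Vec (Vec K (tri n)) k) →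
          toM n (L c v) ≈ lcM (λ l → toM n (lookup v l)) (lookup c)
  toM-L n []       []       i j = toM-0 n i j
  toM-L n (c ∷ cs) (v ∷ vs) i j = trans (toM-+ n (c · v) (L cs vs) i j)
    (trans (cong₂ _⊕_ (toM-· n c v i j) (toM-L n cs vs i j))
      (sym (sumFin-suc _ (λ l → lookup (c ∷ cs) l ⊗ toM n (lookup (v ∷ vs) l) i j))))

  -- The indicator of T in coordinates. It contains 0 when d ≥ 1 and is empty for d = 0.
  low : ∀ n → ℕ → Vec K (tri n) → Bool
  low n d z = not (rankAtLeastᵇ d (toM n z))

  low-mono : ∀ n n′ d d′ (y : Vec K (tri n)) (z : Vec K (tri n′)) →
             (RankAtLeast d′ (toM n′ z) → RankAtLeast d (toM n y)) → T (low n d y) → T (low n′ d′ z)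
  low-mono n n′ d d′ y z h ly = T-not (λ r → not-T ly
    (⇒rankAtLeast d (toM n y) (h (rankAtLeast⇒ d′ (toM n′ z) r))))

  -- The closure property that `hits-complete` asks for. Rows independent in `a · z` are independent
  -- in `z`, whatever `a` is, so no inverse of `a` is taken.
  low-· : ∀ n d a (z : Vec K (tri n)) → T (low n d z) → T (low n d (a · z))
  low-· n d a z = low-mono n n d d z (a · z) (λ { (r , ind) → r , Indep-cong {v = λ l → toM n (a · z) (r l)} {w = λ l → toM n z (r l)}
    (λ c e j → trans (sumFin-cong d (λ l → trans (cong (c l ⊗_) (trans (toM-· n a z (r l) j) (R.*-comm a _))) (sym (R.*-assoc _ _ _))))
       (trans (sumFin-*ʳ d (λ l → c l ⊗ toM n z (r l) j) a) (trans (cong (_⊗ a) (e j)) (R.zeroˡ a)))) ind })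

  -- Schur complements and the upper bound for |T|.

  -- The alternating matrix x yᵀ - y xᵀ, of rank at most 2. It is the correction term of the Schur
  -- complement and also what raises the rank in `glue`.
  wedge : ∀ {n} → Row n → Row n → Mat n
  wedge x y i j = x i ⊗ y j ⊕ ⊖ (y i ⊗ x j)

  wedge-alt : ∀ {n} (x y : Row n) → IsAlt (wedge x y)
  wedge-alt x y = (λ i → trans (cong (λ z → x i ⊗ y i ⊕ ⊖ z) (R.*-comm (y i) (x i))) (R.-‿inverseʳ _)) ,
    λ i j → sym (trans (Rₚ.⁻¹-anti-homo-// (x j ⊗ y i) (y j ⊗ x i))
                   (cong₂ (λ a b → a ⊕ ⊖ b) (R.*-comm (y j) (x i)) (R.*-comm (x j) (y i))))

  addM-alt : ∀ {n} {A B : Mat n} → IsAlt A → IsAlt B → IsAlt (addM A B)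
  addM-alt (dA , aA) (dB , aB) = (λ i → trans (cong₂ _⊕_ (dA i) (dB i)) (R.+-identityˡ 𝟘)) ,
    λ i j → trans (cong₂ _⊕_ (aA i j) (aB i j)) (Rₚ.-‿+-comm _ _)

  module Schur {n : ℕ} (M : Mat (2 + n)) (j : Fin (suc n)) where
    ι : Fin n → Fin (2 + n)
    ι p = suc (punchIn j p)

    t : K
    t = inv (M zero (suc j))

    -- The complement M₂₂ - M₂₁ M₁₁⁻¹ M₁₂ of the 2 × 2 block on the indices `zero` and `suc j`. For
    -- alternating M with nonzero pivot this block is a times the standard symplectic one, and the
    -- correction collapses to a wedge of the two pivot rows, one of them divided by a.
    schur : Mat n
    schur = addM (λ p r → M (ι p) (ι r)) (wedge (λ p → M (suc j) (ι p) ⊗ t) (λ r → M zero (ι r)))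

    schur-alt : IsAlt M → IsAlt schur
    schur-alt (d , a) = addM-alt {A = λ p r → M (ι p) (ι r)} ((λ p → d (ι p)) , (λ p r → a (ι p) (ι r)))
      (wedge-alt (λ p → M (suc j) (ι p) ⊗ t) (λ r → M zero (ι r)))

    -- In a relation among the two pivot rows and the rows `ι (r l)`, the pivot columns express the
    -- coefficients α and β through γ; substituted into the other columns this becomes a relation
    -- among rows of the Schur complement. Hence γ vanishes, and α, β follow because a is nonzero.
    schur-rank : IsAlt M → M zero (suc j) ≢ 𝟘 → ∀ {d} → RankAtLeast d schur → RankAtLeast (2 + d) M
    schur-rank (diag , anti) a≢0 {d} (r , ind) = rows , independent
      where
      rows : Fin (2 + d) → Fin (2 + n)
      rows zero          = zero
      rows (suc zero)    = suc j
      rows (suc (suc l)) = ι (r l)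

      independent : Indep (λ l → M (rows l))
      independent c lc≡0 = λ { zero → α≡0 ; (suc zero) → β≡0 ; (suc (suc l)) → γ≡0 l }
        where
        open ≡-Reasoning
        α β a Sx Sy : K
        α = c zero
        β = c (suc zero)
        a = M zero (suc j)
        γ : Fin d → K
        γ l = c (suc (suc l))
        Sx = sumFin d (λ l → γ l ⊗ M zero (ι (r l)))
        Sy = sumFin d (λ l → γ l ⊗ M (suc j) (ι (r l)))
        ΣM : Fin (2 + n) → K
        ΣM i = sumFin d (λ l → γ l ⊗ M (ι (r l)) i)

        column : ∀ i → α ⊗ M zero i ⊕ (β ⊗ M (suc j) i ⊕ ΣM i) ≡ 𝟘
        column i = trans (sym (trans (sumFin-suc (suc d) (λ l → c l ⊗ M (rows l) i))
          (cong (α ⊗ M zero i ⊕_) (sumFin-suc d (λ l → c (suc l) ⊗ M (rows (suc l)) i))))) (lc≡0 i)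

        negate-sum : ∀ i → ΣM i ≡ ⊖ sumFin d (λ l → γ l ⊗ M i (ι (r l)))
        negate-sum i = begin
          ΣM i
            ≡⟨ sumFin-cong d (λ l → trans (cong (γ l ⊗_) (trans (anti _ i) (sym (Rₚ.-1*x≈-x _)))) (rotate (γ l) (M i (ι (r l))))) ⟩
          sumFin d (λ l → γ l ⊗ M i (ι (r l)) ⊗ ⊖ 𝟏)       ≡⟨ sumFin-*ʳ d (λ l → γ l ⊗ M i (ι (r l))) (⊖ 𝟏) ⟩
          sumFin d (λ l → γ l ⊗ M i (ι (r l))) ⊗ ⊖ 𝟏       ≡⟨ trans (R.*-comm _ (⊖ 𝟏)) (Rₚ.-1*x≈-x _) ⟩
          ⊖ sumFin d (λ l → γ l ⊗ M i (ι (r l)))           ∎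
          where
          rotate : ∀ g m → g ⊗ (⊖ 𝟏 ⊗ m) ≡ g ⊗ m ⊗ ⊖ 𝟏
          rotate g m = trans (cong (g ⊗_) (R.*-comm _ m)) (sym (R.*-assoc g m _))

        -- Column `suc j` of the relation: the diagonal entry kills the β term, and antisymmetry
        -- turns the rest into a sum along row `suc j`.
        Sy≡αa : Sy ≡ α ⊗ a
        Sy≡αa = sym (Rₚ.x∙y⁻¹≈ε⇒x≈y _ _ (begin
          α ⊗ a ⊕ ⊖ Sy                             ≡⟨ cong (α ⊗ a ⊕_) (negate-sum (suc j)) ⟨
          α ⊗ a ⊕ ΣM (suc j)                       ≡⟨ cong (α ⊗ a ⊕_) (R.+-identityˡ _) ⟨
          α ⊗ a ⊕ (𝟘 ⊕ ΣM (suc j))                 ≡⟨ cong (λ z → α ⊗ a ⊕ (z ⊕ ΣM (suc j))) (trans (cong (β ⊗_) (diag (suc j))) (R.zeroʳ β)) ⟨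
          α ⊗ a ⊕ (β ⊗ M (suc j) (suc j) ⊕ ΣM (suc j)) ≡⟨ column (suc j) ⟩
          𝟘 ∎))

        Sx≡-βa : Sx ≡ ⊖ (β ⊗ a)
        Sx≡-βa = Rₚ.+-inverseʳ-unique (β ⊗ a) Sx βa+Sx
          where
          βa+Sx : β ⊗ a ⊕ Sx ≡ 𝟘
          βa+Sx = Rₚ.-‿injective (begin
            ⊖ (β ⊗ a ⊕ Sx)                ≡⟨ Rₚ.-‿+-comm _ _ ⟨
            ⊖ (β ⊗ a) ⊕ ⊖ Sx              ≡⟨ cong₂ _⊕_ (trans (Rₚ.-‿distribʳ-* β a) (cong (β ⊗_) (sym (anti (suc j) zero)))) (sym (negate-sum zero)) ⟩
            β ⊗ M (suc j) zero ⊕ ΣM zero  ≡⟨ R.+-identityˡ _ ⟨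
            𝟘 ⊕ (β ⊗ M (suc j) zero ⊕ ΣM zero) ≡⟨ cong (_⊕ (β ⊗ M (suc j) zero ⊕ ΣM zero)) (trans (cong (α ⊗_) (diag zero)) (R.zeroʳ α)) ⟨
            α ⊗ M zero zero ⊕ (β ⊗ M (suc j) zero ⊕ ΣM zero) ≡⟨ column zero ⟩
            𝟘                             ≡⟨ Rₚ.-0#≈0# ⟨
            ⊖ 𝟘                           ∎)

        cancel-a : ∀ s x → s ⊗ a ⊗ (t ⊗ x) ≡ s ⊗ x
        cancel-a s x = begin
          s ⊗ a ⊗ (t ⊗ x)  ≡⟨ R.*-assoc s a _ ⟩
          s ⊗ (a ⊗ (t ⊗ x)) ≡⟨ cong (s ⊗_) (R.*-assoc a t x) ⟨
          s ⊗ (a ⊗ t ⊗ x)   ≡⟨ cong (λ z → s ⊗ (z ⊗ x)) (inv-inverseʳ a≢0) ⟩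
          s ⊗ (𝟏 ⊗ x)       ≡⟨ cong (s ⊗_) (R.*-identityˡ x) ⟩
          s ⊗ x             ∎

        expand : ∀ g m y x x′ y′ → g ⊗ (m ⊕ (y ⊗ t ⊗ x ⊕ ⊖ (x′ ⊗ (y′ ⊗ t)))) ≡
                 g ⊗ m ⊕ (g ⊗ y ⊗ (t ⊗ x) ⊕ g ⊗ x′ ⊗ ⊖ (t ⊗ y′))
        expand g m y x x′ y′ = trans (R.distribˡ g m _) (cong (g ⊗ m ⊕_) (trans (R.distribˡ g _ _) (cong₂ _⊕_
          (trans (cong (g ⊗_) (R.*-assoc y t x)) (sym (R.*-assoc g y _)))
          (trans (cong (g ⊗_) (trans (cong (λ z → ⊖ (x′ ⊗ z)) (R.*-comm y′ t)) (Rₚ.-‿distribʳ-* x′ _))) (sym (R.*-assoc g x′ _))))))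

        combination≡0 : ∀ i → lcV (λ l → schur (r l)) γ i ≡ 𝟘
        combination≡0 i = begin
          sumFin d (λ l → γ l ⊗ schur (r l) i)
            ≡⟨ sumFin-cong d (λ l → expand (γ l) (M (ι (r l)) (ι i)) (y (r l)) (x i) (x (r l)) (y i)) ⟩
          sumFin d (λ l → γ l ⊗ M (ι (r l)) (ι i) ⊕ (γ l ⊗ y (r l) ⊗ (t ⊗ x i) ⊕ γ l ⊗ x (r l) ⊗ ⊖ (t ⊗ y i)))
            ≡⟨ trans (sumFin-+ d _ (λ l → γ l ⊗ y (r l) ⊗ (t ⊗ x i) ⊕ γ l ⊗ x (r l) ⊗ ⊖ (t ⊗ y i)))
                     (cong (ΣM (ι i) ⊕_) (trans (sumFin-+ d _ _) (cong₂ _⊕_ (sumFin-*ʳ d _ _) (sumFin-*ʳ d _ _)))) ⟩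
          ΣM (ι i) ⊕ (Sy ⊗ (t ⊗ x i) ⊕ Sx ⊗ ⊖ (t ⊗ y i))
            ≡⟨ cong (ΣM (ι i) ⊕_) (cong₂ _⊕_ (trans (cong (_⊗ (t ⊗ x i)) Sy≡αa) (cancel-a α (x i)))
                 (trans (cong (_⊗ ⊖ (t ⊗ y i)) Sx≡-βa) (trans (neg-neg (β ⊗ a) (t ⊗ y i)) (cancel-a β (y i))))) ⟩
          ΣM (ι i) ⊕ (α ⊗ x i ⊕ β ⊗ y i)
            ≡⟨ trans (R.+-comm _ _) (R.+-assoc _ _ _) ⟩
          α ⊗ x i ⊕ (β ⊗ y i ⊕ ΣM (ι i))
            ≡⟨ column (ι i) ⟩
          𝟘 ∎
          where
          x y : Fin n → K
          x p = M zero (ι p)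
          y p = M (suc j) (ι p)
          neg-neg : ∀ u v → ⊖ u ⊗ ⊖ v ≡ u ⊗ v
          neg-neg u v = trans (sym (Rₚ.-‿distribˡ-* u _)) (trans (cong ⊖_ (sym (Rₚ.-‿distribʳ-* u v))) (Rₚ.-‿involutive _))

        γ≡0 : ∀ l → γ l ≡ 𝟘
        γ≡0 = ind γ combination≡0

        vanish : ∀ i → sumFin d (λ l → γ l ⊗ M i (ι (r l))) ≡ 𝟘
        vanish i = sumFin-zero d (λ l → trans (cong (_⊗ M i (ι (r l))) (γ≡0 l)) (R.zeroˡ _))

        α≡0 : α ≡ 𝟘
        α≡0 = ⊗-cancelˡ-𝟘 a≢0 (trans (R.*-comm a α) (trans (sym Sy≡αa) (vanish (suc j))))

        β≡0 : β ≡ 𝟘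
        β≡0 = ⊗-cancelˡ-𝟘 a≢0 (trans (R.*-comm a β) (Rₚ.-‿injective
                (trans (sym Sx≡-βa) (trans (vanish zero) (sym Rₚ.-0#≈0#)))))

  open Schur using (schur; schur-alt; schur-rank)

  -- Row `suc j` contributes only n new entries: its entry at `suc j` is 0 and its entry at `zero`
  -- is minus the pivot. With both pivot rows known, the correction term is known and the complement
  -- gives back the remaining minor.
  schur-injective : ∀ {n} (M M′ : Mat (2 + n)) (j : Fin (suc n)) → IsAlt M → IsAlt M′ →
    (∀ i → M zero i ≡ M′ zero i) → (∀ p → M (suc j) (suc (punchIn j p)) ≡ M′ (suc j) (suc (punchIn j p))) →
    schur M j ≈ schur M′ j → M ≈ M′
  schur-injective M M′ j (diag , anti) (diag′ , anti′) row₀ rowⱼ complement = equal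
    where
    flip-eq : ∀ i k → M i k ≡ M′ i k → M k i ≡ M′ k i
    flip-eq i k e = trans (anti k i) (trans (cong ⊖_ e) (sym (anti′ k i)))

    row : ∀ k → M (suc j) (suc k) ≡ M′ (suc j) (suc k)
    row k with j Fin.≟ k
    ... | yes refl = trans (diag _) (sym (diag′ _))
    ... | no j≢k   = subst (λ z → M (suc j) (suc z) ≡ M′ (suc j) (suc z)) (punchIn-punchOut j≢k) (rowⱼ (punchOut j≢k))

    minor : ∀ p r → M (suc (punchIn j p)) (suc (punchIn j r)) ≡ M′ (suc (punchIn j p)) (suc (punchIn j r))
    minor p r = Rₚ.+-cancelʳ _ _ _ (trans (complement p r) (cong (M′ (suc (punchIn j p)) (suc (punchIn j r)) ⊕_)
      (sym (cong₂ (λ a b → a ⊕ ⊖ b)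
        (cong₂ _⊗_ (cong₂ (λ y a → y ⊗ inv a) (row (punchIn j p)) (row₀ (suc j))) (row₀ (suc (punchIn j r))))
        (cong₂ _⊗_ (row₀ (suc (punchIn j p))) (cong₂ (λ y a → y ⊗ inv a) (row (punchIn j r)) (row₀ (suc j))))))))

    equal : M ≈ M′
    equal zero    k       = row₀ k
    equal (suc i) zero    = flip-eq zero (suc i) (row₀ (suc i))
    equal (suc i) (suc k) with j Fin.≟ i | j Fin.≟ k
    ... | yes refl | _        = row k
    ... | no j≢i   | yes refl = flip-eq (suc j) (suc i) (row i)
    ... | no j≢i   | no j≢k   = subst₂ (λ a b → M (suc a) (suc b) ≡ M′ (suc a) (suc b))
          (punchIn-punchOut j≢i) (punchIn-punchOut j≢k) (minor (punchOut j≢i) (punchOut j≢k))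

  toM-alt : ∀ n z → IsAlt (toM n z)
  toM-alt n z = toM-diagonal n z , toM-antisym n z

  RankAtLeast-cong : ∀ {n d} {A B : Mat n} → A ≈ B → RankAtLeast d A → RankAtLeast d B
  RankAtLeast-cong {d = d} {A} {B} A≈B (r , ind) = r , Indep-cong {v = λ l → A (r l)} {w = λ l → B (r l)}
    (λ c e j → trans (sumFin-cong d (λ l → cong (c l ⊗_) (A≈B (r l) j))) (e j)) ind

  drop-rank : ∀ n d (z : Vec K (tri (suc n))) → RankAtLeast d (toM n (Vec.drop n z)) → RankAtLeast d (toM (suc n) z)
  drop-rank n d z (r , ind) = (λ l → suc (r l)) , Indep-cong {v = λ l → toM n (Vec.drop n z) (r l)} {w = λ l → toM (suc n) z (suc (r l))} (λ c e j → e (suc j)) ind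

  ∑-proj₂ : ∀ {A B : Set} (xs : List A) (ys : List B) (g : B → ℕ) →
            ∑ (cartesianProduct xs ys) (λ xy → g (proj₂ xy)) ≡ length xs * ∑ ys g
  ∑-proj₂ xs ys g = trans (∑-product _,_ xs ys (λ xy → g (proj₂ xy))) (∑-const xs _)

  -- Either the first row vanishes and the matrix is a smaller one of rank below 2 + d, or it has a
  -- pivot. In the second case the code consists of the pivot position, the first row (q^(n+1)), the
  -- free part of the pivot's row (q^n) and a Schur complement of rank below d. Not every code
  -- occurs, so this is only an upper bound.
  count-low-step : ∀ d n → count (low (2 + n) (2 + d)) ≤
    count (low (1 + n) (2 + d)) + suc n * (q ^ suc n * (q ^ n * count (low n d)))
  count-low-step d n = begin
    count (low (2 + n) (2 + d)) ≤⟨ ∑-inject Rel (λ z → 𝟙 (low (2 + n) (2 + d) z)) weight (vectors (tri (2 + n))) codes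
                                     (λ {z} _ → inj₂ (match z)) (AllPairs.map (λ z≢z′ w Rz Rz′ → z≢z′ (Rel-injective _ _ w Rz Rz′)) (unique (enumK^ (tri (2 + n))))) ⟩
    ∑ codes weight              ≡⟨ ∑-++ (map inj₁ As) (map inj₂ Bs) weight ⟩
    ∑ (map inj₁ As) weight + ∑ (map inj₂ Bs) weight ≡⟨ cong₂ _+_ (∑-map inj₁ As weight) (∑-map inj₂ Bs weight) ⟩
    count (low (1 + n) (2 + d)) + ∑ Bs (weight ∘ inj₂) ≡⟨ cong (count (low (1 + n) (2 + d)) +_) Bs-count ⟩
    count (low (1 + n) (2 + d)) + suc n * (q ^ suc n * (q ^ n * count (low n d))) ∎
    where
    open ≤-Reasoning
    Code : Set
    Code = Vec K (tri (suc n)) ⊎ (Fin (suc n) × Vec K (suc n) × Vec K n × Vec K (tri n))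
    As = vectors (tri (suc n))
    B₁ = cartesianProduct (vectors n) (vectors (tri n))
    B₂ = cartesianProduct (vectors (suc n)) B₁
    Bs = cartesianProduct (allFin (suc n)) B₂
    codes : List Code
    codes = map inj₁ As ++ map inj₂ Bs
    weight : Code → ℕ
    weight (inj₁ y)               = 𝟙 (low (1 + n) (2 + d) y)
    weight (inj₂ (_ , _ , _ , y)) = 𝟙 (low n d y)
    Bs-count : ∑ Bs (weight ∘ inj₂) ≡ suc n * (q ^ suc n * (q ^ n * count (low n d)))
    Bs-count = trans (∑-proj₂ (allFin (suc n)) B₂ (λ w → 𝟙 (low n d (proj₂ (proj₂ w))))) (cong₂ _*_ (Listₚ.length-tabulate {n = suc n} (λ i → i))
      (trans (∑-proj₂ (vectors (suc n)) B₁ (λ w → 𝟙 (low n d (proj₂ w)))) (cong₂ _*_ (size-vectors (suc n))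
        (trans (∑-proj₂ (vectors n) (vectors (tri n)) (λ y → 𝟙 (low n d y))) (cong (_* count (low n d)) (size-vectors n))))))
    -- Only the direction from code to matrix has to be unambiguous.
    Rel : Vec K (tri (2 + n)) → Code → Set
    Rel z (inj₁ y)               = (∀ i → toM (2 + n) z zero (suc i) ≡ 𝟘) × Vec.drop (suc n) z ≡ y
    Rel z (inj₂ (j , u , c , y)) = Vec.take (suc n) z ≡ u
      × (∀ p → toM (2 + n) z (suc j) (suc (punchIn j p)) ≡ lookup c p)
      × toM n y ≈ schur (toM (2 + n) z) j
    Rel-injective : ∀ z z′ w → Rel z w → Rel z′ w → z ≡ z′
    Rel-injective z z′ (inj₁ y) (u≡0 , e) (u′≡0 , e′) = toM-injective (2 + n) z z′ eq
      where
      eq : toM (2 + n) z ≈ toM (2 + n) z′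
      eq zero    zero    = refl
      eq zero    (suc k) = trans (u≡0 k) (sym (u′≡0 k))
      eq (suc i) zero    = cong ⊖_ (trans (u≡0 i) (sym (u′≡0 i)))
      eq (suc i) (suc k) = cong (λ x → toM (suc n) x i k) (trans e (sym e′))
    Rel-injective z z′ (inj₂ (j , u , c , y)) (eu , ec , ey) (eu′ , ec′ , ey′) =
      toM-injective (2 + n) z z′ (schur-injective _ _ j (toM-alt (2 + n) z) (toM-alt (2 + n) z′)
        (λ { zero → refl ; (suc k) → cong (λ x → lookup x k) (trans eu (sym eu′)) })
        (λ p → trans (ec p) (sym (ec′ p))) (λ p r → trans (sym (ey p r)) (ey′ p r)))
    match : ∀ z → ∃ λ w → w ∈ codes × Rel z w × 𝟙 (low (2 + n) (2 + d) z) ≤ weight w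
    match z with any? (λ j → ¬? (toM (2 + n) z zero (suc j) ≟ 𝟘))
    ... | no none = inj₁ (Vec.drop (suc n) z) , ∈-++⁺ˡ (∈-map⁺ inj₁ (complete (enumK^ _) _)) ,
          ((λ i → decidable-stable (_ ≟ _) (λ ne → none (i , ne))) , refl) ,
          𝟙-mono (low-mono (2 + n) (1 + n) (2 + d) (2 + d) z (Vec.drop (suc n) z) (drop-rank (suc n) (2 + d) z))
    ... | yes (j , a≢0) = inj₂ (j , Vec.take (suc n) z , c , y) ,
          ∈-++⁺ʳ (map inj₁ As) (∈-map⁺ inj₂ (∈-cartesianProduct⁺ (∈-allFin j) (∈-cartesianProduct⁺ (complete (enumK^ _) _)
            (∈-cartesianProduct⁺ (complete (enumK^ _) _) (complete (enumK^ _) _))))) ,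
          (refl , (λ p → sym (Vecₚ.lookup∘tabulate _ p)) , y≈) ,
          𝟙-mono (low-mono (2 + n) n (2 + d) d z y
            (λ rk → schur-rank (toM (2 + n) z) j (toM-alt (2 + n) z) a≢0 (RankAtLeast-cong y≈ rk)))
      where
      c : Vec K n
      c = Vec.tabulate (λ p → toM (2 + n) z (suc j) (suc (punchIn j p)))
      y : Vec K (tri n)
      y = fromM n (schur (toM (2 + n) z) j)
      y≈ : toM n y ≈ schur (toM (2 + n) z) j
      y≈ = toM-fromM n _ (schur-alt (toM (2 + n) z) j (toM-alt (2 + n) z))

  count≤size : ∀ {N} (p : Vec K N → Bool) → count p ≤ q ^ N
  count≤size {N} p = ≤-trans (∑-mono (vectors N) (λ x → 𝟙≤1 (p x)))
    (≤-reflexive (trans (∑-1 (vectors N)) (size-vectors N)))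

  count-low-0 : ∀ n → count (low n 0) ≡ 0
  count-low-0 n = ∑-zero (vectors (tri n))

  -- For n ≤ 1 there is a single alternating matrix, which accounts for the base cases. In the
  -- inductive step the branch with vanishing first row is absorbed by `dimLow-mono`, while the
  -- pivot branch has exactly the exponent `suc n + n + dimLow s n`.
  count-low-upper : ∀ s n → count (low n (2 + dbl s)) ≤ involutions n * q ^ dimLow s n
  count-low-upper zero    zero       = count≤size (low 0 2)
  count-low-upper (suc s) zero       = count≤size (low 0 (4 + dbl s))
  count-low-upper zero    (suc zero) = count≤size (low 1 2)
  count-low-upper (suc s) (suc zero) = count≤size (low 1 (4 + dbl s))
  -- Rank below 2 forces the matrix 0: a pivot would lead into `low n 0`, which is empty.
  count-low-upper zero (suc (suc n)) = begin
    count (low (2 + n) 2)                   ≤⟨ count-low-step 0 n ⟩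
    count (low (1 + n) 2) + suc n * (q ^ suc n * (q ^ n * count (low n 0)))
      ≡⟨ cong (λ z → count (low (1 + n) 2) + suc n * (q ^ suc n * (q ^ n * z))) (count-low-0 n) ⟩
    count (low (1 + n) 2) + suc n * (q ^ suc n * (q ^ n * 0))
      ≡⟨ cong (count (low (1 + n) 2) +_) (solve 3 (λ a b c → a :* (b :* (c :* con 0)) := con 0) refl (suc n) (q ^ suc n) (q ^ n)) ⟩
    count (low (1 + n) 2) + 0               ≤⟨ +-mono-≤ (count-low-upper zero (suc n)) z≤n ⟩
    involutions (suc n) * 1 + suc n * involutions n * 1  ≡⟨ *-distribʳ-+ 1 (involutions (suc n)) _ ⟨
    involutions (2 + n) * 1                 ∎
    where
    open ≤-Reasoning
    open +-*-Solver
  count-low-upper (suc s) (suc (suc n)) = begin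
    count (low (2 + n) (4 + dbl s))                   ≤⟨ count-low-step (2 + dbl s) n ⟩
    count (low (1 + n) (4 + dbl s)) + suc n * (q ^ suc n * (q ^ n * count (low n (2 + dbl s))))
      ≤⟨ +-mono-≤ (count-low-upper (suc s) (suc n)) (*-monoʳ-≤ (suc n) (*-monoʳ-≤ (q ^ suc n) (*-monoʳ-≤ (q ^ n) (count-low-upper s n)))) ⟩
    involutions (suc n) * q ^ dimLow (suc s) (suc n) + suc n * (q ^ suc n * (q ^ n * (involutions n * q ^ dimLow s n)))
      ≤⟨ +-mono-≤ (*-monoʳ-≤ (involutions (suc n)) (^-monoʳ-≤ q {{ℕ.>-nonZero 1≤q}} (dimLow-mono (suc s) (suc n)))) (≤-reflexive powers) ⟩
    involutions (suc n) * Y + suc n * involutions n * Y ≡⟨ *-distribʳ-+ Y (involutions (suc n)) _ ⟨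
    involutions (2 + n) * Y ∎
    where
    open ≤-Reasoning
    open +-*-Solver
    Y = q ^ dimLow (suc s) (2 + n)
    powers : suc n * (q ^ suc n * (q ^ n * (involutions n * q ^ dimLow s n))) ≡ suc n * involutions n * Y
    powers = trans (solve 5 (λ a b c d e → a :* (b :* (c :* (d :* e))) := a :* d :* (b :* c :* e)) refl
        (suc n) (q ^ suc n) (q ^ n) (involutions n) (q ^ dimLow s n))
      (cong (suc n * involutions n *_) (sym (trans (^-distribˡ-+-* q (suc n + n) (dimLow s n)) (cong (_* q ^ dimLow s n) (^-distribˡ-+-* q (suc n) n)))))

  -- Explicit low-rank matrices and the lower bound for |T|.

  -- A certificate that the rank is at most m which survives gluing without any computation of
  -- ranks.
  RowSpan : ∀ {n} → ℕ → Mat n → Set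
  RowSpan {n} m M = ∃ λ (w : Vec (Vec K n) m) → ∀ i → ∃ λ (c : Vec K m) → ∀ j → M i j ≡ lookup (L c w) j

  -- The d chosen rows have coefficient vectors in K^m; these are dependent since m < d, and `L-L`
  -- carries the relation over to the rows.
  RowSpan⇒¬RankAtLeast : ∀ {n m d} {M : Mat n} → m < d → RowSpan m M → ¬ RankAtLeast d M
  RowSpan⇒¬RankAtLeast {n} {m} {d} {M} m<d (w , rows) (r , ind) =
    a≢0 (Vec-ext (λ l → trans (ind (lookup a) combination l) (sym (lookup-0ⱽ l))))
    where
    Γ : Vec (Vec K m) d
    Γ = Vec.tabulate (λ l → proj₁ (rows (r l)))
    relation : ∃ λ a → a ≢ 0ⱽ × L a Γ ≡ 0ⱽ
    relation = dependent Γ m<d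
    a = proj₁ relation
    a≢0 = proj₁ (proj₂ relation)
    entry : ∀ l j → M (r l) j ≡ lookup (lookup (Vec.map (λ c → L c w) Γ) l) j
    entry l j = trans (proj₂ (rows (r l)) j) (cong (λ z → lookup z j) (sym (trans (Vecₚ.lookup-map l (λ c → L c w) Γ)
      (cong (λ c → L c w) (Vecₚ.lookup∘tabulate _ l)))))
    combination : ∀ j → lcV (λ l → M (r l)) (lookup a) j ≡ 𝟘
    combination j = begin
      sumFin d (λ l → lookup a l ⊗ M (r l) j)       ≡⟨ sumFin-cong d (λ l → cong (lookup a l ⊗_) (entry l j)) ⟩
      sumFin d (λ l → lookup a l ⊗ lookup (lookup (Vec.map (λ c → L c w) Γ) l) j) ≡⟨ lookup-L a (Vec.map (λ c → L c w) Γ) j ⟨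
      lookup (L a (Vec.map (λ c → L c w) Γ)) j      ≡⟨ cong (λ z → lookup z j) (L-L a Γ w) ⟨
      lookup (L (L a Γ) w) j                        ≡⟨ cong (λ z → lookup (L z w) j) (proj₂ (proj₂ relation)) ⟩
      lookup (L 0ⱽ w) j                             ≡⟨ cong (λ z → lookup z j) (L-zero w) ⟩
      lookup 0ⱽ j                                   ≡⟨ lookup-0ⱽ j ⟩
      𝟘 ∎
      where open ≡-Reasoning

  pad : ∀ {n} → Mat n → Mat (2 + n)
  pad M (suc (suc i)) (suc (suc j)) = M i j
  pad M _             _             = 𝟘

  pad-alt : ∀ {n} {M : Mat n} → IsAlt M → IsAlt (pad M)
  pad-alt {M = M} (diag , anti) = diag′ , anti′
    where
    diag′ : ∀ i → pad M i i ≡ 𝟘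
    diag′ zero          = refl
    diag′ (suc zero)    = refl
    diag′ (suc (suc i)) = diag i
    anti′ : ∀ i j → pad M i j ≡ ⊖ pad M j i
    anti′ zero          zero          = sym Rₚ.-0#≈0#
    anti′ zero          (suc zero)    = sym Rₚ.-0#≈0#
    anti′ zero          (suc (suc j)) = sym Rₚ.-0#≈0#
    anti′ (suc zero)    zero          = sym Rₚ.-0#≈0#
    anti′ (suc zero)    (suc zero)    = sym Rₚ.-0#≈0#
    anti′ (suc zero)    (suc (suc j)) = sym Rₚ.-0#≈0#
    anti′ (suc (suc i)) zero          = sym Rₚ.-0#≈0#
    anti′ (suc (suc i)) (suc zero)    = sym Rₚ.-0#≈0#
    anti′ (suc (suc i)) (suc (suc j)) = anti i j

  L-pad : ∀ {n m} (c : Vec K m) (w : Vec (Vec K n) m) → L c (Vec.map (λ x → 𝟘 ∷ 𝟘 ∷ x) w) ≡ 𝟘 ∷ 𝟘 ∷ L c w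
  L-pad []       []      = refl
  L-pad (c ∷ cs) (w ∷ ws) = trans (cong (c · (𝟘 ∷ 𝟘 ∷ w) +ⱽ_) (L-pad cs ws))
    (cong₂ (λ a b → a ∷ b ∷ (c · w +ⱽ L cs ws)) c𝟘+𝟘 c𝟘+𝟘)
    where
    c𝟘+𝟘 : c ⊗ 𝟘 ⊕ 𝟘 ≡ 𝟘
    c𝟘+𝟘 = trans (R.+-identityʳ _) (R.zeroʳ c)

  module Glue {n : ℕ} (a : K) (b c : Vec K n) (M : Mat n) where
    x y : Vec K (2 + n)
    x = 𝟏 ∷ 𝟘 ∷ b
    y = 𝟘 ∷ a ∷ c

    -- The Schur step reversed, with pivot a at position (0,1): the first row is (0, a, c), the
    -- second continues with -a b, and for nonzero a the Schur complement is M again. This gives 2n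
    -- + 1 parameters, the increment of `dimLow`.
    glue : Mat (2 + n)
    glue = addM (wedge (lookup x) (lookup y)) (pad M)

    glue-alt : IsAlt M → IsAlt glue
    glue-alt alt = addM-alt {A = wedge (lookup x) (lookup y)} (wedge-alt (lookup x) (lookup y)) (pad-alt alt)

    glue-RowSpan : ∀ {m} → RowSpan m M → RowSpan (2 + m) glue
    glue-RowSpan {m} (w , rows) = x ∷ y ∷ w′ , λ i → ⊖ lookup y i ∷ lookup x i ∷ proj₁ (padRow i) , λ j → entry i j
      where
      w′ : Vec (Vec K (2 + n)) m
      w′ = Vec.map (λ x → 𝟘 ∷ 𝟘 ∷ x) w
      padRow : ∀ i → ∃ λ (c : Vec K m) → ∀ j → pad M i j ≡ lookup (L c w′) j
      padRow zero          = 0ⱽ , λ j → sym (trans (cong (λ z → lookup z j) (L-zero w′)) (lookup-0ⱽ j))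
      padRow (suc zero)    = 0ⱽ , λ j → sym (trans (cong (λ z → lookup z j) (L-zero w′)) (lookup-0ⱽ j))
      padRow (suc (suc i)) = proj₁ (rows i) , λ j → trans (shifted j) (sym (cong (λ z → lookup z j) (L-pad (proj₁ (rows i)) w)))
        where
        shifted : ∀ j → pad M (suc (suc i)) j ≡ lookup (𝟘 ∷ 𝟘 ∷ L (proj₁ (rows i)) w) j
        shifted zero          = refl
        shifted (suc zero)    = refl
        shifted (suc (suc j)) = proj₂ (rows i) j
      entry : ∀ i j → glue i j ≡ lookup (⊖ lookup y i · x +ⱽ (lookup x i · y +ⱽ L (proj₁ (padRow i)) w′)) j
      entry i j = sym (begin
        lookup (⊖ yᵢ · x +ⱽ (xᵢ · y +ⱽ r)) j            ≡⟨ lookup-+ⱽ j (⊖ yᵢ · x) (xᵢ · y +ⱽ r) ⟩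
        lookup (⊖ yᵢ · x) j ⊕ lookup (xᵢ · y +ⱽ r) j
          ≡⟨ cong₂ _⊕_ (lookup-· j (⊖ yᵢ) x) (trans (lookup-+ⱽ j (xᵢ · y) r) (cong₂ _⊕_ (lookup-· j xᵢ y) (sym (proj₂ (padRow i) j)))) ⟩
        ⊖ yᵢ ⊗ lookup x j ⊕ (xᵢ ⊗ lookup y j ⊕ pad M i j) ≡⟨ R.+-assoc _ _ _ ⟨
        ⊖ yᵢ ⊗ lookup x j ⊕ xᵢ ⊗ lookup y j ⊕ pad M i j
          ≡⟨ cong (_⊕ pad M i j) (trans (R.+-comm _ _) (cong (xᵢ ⊗ lookup y j ⊕_) (sym (Rₚ.-‿distribˡ-* yᵢ _)))) ⟩
        glue i j ∎)
        where
        open ≡-Reasoning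
        xᵢ = lookup x i
        yᵢ = lookup y i
        r = L (proj₁ (padRow i)) w′

    glue-row₀ : ∀ j → glue zero (suc j) ≡ lookup (a ∷ c) j
    glue-row₀ j = trans (R.+-identityʳ _) (trans (cong₂ _⊕_ (R.*-identityˡ _) (trans (cong ⊖_ (R.zeroˡ _)) Rₚ.-0#≈0#)) (R.+-identityʳ _))

    glue-row₁ : ∀ j → glue (suc zero) (suc (suc j)) ≡ ⊖ (a ⊗ lookup b j)
    glue-row₁ j = trans (R.+-identityʳ _) (trans (cong (_⊕ ⊖ (a ⊗ lookup b j)) (R.zeroˡ _)) (R.+-identityˡ _))

  open Glue using (glue; glue-alt; glue-RowSpan; glue-row₀; glue-row₁)

  -- The first row shows a and c; the second shows a b, from which b is recovered by dividing by a.
  glue-injective : ∀ {n} a b c (M : Mat n) a′ b′ c′ M′ → a ≢ 𝟘 → glue a b c M ≈ glue a′ b′ c′ M′ →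
                   a ≡ a′ × b ≡ b′ × c ≡ c′ × M ≈ M′
  glue-injective a b c M a′ b′ c′ M′ a≢0 h = a≡a′ , b≡b′ , c≡c′ , M≈M′
    where
    row₀ : a ∷ c ≡ a′ ∷ c′
    row₀ = Vec-ext {x = a ∷ c} {a′ ∷ c′} (λ j → trans (sym (glue-row₀ a b c M j)) (trans (h zero (suc j)) (glue-row₀ a′ b′ c′ M′ j)))
    a≡a′ = Vecₚ.∷-injectiveˡ row₀
    c≡c′ = Vecₚ.∷-injectiveʳ row₀
    b≡b′ : b ≡ b′
    b≡b′ = Vec-ext (λ j → Rₚ.x∙y⁻¹≈ε⇒x≈y _ _ (⊗-cancelˡ-𝟘 a≢0 (trans (Rₚ.x[y-z]≈xy-xz a _ _) (Rₚ.x≈y⇒x∙y⁻¹≈ε (row₁ j)))))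
      where
      row₁ : ∀ j → a ⊗ lookup b j ≡ a ⊗ lookup b′ j
      row₁ j = Rₚ.-‿injective (trans (sym (glue-row₁ a b c M j)) (trans (h (suc zero) (suc (suc j)))
        (trans (glue-row₁ a′ b′ c′ M′ j) (cong (λ z → ⊖ (z ⊗ lookup b′ j)) (sym a≡a′)))))
    M≈M′ : M ≈ M′
    M≈M′ i j = Rₚ.+-cancelˡ _ _ _ (trans (h (suc (suc i)) (suc (suc j)))
      (cong (_⊕ M′ i j) (sym (cong₂ (λ u v → lookup u i ⊗ lookup v j ⊕ ⊖ (lookup v i ⊗ lookup u j)) b≡b′ c≡c′))))

  unique-map : ∀ {A B : Set} {P : A → Set} {f : A → B} {xs} → All P xs →
               (∀ {x y} → P x → P y → f x ≡ f y → x ≡ y) → Unique xs → Unique (map f xs)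
  unique-map []         inj []       = []
  unique-map (px ∷ pxs) inj (d ∷ ds) =
    Allₚ.map⁺ (All.zipWith (λ { (py , x≢y) e → x≢y (inj px py e) }) (pxs , d)) ∷ unique-map pxs inj ds

  units : List K
  units = filterᵇ (λ a → not (eqᵇ a 𝟘)) elements

  -- Replaces the factor q - 1 by q/2; one such loss in each gluing step accounts for the constant
  -- 2^s.
  units-many : q ≤ 2 * length units
  units-many = begin
    q                                ≡⟨ ∑-complement elements (λ a → eqᵇ a 𝟘) ⟨
    ∑ elements (λ a → 𝟙 (not (eqᵇ a 𝟘))) + ∑ elements (λ a → 𝟙 (eqᵇ a 𝟘)) ≡⟨ cong (_+ z) (length-filterᵇ _ elements) ⟨
    length units + z                 ≤⟨ +-monoʳ-≤ (length units) (≤-trans z≤1 1≤u) ⟩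
    length units + length units      ≡⟨ cong (length units +_) (+-identityʳ _) ⟨
    2 * length units                 ∎
    where
    open ≤-Reasoning
    z = ∑ elements (λ a → 𝟙 (eqᵇ a 𝟘))
    z≤1 : z ≤ 1
    z≤1 = ∑-atMostOne elements (λ a → eqᵇ a 𝟘) (AllPairs.map (λ a≢b h h′ → a≢b (trans (eqᵇ⇒≡ h) (sym (eqᵇ⇒≡ h′)))) (unique enumK))
    1≤u : 1 ≤ length units
    1≤u = ℕ.s≤s⁻¹ (begin
      2                   ≤⟨ 2≤q ⟩
      q                   ≡⟨ ∑-complement elements (λ a → eqᵇ a 𝟘) ⟨
      ∑ elements (λ a → 𝟙 (not (eqᵇ a 𝟘))) + z ≡⟨ cong (_+ z) (length-filterᵇ _ elements) ⟨
      length units + z    ≤⟨ +-monoʳ-≤ (length units) z≤1 ⟩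
      length units + 1    ≡⟨ +-comm (length units) 1 ⟩
      suc (length units)  ∎)

  Params : ℕ → Set
  Params n = K × Vec K n × Vec K n × Vec K (tri n)

  build : ∀ n → Params n → Vec K (tri (2 + n))
  build n (a , b , c , y) = fromM (2 + n) (glue a b c (toM n y))

  toM-build : ∀ n a b c y → toM (2 + n) (build n (a , b , c , y)) ≈ glue a b c (toM n y)
  toM-build n a b c y = toM-fromM (2 + n) _ (glue-alt a b c (toM n y) (toM-alt n y))

  -- Keeping the pivot always at position (0,1) misses many matrices of rank at most 2s, but only
  -- costs a constant factor.
  lowList : ∀ (s n : ℕ) → List (Vec K (tri n))
  lowList zero    n             = 0ⱽ ∷ []
  lowList (suc s) (suc (suc n)) = map (build n) (cartesianProduct units (cartesianProduct (vectors n) (cartesianProduct (vectors n) (lowList s n))))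
  lowList (suc s) _             = []

  lowList-unique : ∀ s n → Unique (lowList s n)
  lowList-unique zero    n             = [] ∷ []
  lowList-unique (suc s) zero          = []
  lowList-unique (suc s) (suc zero)    = []
  lowList-unique (suc s) (suc (suc n)) = unique-map {P = λ w → proj₁ w ≢ 𝟘} (All.tabulate nonzero) injective
    (Uniqueₚ.cartesianProduct⁺ (Uniqueₚ.filter⁺ (T? ∘ (λ a → not (eqᵇ a 𝟘))) (unique enumK)) (Uniqueₚ.cartesianProduct⁺ (unique (enumK^ n))
      (Uniqueₚ.cartesianProduct⁺ (unique (enumK^ n)) (lowList-unique s n))))
    where
    nonzero : ∀ {w} → w ∈ cartesianProduct units (cartesianProduct (vectors n) (cartesianProduct (vectors n) (lowList s n))) → proj₁ w ≢ 𝟘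
    nonzero {w} w∈ e = not-T (proj₂ (∈-filter⁻ (T? ∘ (λ a → not (eqᵇ a 𝟘))) {xs = elements} (proj₁ (∈-cartesianProduct⁻ units _ w∈)))) (≡⇒eqᵇ e)
    injective : ∀ {w w′ : Params n} → proj₁ w ≢ 𝟘 → proj₁ w′ ≢ 𝟘 → build n w ≡ build n w′ → w ≡ w′
    injective {a , b , c , y} {a′ , b′ , c′ , y′} a≢0 _ e
      with glue-injective a b c (toM n y) a′ b′ c′ (toM n y′) a≢0
        (λ i j → trans (sym (toM-build n a b c y i j)) (trans (cong (λ z → toM (2 + n) z i j) e) (toM-build n a′ b′ c′ y′ i j)))
    ... | refl , refl , refl , h with toM-injective n y y′ h
    ... | refl = refl

  lowList-span : ∀ s n {z} → z ∈ lowList s n → RowSpan (dbl s) (toM n z)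
  lowList-span zero n (here refl) = [] , λ i → [] , λ j → trans (toM-0 n i j) (sym (lookup-0ⱽ j))
  lowList-span (suc s) (suc (suc n)) z∈ with ∈-map⁻ (build n) z∈
  ... | (a , b , c , y) , w∈ , refl =
    let y∈ = proj₂ (∈-cartesianProduct⁻ (vectors n) (lowList s n)
               (proj₂ (∈-cartesianProduct⁻ (vectors n) _ (proj₂ (∈-cartesianProduct⁻ units _ w∈)))))
        w , rows = glue-RowSpan a b c (toM n y) (lowList-span s n y∈)
    in w , λ i → proj₁ (rows i) , λ j → trans (toM-build n a b c y i j) (proj₂ (rows i) j)

  length-product : ∀ {A B : Set} (xs : List A) (ys : List B) → length (cartesianProduct xs ys) ≡ length xs * length ys
  length-product xs ys = trans (sym (∑-1 (cartesianProduct xs ys)))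
    (trans (∑-proj₂ xs ys (λ _ → 1)) (cong (length xs *_) (∑-1 ys)))

  lowList-length : ∀ s n → dbl s ≤ n → q ^ dimLow s n ≤ 2 ^ s * length (lowList s n)
  lowList-length zero    n _ = ≤-refl
  lowList-length (suc s) (suc (suc n)) (s≤s (s≤s h)) = begin
    q ^ (suc n + n + dimLow s n)
      ≡⟨ trans (^-distribˡ-+-* q (suc n + n) (dimLow s n)) (cong (_* q ^ dimLow s n) (^-distribˡ-+-* q (suc n) n)) ⟩
    q * q ^ n * q ^ n * q ^ dimLow s n      ≤⟨ *-mono-≤ (*-monoˡ-≤ (q ^ n) (*-monoˡ-≤ (q ^ n) units-many)) (lowList-length s n h) ⟩
    2 * u * q ^ n * q ^ n * (2 ^ s * l)
      ≡⟨ solve 4 (λ u x t l → con 2 :* u :* x :* x :* (t :* l) := con 2 :* t :* (u :* (x :* (x :* l)))) refl u (q ^ n) (2 ^ s) l ⟩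
    2 ^ suc s * (u * (q ^ n * (q ^ n * l))) ≡⟨ cong (2 ^ suc s *_) len ⟨
    2 ^ suc s * length (lowList (suc s) (2 + n)) ∎
    where
    open ≤-Reasoning
    open +-*-Solver
    u = length units
    l = length (lowList s n)
    C₁ = cartesianProduct (vectors n) (lowList s n)
    C₂ = cartesianProduct (vectors n) C₁
    len : length (lowList (suc s) (2 + n)) ≡ u * (q ^ n * (q ^ n * l))
    len = trans (Listₚ.length-map (build n) (cartesianProduct units C₂)) (trans (length-product units C₂) (cong (u *_)
      (trans (length-product (vectors n) C₁) (cong₂ _*_ (size-vectors n) (trans (length-product (vectors n) (lowList s n)) (cong (_* l) (size-vectors n)))))))

  count-low-lower : ∀ s n → dbl s ≤ n → q ^ dimLow s n ≤ 2 ^ s * count (low n (2 + dbl s))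
  count-low-lower s n h = ≤-trans (lowList-length s n h) (*-monoʳ-≤ (2 ^ s) (≤-trans (≤-reflexive (sym (∑-1 (lowList s n))))
    (∑-inject _≡_ (λ _ → 1) (λ z → 𝟙 (low n (2 + dbl s) z)) (lowList s n) (vectors (tri n))
      (λ {z} z∈ → inj₂ (z , complete (enumK^ _) z , refl , 𝟙-mono {true} (λ _ → T-not (λ r →
        RowSpan⇒¬RankAtLeast {M = toM n z} (n≤1+n _) (lowList-span s n z∈) (rankAtLeast⇒ _ (toM n z) r)))))
      (AllPairs.map (λ { x≢y _ refl refl → x≢y refl }) (lowList-unique s n)))))

  -- Independent tuples and k-dimensional spaces in coordinates.

  zeroᵇ : ∀ {N} → Vec K N → Bool
  zeroᵇ z = ⌊ z ≟ⱽ 0ⱽ ⌋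

  indepᵇ : ∀ {N k} → Vec (Vec K N) k → Bool
  indepᵇ v = not (hits zeroᵇ v)

  indep⇒ : ∀ {N k} (v : Vec (Vec K N) k) → T (indepᵇ v) → ∀ c → L c v ≡ 0ⱽ → c ≡ 0ⱽ
  indep⇒ v h c e with c ≟ⱽ 0ⱽ
  ... | yes p   = p
  ... | no c≢0  = ⊥-elim (not-T h (hits-complete zeroᵇ closed v c c≢0 (fromWitness {a? = L c v ≟ⱽ 0ⱽ} e)))
    where
    closed : ∀ {N} a (x : Vec K N) → T (zeroᵇ x) → T (zeroᵇ (a · x))
    closed {N} a x hx = fromWitness {a? = (a · x) ≟ⱽ 0ⱽ} (trans (cong (a ·_) (toWitness {a? = x ≟ⱽ 0ⱽ} hx)) (·-zeroʳ N a))

  ⇒indep : ∀ {N k} (v : Vec (Vec K N) k) → (∀ c → L c v ≡ 0ⱽ → c ≡ 0ⱽ) → T (indepᵇ v)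
  ⇒indep v ker = T-not (λ h → let c , c≢0 , e = hits-sound zeroᵇ v h in c≢0 (ker c (toWitness {a? = L c v ≟ⱽ 0ⱽ} e)))

  allᵛ : ∀ {A : Set} {k} → (A → Bool) → Vec A k → Bool
  allᵛ p []       = true
  allᵛ p (x ∷ xs) = p x ∧ allᵛ p xs

  allᵛ⇒ : ∀ {A : Set} {k} (p : A → Bool) (v : Vec A k) → T (allᵛ p v) → ∀ l → T (p (lookup v l))
  allᵛ⇒ p (x ∷ v) h zero    = proj₁ (to (T-∧ {p x}) h)
  allᵛ⇒ p (x ∷ v) h (suc l) = allᵛ⇒ p v (proj₂ (to (T-∧ {p x}) h)) l

  ⇒allᵛ : ∀ {A : Set} {k} (p : A → Bool) (v : Vec A k) → (∀ l → T (p (lookup v l))) → T (allᵛ p v)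
  ⇒allᵛ p []      h = _
  ⇒allᵛ p (x ∷ v) h = from (T-∧ {p x}) (h zero , ⇒allᵛ p v (λ l → h (suc l)))

  T-stable : ∀ {b} → ¬ ¬ T b → T b
  T-stable {b} = decidable-stable (T? b)

  -- Isolates the linear algebra from the lists of matrices that represent subspaces: only
  -- membership matters, given as a Boolean predicate on coordinate vectors.
  record KSpace {N} (k : ℕ) (p : Vec K N → Bool) : Set where
    field
      0∈     : T (p 0ⱽ)
      +∈     : ∀ x y → T (p x) → T (p y) → T (p (x +ⱽ y))
      ·∈     : ∀ c x → T (p x) → T (p (c · x))
      basis  : Vec (Vec K N) k
      basis∈ : T (allᵛ p basis)
      ker    : ∀ c → L c basis ≡ 0ⱽ → c ≡ 0ⱽ
      span   : ∀ z → T (p z) → ∃ λ c → L c basis ≡ z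

    L∈ : ∀ {l} (c : Vec K l) (v : Vec (Vec K N) l) → T (allᵛ p v) → T (p (L c v))
    L∈ []       []       h = 0∈
    L∈ (c ∷ cs) (v ∷ vs) h = let pv , pvs = to (T-∧ {p v}) h in +∈ (c · v) (L cs vs) (·∈ c v pv) (L∈ cs vs pvs)

    coordinates : ∀ {l} (v : Vec (Vec K N) l) → T (allᵛ p v) → ∃ λ (A : Vec (Vec K k) l) → Vec.map (λ a → L a basis) A ≡ v
    coordinates []       h = [] , refl
    coordinates (v ∷ vs) h = let pv , pvs = to (T-∧ {p v}) h ; a , e = span v pv ; A , E = coordinates vs pvs
                             in a ∷ A , cong₂ _∷_ e E

    combine-injective : ∀ {l} (A A′ : Vec (Vec K k) l) → Vec.map (λ a → L a basis) A ≡ Vec.map (λ a → L a basis) A′ → A ≡ A′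
    combine-injective []      []        e = refl
    combine-injective (a ∷ A) (a′ ∷ A′) e = cong₂ _∷_ (L-injective basis ker a a′ (Vecₚ.∷-injectiveˡ e))
                                                      (combine-injective A A′ (Vecₚ.∷-injectiveʳ e))

    -- A basis of the space identifies independent k-tuples in K^k with bases of the space, so the
    -- bound is the same number for every space.
    indep-tuples-lower : ∑ (tuples k k) (λ A → 𝟙 (indepᵇ A)) ≤ ∑ (tuples N k) (λ v → 𝟙 (indepᵇ v ∧ allᵛ p v))
    indep-tuples-lower = ∑-injective (enumVec (enumK^ k) k) (enumVec (enumK^ N) k) _ _ (Vec.map (λ a → L a basis))
      combine-injective (λ A → 𝟙-mono (λ h → from (T-∧ {indepᵇ (combine A)})
        (⇒indep (combine A) (λ c e → indep⇒ A h c (ker _ (trans (L-L c A basis) e))) ,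
         ⇒allᵛ p (combine A) (λ l → subst (T ∘ p) (sym (Vecₚ.lookup-map l _ A)) (L∈ (lookup A l) basis basis∈)))))
      where
      combine : Vec (Vec K k) k → Vec (Vec K N) k
      combine = Vec.map (λ a → L a basis)

    tuples-upper : ∑ (tuples N k) (λ v → 𝟙 (allᵛ p v)) ≤ (q ^ k) ^ k
    tuples-upper = ≤-trans (∑-inject (λ v A → Vec.map (λ a → L a basis) A ≡ v) (λ v → 𝟙 (allᵛ p v)) (λ _ → 1) (tuples N k) (tuples k k)
        (λ {v} _ → match v) (AllPairs.map (λ v≢v′ A e e′ → v≢v′ (trans (sym e) e′)) (unique (enumVec (enumK^ N) k))))
      (≤-reflexive (trans (∑-1 (tuples k k)) (size-tuples k k)))
      where
      match : ∀ v → 𝟙 (allᵛ p v) ≡ 0 ⊎ ∃ λ A → A ∈ tuples k k × Vec.map (λ a → L a basis) A ≡ v × 𝟙 (allᵛ p v) ≤ 1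
      match v with allᵛ p v in eq
      ... | false = inj₁ refl
      ... | true  = let A , e = coordinates v (subst T (sym eq) _) in
                    inj₂ (A , complete (enumVec (enumK^ k) k) A , e , ≤-refl)

    -- k + 1 vectors of a k-dimensional space are dependent, and the new vector occurs in the relation.
    indep-spans : (v : Vec (Vec K N) k) → T (indepᵇ v) → T (allᵛ p v) → ∀ z → T (p z) → ∃ λ c → L c v ≡ z
    indep-spans v ind v∈ z z∈ with coordinates (z ∷ v) (from (T-∧ {p z}) (z∈ , v∈))
    ... | A , e with dependent A ≤-refl
    ... | (c ∷ cs) , c≢0 , relation = ⊖ inv c · cs , trans (L-· (⊖ inv c) cs v) (Vₚ.∙-cancelʳ (inv c · L cs v) _ _ (begin
      ⊖ inv c · L cs v +ⱽ inv c · L cs v   ≡⟨ ·-distribʳ (⊖ inv c) (inv c) (L cs v) ⟨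
      (⊖ inv c ⊕ inv c) · L cs v           ≡⟨ cong (_· L cs v) (R.-‿inverseˡ (inv c)) ⟩
      𝟘 · L cs v                           ≡⟨ ·-zeroˡ _ ⟩
      0ⱽ                                   ≡⟨ ·-zeroʳ _ (inv c) ⟨
      inv c · 0ⱽ                           ≡⟨ cong (inv c ·_) relation′ ⟨
      inv c · (c · z +ⱽ L cs v)            ≡⟨ ·-distribˡ (inv c) _ _ ⟩
      inv c · (c · z) +ⱽ inv c · L cs v    ≡⟨ cong (_+ⱽ inv c · L cs v) (·-invˡ c≢𝟘 z) ⟩
      z +ⱽ inv c · L cs v                  ∎))
      where
      open ≡-Reasoning
      relation′ : c · z +ⱽ L cs v ≡ 0ⱽ
      relation′ = begin
        L (c ∷ cs) (z ∷ v)                            ≡⟨ cong (L (c ∷ cs)) e ⟨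
        L (c ∷ cs) (Vec.map (λ a → L a basis) A)      ≡⟨ L-L (c ∷ cs) A basis ⟨
        L (L (c ∷ cs) A) basis                        ≡⟨ cong (λ w → L w basis) relation ⟩
        L 0ⱽ basis                                    ≡⟨ L-zero basis ⟩
        0ⱽ                                            ∎
      c≢𝟘 : c ≢ 𝟘
      c≢𝟘 refl = c≢0 (cong (𝟘 ∷_) (indep⇒ v ind cs (trans (sym (trans (cong (_+ⱽ L cs v) (·-zeroˡ z)) (V.identityˡ _))) relation′)))

  -- Lists of matrices and of subspaces up to pointwise equality.

  AllPairs-∈ : ∀ {B : Set} {R R′ : B → B → Set} {xs} → (∀ {x y} → x ∈ xs → y ∈ xs → R x y → R′ x y) → AllPairs R xs → AllPairs R′ xs
  AllPairs-∈ h []       = []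
  AllPairs-∈ h (d ∷ ds) = All.tabulate (λ p → h (here refl) (there p) (All.lookup d p)) ∷ AllPairs-∈ (λ p r → h (there p) (there r)) ds

  module _ {A : Set} (_~_ : A → A → Set) where

    allFuns-distinct : ∀ {xs} m → AllPairs (λ x y → ¬ x ~ y) xs → AllPairs (λ f g → ¬ (∀ i → f i ~ g i)) (allFuns xs m)
    allFuns-distinct zero    d = [] ∷ []
    allFuns-distinct (suc m) d = AllPairsₚ.concat⁺
      (Allₚ.map⁺ (All.tabulate (λ _ → AllPairsₚ.map⁺ (AllPairs.map (λ h e → h (e ∘ suc)) (allFuns-distinct m d)))))
      (AllPairsₚ.map⁺ (AllPairs.map (λ x≁y → Allₚ.map⁺ (All.tabulate (λ _ → Allₚ.map⁺ (All.tabulate (λ _ e → x≁y (e zero)))))) d))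

    _⊑_ : List A → List A → Set
    S ⊑ S′ = ∀ {x} → x ∈ S → ∃ λ y → y ∈ S′ × x ~ y

    sublists-⊆ : ∀ xs {S : List A} → S ∈ sublists xs → ∀ {y} → y ∈ S → y ∈ xs
    sublists-⊆ []       (here refl) ()
    sublists-⊆ (x ∷ xs) S∈ y∈ with ∈-++⁻ (map (x ∷_) (sublists xs)) S∈
    ... | inj₂ S∈′ = there (sublists-⊆ xs S∈′ y∈)
    ... | inj₁ S∈′ with ∈-map⁻ (x ∷_) S∈′
    sublists-⊆ (x ∷ xs) S∈ (here e)   | inj₁ _ | S′ , S′∈ , refl = here e
    sublists-⊆ (x ∷ xs) S∈ (there y∈) | inj₁ _ | S′ , S′∈ , refl = there (sublists-⊆ xs S′∈ y∈)

    -- Distinct positions in the list of sublists differ even as sets modulo `~`. If both sublists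
    -- contain `x`, it can be removed from both, as no other listed element is related to `x`.
    sublists-distinct : (∀ {x y} → x ~ y → y ~ x) → ∀ {xs} → AllPairs (λ x y → ¬ x ~ y) xs →
                        AllPairs (λ S S′ → ¬ (S ⊑ S′ × S′ ⊑ S)) (sublists xs)
    sublists-distinct sym~ []              = [] ∷ []
    sublists-distinct sym~ {x ∷ xs} (d ∷ ds) = AllPairsₚ.++⁺
      (AllPairsₚ.map⁺ (AllPairs-∈ (λ S∈ S′∈ h → λ { (f , g) → h (remove S∈ f , remove S′∈ g) }) rec))
      rec
      (Allₚ.map⁺ (All.tabulate (λ _ → All.tabulate (λ S′∈ → λ { (f , _) → let y , y∈ , x~y = f (here refl) in
        All.lookup d (sublists-⊆ xs S′∈ y∈) x~y }))))
      where
      rec = sublists-distinct sym~ ds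
      remove : ∀ {S S′} → S ∈ sublists xs → (x ∷ S) ⊑ (x ∷ S′) → S ⊑ S′
      remove S∈ f y∈ with f (there y∈)
      ... | z , there z∈ , y~z  = z , z∈ , y~z
      ... | _ , here refl , y~x = ⊥-elim (All.lookup d (sublists-⊆ xs S∈ y∈) (sym~ y~x))

  filterᵇ∈sublists : ∀ {A : Set} (p : A → Bool) xs → filterᵇ p xs ∈ sublists xs
  filterᵇ∈sublists p []       = here refl
  filterᵇ∈sublists p (x ∷ xs) with p x
  ... | true  = ∈-++⁺ˡ (∈-map⁺ (x ∷_) (filterᵇ∈sublists p xs))
  ... | false = ∈-++⁺ʳ (map (x ∷_) (sublists xs)) (filterᵇ∈sublists p xs)

  isAlt⇒ : ∀ {n} (M : Mat n) → T (isAltᵇ M) → IsAlt M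
  isAlt⇒ {n} M h = (λ i → eqᵇ⇒≡ (proj₁ (row i))) , λ i j → eqᵇ⇒≡ (T-all _ (allFin n) (proj₂ (row i)) (∈-allFin j))
    where
    row : ∀ i → T (eqᵇ (M i i) 𝟘) × T (all (λ j → eqᵇ (M i j) (⊖ (M j i))) (allFin n))
    row i = to (T-∧ {eqᵇ (M i i) 𝟘}) (T-all _ (allFin n) h (∈-allFin i))

  ⇒isAlt : ∀ {n} (M : Mat n) → IsAlt M → T (isAltᵇ M)
  ⇒isAlt {n} M (diag , anti) = all-T _ (allFin n) (λ {i} _ → from (T-∧ {eqᵇ (M i i) 𝟘})
    (≡⇒eqᵇ (diag i) , all-T _ (allFin n) (λ {j} _ → ≡⇒eqᵇ (anti i j))))

  Alt-complete : ∀ {n} (M : Mat n) → IsAlt M → ∃ λ M′ → M′ ∈ Alt n × M′ ≈ M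
  Alt-complete {n} M (diag , anti) =
    let M′ , M′∈ , eq = allFuns-complete (λ (u w : Row n) → ∀ j → u j ≡ w j) (allFuns elements n) n M (λ i → allFuns-K (M i))
    in M′ , ∈-filter⁺ (T? ∘ isAltᵇ) M′∈ (⇒isAlt M′ ((λ i → trans (eq i i) (diag i)) ,
         (λ i j → trans (eq i j) (trans (anti i j) (cong ⊖_ (sym (eq j i))))))) , eq

  Alt-sound : ∀ {n} {M : Mat n} → M ∈ Alt n → IsAlt M
  Alt-sound {n} {M} M∈ = isAlt⇒ M (proj₂ (∈-filter⁻ (T? ∘ isAltᵇ) {xs = allFuns (allFuns elements n) n} M∈))

  Alt-distinct : ∀ n → AllPairs (λ A B → ¬ A ≈ B) (Alt n)
  Alt-distinct n = AllPairsₚ.filter⁺ (T? ∘ isAltᵇ)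
    (allFuns-distinct (λ u w → ∀ j → u j ≡ w j) n (allFuns-distinct _≡_ n (unique enumK)))

  mem⇒ : ∀ {n} (A : Mat n) S → T (memᵇ A S) → ∃ λ B → B ∈ S × A ≈ B
  mem⇒ A S h = let B , B∈ , e = T-any (eqMᵇ A) S h in B , B∈ , eqM⇒≈ {A = A} {B} e

  ⇒mem : ∀ {n} {A B : Mat n} {S} → B ∈ S → A ≈ B → T (memᵇ A S)
  ⇒mem {A = A} {B} B∈ e = any-T (eqMᵇ A) B∈ (≈⇒eqM {A = A} {B} e)

  ≈-trans : ∀ {n} {A B C : Mat n} → A ≈ B → B ≈ C → A ≈ C
  ≈-trans e f i j = trans (e i j) (f i j)

  ≈-sym : ∀ {n} {A B : Mat n} → A ≈ B → B ≈ A
  ≈-sym e i j = sym (e i j)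

  inᵇ : ∀ n → List (Mat n) → Vec K (tri n) → Bool
  inᵇ n S z = memᵇ (toM n z) S

  lcM-cong : ∀ {k n} {v w : Fin k → Mat n} {c d : Row k} → (∀ l → v l ≈ w l) → (∀ l → c l ≡ d l) → lcM v c ≈ lcM w d
  lcM-cong {k} v≈w c≡d i j = sumFin-cong k (λ l → cong₂ _⊗_ (c≡d l) (v≈w l i j))

  indepM⇒ : ∀ {k n} (v : Fin k → Mat n) → T (indepMᵇ v) → ∀ (c : Row k) → (∀ i j → lcM v c i j ≡ 𝟘) → ∀ l → c l ≡ 𝟘
  indepM⇒ v h c e l with allFuns-K c
  ... | c′ , c′∈ , eq with to (T-∨ {isZeroVᵇ c′}) (T-all _ _ h c′∈)
  ... | inj₁ z  = trans (sym (eq l)) (isZeroV⇒ {u = c′} z l)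
  ... | inj₂ nz = ⊥-elim (not-T nz (⇒isZeroM {A = lcM v c′} (≈-trans {A = lcM v c′} {lcM v c} {zeroM} (lcM-cong {v = v} {v} (λ _ _ _ → refl) eq) e)))

  ⇒indepM : ∀ {k n} (v : Fin k → Mat n) → (∀ (c : Row k) → (∀ i j → lcM v c i j ≡ 𝟘) → ∀ l → c l ≡ 𝟘) → T (indepMᵇ v)
  ⇒indepM {k} v ind = all-T _ (allFuns elements k) (λ {c} _ → step c)
    where
    step : ∀ c → T (isZeroVᵇ c ∨ not (isZeroMᵇ (lcM v c)))
    step c with isZeroMᵇ (lcM v c) in eq
    ... | false = from (T-∨ {isZeroVᵇ c}) (inj₂ _)
    ... | true  = from (T-∨ {isZeroVᵇ c}) (inj₁ (⇒isZeroV {u = c} (ind c (isZeroM⇒ {A = lcM v c} (subst T (sym eq) _)))))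

  module _ (n k : ℕ) where

    private
      N = tri n
      subspaceᵇ : List (Mat n) → Bool
      subspaceᵇ S = isSubspaceᵇ S ∧ hasDimᵇ k S

    kSubspace-alt : ∀ {S} → S ∈ kSubspaces n k → ∀ {M} → M ∈ S → IsAlt M
    kSubspace-alt S∈ M∈ = Alt-sound (sublists-⊆ _≈_ (Alt n) (proj₁ (∈-filter⁻ (T? ∘ subspaceᵇ) {xs = sublists (Alt n)} S∈)) M∈)

    -- The basis found by `hasDimᵇ` is rewritten in coordinates; `toM-b̂` says that this commutes
    -- with linear combinations.
    kSubspace⇒KSpace : ∀ {S} → S ∈ kSubspaces n k → KSpace k (inᵇ n S)
    kSubspace⇒KSpace {S} S∈ = record
      { 0∈ = mem-cong zeroM (toM n 0ⱽ) (toM-0 n) (proj₁ closure)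
      ; +∈ = λ x y hx hy → let A , A∈ , ex = mem⇒ (toM n x) S hx ; B , B∈ , ey = mem⇒ (toM n y) S hy in
          mem-cong (addM A B) (toM n (x +ⱽ y)) (λ i j → trans (toM-+ n x y i j) (cong₂ _⊕_ (ex i j) (ey i j)))
            (T-all _ S (T-all _ S (proj₁ (proj₂ closure)) A∈) B∈)
      ; ·∈ = λ c x hx → let A , A∈ , ex = mem⇒ (toM n x) S hx in
          mem-cong (scaleM c A) (toM n (c · x)) (λ i j → trans (toM-· n c x i j) (cong (c ⊗_) (ex i j)))
            (T-all _ S (T-all _ elements (proj₂ (proj₂ closure)) (complete enumK c)) A∈)
      ; basis = b̂
      ; basis∈ = ⇒allᵛ (inᵇ n S) b̂ (λ l → ⇒mem (allFuns-sound S k b∈ l) (b̂≈b l))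
      ; ker = λ c e → Vec-ext (λ l → trans (indepM⇒ b (proj₁ b-props) (lookup c)
          (λ i j → trans (sym (toM-b̂ c i j)) (trans (cong (λ z → toM n z i j) e) (toM-0 n i j))) l) (sym (lookup-0ⱽ l)))
      ; span = λ z hz → let M , M∈ , e = mem⇒ (toM n z) S hz
                            c , _ , ec = T-any (λ c → eqMᵇ (lcM b c) M) (allFuns elements k) (T-all _ S (proj₂ b-props) M∈)
                        in Vec.tabulate c , toM-injective n _ z (λ i j → trans (toM-b̂ (Vec.tabulate c) i j)
                             (trans (lcM-cong {v = b} {b} (λ _ _ _ → refl) (λ l → Vecₚ.lookup∘tabulate c l) i j)
                               (trans (eqM⇒≈ {A = lcM b c} {M} ec i j) (sym (e i j)))))
      }
      where
      props : T (isSubspaceᵇ S) × T (hasDimᵇ k S)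
      props = to (T-∧ {isSubspaceᵇ S}) (proj₂ (∈-filter⁻ (T? ∘ subspaceᵇ) {xs = sublists (Alt n)} S∈))
      closure : T (memᵇ zeroM S) × T (all (λ A → all (λ B → memᵇ (addM A B) S) S) S) × T (all (λ c → all (λ A → memᵇ (scaleM c A) S) S) elements)
      closure = let h₁ , h₂ = to (T-∧ {memᵇ zeroM S}) (proj₁ props) in h₁ , to (T-∧ {all (λ A → all (λ B → memᵇ (addM A B) S) S) S}) h₂
      mem-cong : ∀ A B → B ≈ A → T (memᵇ A S) → T (memᵇ B S)
      mem-cong A B e h = let C , C∈ , e′ = mem⇒ A S h in ⇒mem {A = B} C∈ (≈-trans {A = B} {A} {C} e e′)
      basis-found : ∃ λ b → b ∈ allFuns S k × T (indepMᵇ b ∧ all (λ M → any (λ c → eqMᵇ (lcM b c) M) (allFuns elements k)) S)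
      basis-found = T-any _ (allFuns S k) (proj₂ props)
      b : Fin k → Mat n
      b = proj₁ basis-found
      b∈ = proj₁ (proj₂ basis-found)
      b-props : T (indepMᵇ b) × T (all (λ M → any (λ c → eqMᵇ (lcM b c) M) (allFuns elements k)) S)
      b-props = to (T-∧ {indepMᵇ b}) (proj₂ (proj₂ basis-found))
      b̂ : Vec (Vec K N) k
      b̂ = Vec.tabulate (λ l → fromM n (b l))
      b̂≈b : ∀ l → toM n (lookup b̂ l) ≈ b l
      b̂≈b l i j = trans (cong (λ z → toM n z i j) (Vecₚ.lookup∘tabulate (λ l → fromM n (b l)) l))
        (toM-fromM n (b l) (kSubspace-alt S∈ (allFuns-sound S k b∈ l)) i j)
      toM-b̂ : ∀ c → toM n (L c b̂) ≈ lcM b (lookup c)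
      toM-b̂ c i j = trans (toM-L n c b̂ i j) (lcM-cong {v = λ l → toM n (lookup b̂ l)} {b} b̂≈b (λ _ → refl) i j)

    indep⇒kSubspace : (v : Vec (Vec K N) k) → T (indepᵇ v) → ∃ λ S → S ∈ kSubspaces n k × T (allᵛ (inᵇ n S) v)
    indep⇒kSubspace v ind = S , ∈-filter⁺ (T? ∘ subspaceᵇ) (filterᵇ∈sublists inSpan (Alt n))
        (from (T-∧ {isSubspaceᵇ S}) (subspace , dimension)) ,
        ⇒allᵛ (inᵇ n S) v (λ l → member (toM n (lookup v l)) (unit l) (λ i j → cong (λ z → toM n z i j) (sym (L-unit l v))))
      where
      b : Fin k → Mat n
      b l = toM n (lookup v l)
      inSpan : Mat n → Bool
      inSpan M = any (λ c → eqMᵇ (lcM b c) M) (allFuns elements k)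
      -- Filtering `Alt n` makes the span literally one of the sublists over which `kSubspaces`
      -- ranges.
      S : List (Mat n)
      S = filterᵇ inSpan (Alt n)

      unit : ∀ {k} → Fin k → Vec K k
      unit zero    = 𝟏 ∷ 0ⱽ
      unit (suc l) = 𝟘 ∷ unit l
      L-unit : ∀ {k} (l : Fin k) (v : Vec (Vec K N) k) → L (unit l) v ≡ lookup v l
      L-unit zero    (v ∷ vs) = trans (cong₂ _+ⱽ_ (·-identity v) (L-zero vs)) (V.identityʳ v)
      L-unit (suc l) (v ∷ vs) = trans (cong₂ _+ⱽ_ (·-zeroˡ v) (L-unit l vs)) (V.identityˡ _)

      member : ∀ M c → M ≈ toM n (L c v) → T (memᵇ M S)
      member M c e =
        let M′ , M′∈ , e′ = Alt-complete (toM n (L c v)) (toM-alt n (L c v))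
            c′ , c′∈ , ec = allFuns-K (lookup c)
        in ⇒mem (∈-filter⁺ (T? ∘ inSpan) M′∈ (any-T (λ c → eqMᵇ (lcM b c) M′) c′∈ (≈⇒eqM {A = lcM b c′} {M′}
             (λ i j → trans (lcM-cong {v = b} {b} (λ _ _ _ → refl) ec i j) (trans (sym (toM-L n c v i j)) (sym (e′ i j)))))))
           (λ i j → trans (e i j) (sym (e′ i j)))

      represent : ∀ {M} → M ∈ S → ∃ λ c → M ≈ toM n (L c v)
      represent {M} M∈ =
        let c , _ , e = T-any (λ c → eqMᵇ (lcM b c) M) (allFuns elements k) (proj₂ (∈-filter⁻ (T? ∘ inSpan) {xs = Alt n} M∈))
        in Vec.tabulate c , λ i j → sym (trans (toM-L n (Vec.tabulate c) v i j)
             (trans (lcM-cong {v = b} {b} (λ _ _ _ → refl) (λ l → Vecₚ.lookup∘tabulate c l) i j) (eqM⇒≈ {A = lcM b c} {M} e i j)))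

      subspace : T (isSubspaceᵇ S)
      subspace = from (T-∧ {memᵇ zeroM S}) (
        member zeroM 0ⱽ (λ i j → sym (trans (cong (λ z → toM n z i j) (L-zero v)) (toM-0 n i j))) ,
        from (T-∧ {all (λ A → all (λ B → memᵇ (addM A B) S) S) S}) (
          all-T _ S (λ {A} A∈ → all-T _ S (λ {B} B∈ → let c , ec = represent A∈ ; d , ed = represent B∈ in
            member (addM A B) (c +ⱽ d) (λ i j → trans (cong₂ _⊕_ (ec i j) (ed i j))
              (trans (sym (toM-+ n (L c v) (L d v) i j)) (cong (λ z → toM n z i j) (sym (L-+ c d v))))))) ,
          all-T _ elements (λ {a} _ → all-T _ S (λ {A} A∈ → let c , ec = represent A∈ in
            member (scaleM a A) (a · c) (λ i j → trans (cong (a ⊗_) (ec i j))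
              (trans (sym (toM-· n a (L c v) i j)) (cong (λ z → toM n z i j) (sym (L-· a c v)))))))))

      dimension : T (hasDimᵇ k S)
      dimension =
        -- The given basis need not be literally listed in `allFuns S k`; `g` is a pointwise equal
        -- family that is.
        let g , g∈ , eq = allFuns-complete (λ (A B : Mat n) → A ≈ B) S k b (λ l →
              let M , M∈ , e = mem⇒ (b l) S (member (b l) (unit l) (λ i j → cong (λ z → toM n z i j) (sym (L-unit l v))))
              in M , M∈ , ≈-sym {A = b l} {M} e)
        in any-T _ g∈ (from (T-∧ {indepMᵇ g}) (
             ⇒indepM g (λ c e l → trans (sym (Vecₚ.lookup∘tabulate c l)) (trans (cong (λ z → lookup z l)
               (indep⇒ v ind (Vec.tabulate c) (toM-injective n _ 0ⱽ (λ i j → trans (combination g eq c i j) (trans (e i j) (sym (toM-0 n i j)))))))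
               (lookup-0ⱽ l))) ,
             all-T _ S (λ {M} M∈ → let c , e = represent M∈ ; c′ , c′∈ , ec = allFuns-K (lookup c) in
               any-T (λ c → eqMᵇ (lcM g c) M) c′∈ (≈⇒eqM {A = lcM g c′} {M} (λ i j →
                 trans (lcM-cong {v = g} {b} eq ec i j) (trans (sym (toM-L n c v i j)) (sym (e i j))))))))
        where
        combination : ∀ g → (∀ l → g l ≈ b l) → ∀ c → toM n (L (Vec.tabulate c) v) ≈ lcM g c
        combination g eq c i j = trans (toM-L n (Vec.tabulate c) v i j)
          (lcM-cong {v = b} {g} (λ l i j → sym (eq l i j)) (λ l → Vecₚ.lookup∘tabulate c l) i j)

    -- v spans every k-dimensional space containing it, so two such spaces coincide.
    kSubspaces-conflict : ∀ v → AllPairs (λ S S′ → T (indepᵇ v ∧ allᵛ (inᵇ n S) v) → T (indepᵇ v ∧ allᵛ (inᵇ n S′) v) → ⊥) (kSubspaces n k)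
    kSubspaces-conflict v = AllPairs-∈ conflict (AllPairsₚ.filter⁺ (T? ∘ subspaceᵇ)
        (sublists-distinct _≈_ (λ {A} {B} → ≈-sym {A = A} {B}) (Alt-distinct n)))
      where
      contained : ∀ {S S′} → S ∈ kSubspaces n k → S′ ∈ kSubspaces n k → T (indepᵇ v) →
                  T (allᵛ (inᵇ n S) v) → T (allᵛ (inᵇ n S′) v) → ∀ {M} → M ∈ S → ∃ λ M′ → M′ ∈ S′ × M ≈ M′
      contained {S} {S′} S∈ S′∈ ind v∈ v∈′ {M} M∈ =
        let z     = fromM n M
            z≈M   = toM-fromM n M (kSubspace-alt S∈ M∈)
            c , e = KSpace.indep-spans (kSubspace⇒KSpace S∈) v ind v∈ z (⇒mem {A = toM n z} M∈ z≈M)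
            M′ , M′∈ , e′ = mem⇒ (toM n z) S′ (subst (T ∘ inᵇ n S′) e (KSpace.L∈ (kSubspace⇒KSpace S′∈) c v v∈′))
        in M′ , M′∈ , λ i j → trans (sym (z≈M i j)) (e′ i j)
      conflict : ∀ {S S′} → S ∈ kSubspaces n k → S′ ∈ kSubspaces n k → ¬ (_⊑_ _≈_ S S′ × _⊑_ _≈_ S′ S) →
                 T (indepᵇ v ∧ allᵛ (inᵇ n S) v) → T (indepᵇ v ∧ allᵛ (inᵇ n S′) v) → ⊥
      conflict S∈ S′∈ distinct h h′ =
        let ind , v∈ = to (T-∧ {indepᵇ v}) h ; _ , v∈′ = to (T-∧ {indepᵇ v}) h′ in
        distinct (contained S∈ S′∈ ind v∈ v∈′ , contained S′∈ S∈ ind v∈′ v∈)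

    -- Double counting of subspaces and their bases.

    -- Every independent tuple lies in its span, and each space contains at most (q^k)^k tuples.
    count-subspaces-lower : ∑ (tuples N k) (λ v → 𝟙 (indepᵇ v)) ≤ length (kSubspaces n k) * (q ^ k) ^ k
    count-subspaces-lower = begin
      ∑ Ts (λ v → 𝟙 (indepᵇ v))                       ≤⟨ ∑-mono Ts covered ⟩
      ∑ Ts (λ v → ∑ kS (λ S → 𝟙 (allᵛ (inᵇ n S) v)))  ≡⟨ ∑-swap Ts kS _ ⟩
      ∑ kS (λ S → ∑ Ts (λ v → 𝟙 (allᵛ (inᵇ n S) v)))  ≤⟨ ∑-mono-∈ kS (λ S∈ → KSpace.tuples-upper (kSubspace⇒KSpace S∈)) ⟩
      ∑ kS (λ _ → (q ^ k) ^ k)                        ≡⟨ ∑-const kS _ ⟩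
      length kS * (q ^ k) ^ k                         ∎
      where
      open ≤-Reasoning
      Ts = tuples N k
      kS = kSubspaces n k
      covered : ∀ v → 𝟙 (indepᵇ v) ≤ ∑ kS (λ S → 𝟙 (allᵛ (inᵇ n S) v))
      covered v with indepᵇ v in eq
      ... | false = z≤n
      ... | true  = let S , S∈ , v∈ = indep⇒kSubspace v (subst T (sym eq) _) in
                    ≤-trans (𝟙-mono {true} (λ _ → v∈)) (∑-∈ (λ S → 𝟙 (allᵛ (inᵇ n S) v)) S∈)

    -- Counts pairs of a good subspace and a basis of it: each subspace has at least as many bases
    -- as there are independent k-tuples in K^k, and each tuple is a basis of at most one subspace.
    double-count : (good : List (Mat n) → Bool) (w : Vec (Vec K N) k → Bool) →
      (∀ {S} → S ∈ kSubspaces n k → T (good S) → ∀ v → T (indepᵇ v) → T (allᵛ (inᵇ n S) v) → T (w v)) →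
      length (filterᵇ good (kSubspaces n k)) * ∑ (tuples k k) (λ A → 𝟙 (indepᵇ A)) ≤ ∑ (tuples N k) (λ v → 𝟙 (w v))
    double-count good w good⇒w = begin
      length (filterᵇ good kS) * B                      ≡⟨ cong (_* B) (length-filterᵇ good kS) ⟩
      ∑ kS (λ S → 𝟙 (good S)) * B                       ≡⟨ ∑-*ʳ kS B _ ⟨
      ∑ kS (λ S → 𝟙 (good S) * B)                       ≤⟨ ∑-mono-∈ kS pointwise ⟩
      ∑ kS (λ S → ∑ Ts (λ v → 𝟙 (w v) * 𝟙 (cond v S)))  ≡⟨ ∑-swap kS Ts _ ⟩
      ∑ Ts (λ v → ∑ kS (λ S → 𝟙 (w v) * 𝟙 (cond v S)))  ≡⟨ ∑-cong Ts (λ v → ∑-*ˡ kS (𝟙 (w v)) _) ⟩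
      ∑ Ts (λ v → 𝟙 (w v) * ∑ kS (λ S → 𝟙 (cond v S)))
        ≤⟨ ∑-mono Ts (λ v → ≤-trans (*-monoʳ-≤ (𝟙 (w v)) (∑-atMostOne kS (cond v) (kSubspaces-conflict v))) (≤-reflexive (*-identityʳ _))) ⟩
      ∑ Ts (λ v → 𝟙 (w v))                              ∎
      where
      open ≤-Reasoning
      Ts = tuples N k
      kS = kSubspaces n k
      B = ∑ (tuples k k) (λ A → 𝟙 (indepᵇ A))
      cond : Vec (Vec K N) k → List (Mat n) → Bool
      cond v S = indepᵇ v ∧ allᵛ (inᵇ n S) v
      pointwise : ∀ {S} → S ∈ kS → 𝟙 (good S) * B ≤ ∑ Ts (λ v → 𝟙 (w v) * 𝟙 (cond v S))
      pointwise {S} S∈ with good S in eq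
      ... | false = z≤n
      ... | true  = begin
        1 * B                                    ≡⟨ *-identityˡ B ⟩
        B                                        ≤⟨ KSpace.indep-tuples-lower (kSubspace⇒KSpace S∈) ⟩
        ∑ Ts (λ v → 𝟙 (cond v S))                ≤⟨ ∑-mono Ts step ⟩
        ∑ Ts (λ v → 𝟙 (w v) * 𝟙 (cond v S))      ∎
        where
        step : ∀ v → 𝟙 (cond v S) ≤ 𝟙 (w v) * 𝟙 (cond v S)
        step v with cond v S in eq′
        ... | false = z≤n
        ... | true  = let ind , v∈ = to (T-∧ {indepᵇ v}) (subst T (sym eq′) _) in
          ≤-trans (𝟙-mono {true} (λ _ → good⇒w S∈ (subst T (sym eq) _) v ind v∈)) (≤-reflexive (sym (*-identityʳ _)))

    count-good : ∀ d → length (filterᵇ (minRankAtLeastᵇ d) (kSubspaces n k)) * ∑ (tuples k k) (λ A → 𝟙 (indepᵇ A))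
                       ≤ ∑ (tuples N k) (λ v → 𝟙 (not (hits (low n d) v)))
    count-good d = double-count (minRankAtLeastᵇ d) (λ v → not (hits (low n d) v)) (λ {S} S∈ good v ind v∈ → T-not (λ h →
      let c , c≢0 , isLow = hits-sound (low n d) v h
          M , M∈ , e = mem⇒ (toM n (L c v)) S (KSpace.L∈ (kSubspace⇒KSpace S∈) c v v∈)
      in [ (λ z → c≢0 (indep⇒ v ind c (toM-injective n _ 0ⱽ (λ i j → trans (e i j) (trans (isZeroM⇒ {A = M} z i j) (sym (toM-0 n i j)))))))
         , (λ r → not-T isLow (⇒rankAtLeast d (toM n (L c v)) (RankAtLeast-cong {A = M} {toM n (L c v)} (≈-sym {A = toM n (L c v)} {M} e) (rankAtLeast⇒ d M r))))
         ]′ (to (T-∨ {isZeroMᵇ M}) (T-all _ S good M∈))))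

    -- If a basis of S hit nothing, every nonzero matrix of S, being a nontrivial combination of the
    -- basis, would have rank at least d. The argument by contradiction is legitimate because all
    -- predicates are Boolean.
    count-bad : ∀ d → length (filterᵇ (λ S → not (minRankAtLeastᵇ d S)) (kSubspaces n k)) * ∑ (tuples k k) (λ A → 𝟙 (indepᵇ A))
                       ≤ ∑ (tuples N k) (λ v → 𝟙 (hits (low n d) v))
    count-bad d = double-count (λ S → not (minRankAtLeastᵇ d S)) (hits (low n d)) step
      where
      step : ∀ {S} → S ∈ kSubspaces n k → T (not (minRankAtLeastᵇ d S)) → ∀ v → T (indepᵇ v) → T (allᵛ (inᵇ n S) v) → T (hits (low n d) v)
      step {S} S∈ bad v ind v∈ = T-stable λ miss → not-T bad (all-T _ S λ {M} M∈ → T-stable λ ¬good →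
        let z     = fromM n M
            z≈M   = toM-fromM n M (kSubspace-alt S∈ M∈)
            c , e = KSpace.indep-spans (kSubspace⇒KSpace S∈) v ind v∈ z (⇒mem {A = toM n z} M∈ z≈M)
            low-z = T-not λ r → ¬good (from (T-∨ {isZeroMᵇ M}) (inj₂
                      (⇒rankAtLeast d M (RankAtLeast-cong {A = toM n z} {M} z≈M (rankAtLeast⇒ d (toM n z) r)))))
            c≡0   = decidable-stable (c ≟ⱽ 0ⱽ) λ c≢0 → miss (hits-complete (low n d) (low-· n d) v c c≢0
                      (subst (T ∘ low n d) (sym e) low-z))
            z≡0   = trans (sym e) (trans (cong (λ a → L a v) c≡0) (L-zero v))
        in ¬good (from (T-∨ {isZeroMᵇ M}) (inj₁ (⇒isZeroM {A = M} λ i j →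
             trans (sym (z≈M i j)) (trans (cong (λ w → toM n w i j) z≡0) (toM-0 n i j))))))

  -- Bounds for the numbers of good and bad subspaces.

  count-zero : ∀ {N} → count (zeroᵇ {N}) ≤ 1
  count-zero {N} = ∑-atMostOne (vectors N) zeroᵇ (AllPairs.map
    (λ x≢y h h′ → x≢y (trans (toWitness h) (sym (toWitness h′)))) (unique (enumK^ N)))

  -- The first moment for T = {0} bounds the proportion of dependent tuples by k q^(k-1) / q^N; with
  -- k ≤ N this is at most k/q, and q ≥ 2k makes it at most 1/2.
  indep-tuples-half : ∀ N m → suc m ≤ N → 2 * suc m ≤ q →
                      (q ^ N) ^ suc m ≤ 2 * ∑ (tuples N (suc m)) (λ v → 𝟙 (indepᵇ v))
  indep-tuples-half N m k≤N 2k≤q = begin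
    Q ^ suc m  ≡⟨ total ⟨
    I + H      ≤⟨ +-monoʳ-≤ I H≤I ⟩
    I + I      ≡⟨ cong (I +_) (+-identityʳ I) ⟨
    2 * I      ∎
    where
    open ≤-Reasoning
    open +-*-Solver
    Q = q ^ N
    I = ∑ (tuples N (suc m)) (λ v → 𝟙 (indepᵇ v))
    H = ∑ (tuples N (suc m)) (λ v → 𝟙 (hits zeroᵇ v))
    total : I + H ≡ Q ^ suc m
    total = trans (∑-complement (tuples N (suc m)) (hits zeroᵇ)) (size-tuples N (suc m))
    H≤I : H ≤ I
    H≤I = +-cancelʳ-≤ H H I (begin
      H + H                                          ≡⟨ cong (H +_) (+-identityʳ H) ⟨
      2 * H                                          ≤⟨ *-monoʳ-≤ 2 (first-moment (zeroᵇ {N}) m) ⟩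
      2 * (suc m * (q ^ m * (Q ^ m * count (zeroᵇ {N}))))
        ≤⟨ *-monoʳ-≤ 2 (*-monoʳ-≤ (suc m) (*-monoʳ-≤ (q ^ m) (*-monoʳ-≤ (Q ^ m) (count-zero {N})))) ⟩
      2 * (suc m * (q ^ m * (Q ^ m * 1)))
        ≡⟨ solve 3 (λ k a b → con 2 :* (k :* (a :* (b :* con 1))) := con 2 :* k :* a :* b) refl (suc m) (q ^ m) (Q ^ m) ⟩
      2 * suc m * q ^ m * Q ^ m                      ≤⟨ *-monoˡ-≤ (Q ^ m) (*-monoˡ-≤ (q ^ m) 2k≤q) ⟩
      q ^ suc m * Q ^ m                              ≤⟨ *-monoˡ-≤ (Q ^ m) (^-monoʳ-≤ q {{ℕ.>-nonZero 1≤q}} k≤N) ⟩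
      Q ^ suc m                                      ≡⟨ total ⟨
      I + H                                          ∎)

  pos-factor : ∀ a b → 1 ≤ a * b → 1 ≤ a
  pos-factor (suc a) b h = s≤s z≤n

  module _ (n s m : ℕ) (2s≤n : dbl s ≤ n) (k≤N : suc m ≤ tri n) (2k≤q : 2 * suc m ≤ q) where
    private
      k = suc m
      d = 2 + dbl s
      N = tri n
      Q = q ^ N
      P = q ^ m
      t = count (low n d)
      kS = kSubspaces n k
      a = length kS
      B = ∑ (tuples k k) (λ A → 𝟙 (indepᵇ A))
      open ≤-Reasoning
      open +-*-Solver

      instance
        q≢0 : ℕ.NonZero q
        q≢0 = ℕ.>-nonZero 1≤q

      -- Turns a count of bases into a proportion of subspaces. The 4 is 2 · 2: one half is lost for
      -- independent tuples in K^N, another for those in K^k.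
      transfer : ∀ x Y → x * B ≤ Y → x * Q ^ k ≤ 4 * (a * Y)
      transfer x Y h = begin
        x * Q ^ k                    ≤⟨ *-monoʳ-≤ x (indep-tuples-half N m k≤N 2k≤q) ⟩
        x * (2 * ∑ (tuples N k) (λ v → 𝟙 (indepᵇ v))) ≤⟨ *-monoʳ-≤ x (*-monoʳ-≤ 2 (count-subspaces-lower n k)) ⟩
        x * (2 * (a * (q ^ k) ^ k))  ≤⟨ *-monoʳ-≤ x (*-monoʳ-≤ 2 (*-monoʳ-≤ a (indep-tuples-half k m ≤-refl 2k≤q))) ⟩
        x * (2 * (a * (2 * B)))      ≡⟨ solve 3 (λ x a B → x :* (con 2 :* (a :* (con 2 :* B))) := con 4 :* (a :* (x :* B))) refl x a B ⟩
        4 * (a * (x * B))            ≤⟨ *-monoʳ-≤ 4 (*-monoʳ-≤ a h) ⟩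
        4 * (a * Y)                  ∎

      1≤t : 1 ≤ t
      1≤t = pos-factor t (2 ^ s) (≤-trans (m^n>0 q (dimLow s n)) (≤-trans (count-low-lower s n 2s≤n) (≤-reflexive (*-comm (2 ^ s) t))))

    -- Ensures that `δAlt` is a genuine quotient and not the default value of `ratio`.
    count-kSubspaces>0 : 1 ≤ a
    count-kSubspaces>0 = pos-factor a ((q ^ k) ^ k * 2) (begin
      1                       ≤⟨ m^n>0 Q {{m^n≢0 q N}} k ⟩
      Q ^ k                   ≤⟨ indep-tuples-half N m k≤N 2k≤q ⟩
      2 * ∑ (tuples N k) (λ v → 𝟙 (indepᵇ v)) ≤⟨ *-monoʳ-≤ 2 (count-subspaces-lower n k) ⟩
      2 * (a * (q ^ k) ^ k)   ≡⟨ solve 2 (λ a x → con 2 :* (a :* x) := a :* (x :* con 2)) refl a ((q ^ k) ^ k) ⟩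
      a * ((q ^ k) ^ k * 2)   ∎)

    -- A basis of a good subspace hits nothing, so the second moment applies, with |T| bounded below
    -- by q^(dimLow) / 2^s.
    good-bound : length (filterᵇ (minRankAtLeastᵇ d) kS) * q ^ (m + dimLow s n) ≤ 4 * 2 ^ s * (a * Q)
    good-bound = begin
      g * q ^ (m + dimLow s n)       ≡⟨ cong (g *_) (^-distribˡ-+-* q m (dimLow s n)) ⟩
      g * (P * q ^ dimLow s n)       ≤⟨ *-monoʳ-≤ g (*-monoʳ-≤ P (count-low-lower s n 2s≤n)) ⟩
      g * (P * (2 ^ s * t))          ≡⟨ solve 4 (λ g P x t → g :* (P :* (x :* t)) := x :* (g :* (P :* t))) refl g P (2 ^ s) t ⟩
      2 ^ s * (g * (P * t))          ≤⟨ *-monoʳ-≤ (2 ^ s) (*-cancelʳ-≤ (g * (P * t)) (4 * (a * Q)) (Q ^ k) {{m^n≢0 Q k {{m^n≢0 q N}}}} cleared) ⟩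
      2 ^ s * (4 * (a * Q))          ≡⟨ solve 2 (λ x y → x :* (con 4 :* y) := con 4 :* x :* y) refl (2 ^ s) (a * Q) ⟩
      4 * 2 ^ s * (a * Q)            ∎
      where
      g = length (filterᵇ (minRankAtLeastᵇ d) kS)
      G = ∑ (tuples N k) (λ v → 𝟙 (not (hits (low n d) v)))
      cleared : g * (P * t) * Q ^ k ≤ 4 * (a * Q) * Q ^ k
      cleared = begin
        g * (P * t) * Q ^ k   ≡⟨ solve 3 (λ g x y → g :* x :* y := g :* y :* x) refl g (P * t) (Q ^ k) ⟩
        g * Q ^ k * (P * t)   ≤⟨ *-monoˡ-≤ (P * t) (transfer g G (count-good n k d)) ⟩
        4 * (a * G) * (P * t) ≡⟨ solve 3 (λ a G x → con 4 :* (a :* G) :* x := con 4 :* (a :* (G :* x))) refl a G (P * t) ⟩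
        4 * (a * (G * (P * t))) ≤⟨ *-monoʳ-≤ 4 (*-monoʳ-≤ a (second-moment m (low n d) 1≤t)) ⟩
        4 * (a * (Q * Q ^ k)) ≡⟨ solve 3 (λ a Q x → con 4 :* (a :* (Q :* x)) := con 4 :* (a :* Q) :* x) refl a Q (Q ^ k) ⟩
        4 * (a * Q) * Q ^ k   ∎

    -- A basis of a bad subspace hits T, so the first moment applies, with |T| bounded above through
    -- `involutions n`.
    bad-bound : length (filterᵇ (λ S → not (minRankAtLeastᵇ d S)) kS) * Q ≤ 4 * suc m * involutions n * (a * q ^ (m + dimLow s n))
    bad-bound = *-cancelʳ-≤ (b * Q) _ (Q ^ m) {{m^n≢0 Q m {{m^n≢0 q N}}}} (begin
      b * Q * Q ^ m                          ≡⟨ *-assoc b Q (Q ^ m) ⟩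
      b * Q ^ k                              ≤⟨ transfer b _ (count-bad n k d) ⟩
      4 * (a * ∑ (tuples N k) (λ v → 𝟙 (hits (low n d) v))) ≤⟨ *-monoʳ-≤ 4 (*-monoʳ-≤ a (first-moment (low n d) m)) ⟩
      4 * (a * (k * (P * (Q ^ m * t))))      ≤⟨ *-monoʳ-≤ 4 (*-monoʳ-≤ a (*-monoʳ-≤ k (*-monoʳ-≤ P (*-monoʳ-≤ (Q ^ m) (count-low-upper s n))))) ⟩
      4 * (a * (k * (P * (Q ^ m * (involutions n * q ^ dimLow s n)))))
        ≡⟨ solve 6 (λ a k P x i e → con 4 :* (a :* (k :* (P :* (x :* (i :* e))))) := con 4 :* k :* i :* (a :* (P :* e)) :* x) refl a k P (Q ^ m) (involutions n) (q ^ dimLow s n) ⟩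
      4 * k * involutions n * (a * (P * q ^ dimLow s n)) * Q ^ m
        ≡⟨ cong (λ z → 4 * k * involutions n * (a * z) * Q ^ m) (^-distribˡ-+-* q m (dimLow s n)) ⟨
      4 * k * involutions n * (a * q ^ (m + dimLow s n)) * Q ^ m ∎)
      where
      b = length (filterᵇ (λ S → not (minRankAtLeastᵇ d S)) kS)

    good+bad : length (filterᵇ (minRankAtLeastᵇ d) kS) + length (filterᵇ (λ S → not (minRankAtLeastᵇ d S)) kS) ≡ a
    good+bad = trans (+-comm (length (filterᵇ (minRankAtLeastᵇ d) kS)) _) (trans (cong₂ _+_ (length-filterᵇ _ kS) (length-filterᵇ _ kS))
      (∑-complement kS (minRankAtLeastᵇ d)))

-- Opened only here: +_ would make the sections x +_ above ambiguous.
open import Data.Integer as ℤ using (+_; -[1+_]; _⊖_)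

-- The exponent in closed form.

tri-formula : ∀ m → m * (m ∸ 1) ≡ tri m * 2
tri-formula zero    = refl
tri-formula (suc m) = trans (square m) (trans (cong (λ z → m + (m + z)) (tri-formula m))
  (solve 2 (λ m t → m :+ (m :+ t :* con 2) := (m :+ t) :* con 2) refl m (tri m)))
  where
  open +-*-Solver
  square : ∀ m → suc m * m ≡ m + (m + m * (m ∸ 1))
  square zero    = refl
  square (suc m) = solve 1 (λ m → (con 2 :+ m) :* (con 1 :+ m) := con 1 :+ m :+ (con 1 :+ m :+ (con 1 :+ m) :* m)) refl m

tri-div : ∀ m → m * (m ∸ 1) / 2 ≡ tri m
tri-div m = trans (cong (_/ 2) (tri-formula m)) (m*n/n≡m (tri m) 2)

2*≡dbl : ∀ s → 2 * s ≡ dbl s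
2*≡dbl zero    = refl
2*≡dbl (suc s) = trans (*-suc 2 s) (cong (λ z → 2 + z) (2*≡dbl s))

-- The classical dimension r(2n - r - 1)/2 for rank r = 2s, written additively to avoid truncated
-- subtraction. With d = 2s + 2, the two terms are (d-1)(d-2)/2 and (d-2)n from the threshold.
dimLow-formula : ∀ s n → dbl s ≤ n → dimLow s n + tri (suc (dbl s)) ≡ dbl s * n
dimLow-formula zero    n             h             = refl
dimLow-formula (suc s) (suc (suc n)) (s≤s (s≤s h)) = begin
  suc n + n + dimLow s n + (2 + D + (1 + D + tri (suc D)))
    ≡⟨ solve 4 (λ n D e t → con 1 :+ n :+ n :+ e :+ (con 2 :+ D :+ (con 1 :+ D :+ t)) := con 4 :+ con 2 :* n :+ con 2 :* D :+ (e :+ t)) refl n D (dimLow s n) (tri (suc D)) ⟩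
  4 + 2 * n + 2 * D + (dimLow s n + tri (suc D)) ≡⟨ cong (λ z → 4 + 2 * n + 2 * D + z) (dimLow-formula s n h) ⟩
  4 + 2 * n + 2 * D + D * n
    ≡⟨ solve 2 (λ n D → con 4 :+ con 2 :* n :+ con 2 :* D :+ D :* n := (con 2 :+ D) :* (con 2 :+ n)) refl n D ⟩
  (2 + D) * (2 + n) ∎
  where
  open ≡-Reasoning
  open +-*-Solver
  D = dbl s

threshold-formula : ∀ n s → dbl s ≤ n → threshold n (2 + dbl s) ≡ + suc (tri n) ℤ.- + dimLow s n
threshold-formula n s h = begin
  + (n * (n ∸ 1) / 2) ℤ.+ + 1 ℤ.- + (dbl s * n) ℤ.+ + (suc (dbl s) * dbl s / 2)
    ≡⟨ cong₂ (λ x y → + x ℤ.+ + 1 ℤ.- + (dbl s * n) ℤ.+ + y) (tri-div n) (tri-div (suc (dbl s))) ⟩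
  + tri n ℤ.+ + 1 ℤ.- + (dbl s * n) ℤ.+ + c
    ≡⟨ cong (λ z → + tri n ℤ.+ + 1 ℤ.- z ℤ.+ + c) (trans (cong +_ (sym (dimLow-formula s n h))) (ℤₚ.pos-+ (dimLow s n) c)) ⟩
  + tri n ℤ.+ + 1 ℤ.- (+ dimLow s n ℤ.+ + c) ℤ.+ + c
    ≡⟨ solve 3 (λ t e c → t :+ con (+ 1) :- (e :+ c) :+ c := con (+ 1) :+ t :- e) refl (+ tri n) (+ dimLow s n) (+ c) ⟩
  + 1 ℤ.+ + tri n ℤ.- + dimLow s n ∎
  where
  open ≡-Reasoning
  open ℤSolver.+-*-Solver
  c = tri (suc (dbl s))

-- From inequalities of natural numbers to rational estimates.

toℚᵘ-ratio : ∀ a b → toℚᵘ (ratio a (suc b)) ℚᵘ.≃ mkℚᵘ (+ a) b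
toℚᵘ-ratio a b = ℚₚ.toℚᵘ-fromℚᵘ (mkℚᵘ (+ a) b)

ratio-≤ : ∀ g a c x y → 1 ≤ a → 1 ≤ y → g * y ≤ c * (a * x) → ratio g a ℚ.≤ ratio c 1 ℚ.* ratio x y
ratio-≤ g (suc a) c x (suc y) _ _ h = ℚₚ.toℚᵘ-cancel-≤ (begin
  toℚᵘ (ratio g (suc a))                          ≃⟨ toℚᵘ-ratio g a ⟩
  mkℚᵘ (+ g) a                                    ≤⟨ *≤* core ⟩
  mkℚᵘ (+ c) 0 ℚᵘ.* mkℚᵘ (+ x) y                  ≃⟨ ℚᵘₚ.*-cong (toℚᵘ-ratio c 0) (toℚᵘ-ratio x y) ⟨
  toℚᵘ (ratio c 1) ℚᵘ.* toℚᵘ (ratio x (suc y))    ≃⟨ ℚₚ.toℚᵘ-homo-* (ratio c 1) (ratio x (suc y)) ⟨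
  toℚᵘ (ratio c 1 ℚ.* ratio x (suc y))            ∎)
  where
  open ℚᵘₚ.≤-Reasoning
  core : + g ℤ.* + suc (y + 0) ℤ.≤ (+ c ℤ.* + x) ℤ.* + suc a
  core = subst₂ ℤ._≤_ (trans (cong +_ (cong (λ z → g * suc z) (sym (+-identityʳ y)))) (ℤₚ.pos-* g (suc (y + 0))))
    (trans (cong +_ (solve 3 (λ c a x → c :* (a :* x) := c :* x :* a) refl c (suc a) x)) (trans (ℤₚ.pos-* (c * x) (suc a)) (cong (ℤ._* + suc a) (ℤₚ.pos-* c x))))
    (ℤ.+≤+ h)
    where open +-*-Solver

ratio-powℤ : ∀ q N P c g a → 1 ≤ q → 1 ≤ a → g * q ^ P ≤ c * (a * q ^ N) → ratio g a ℚ.≤ ratio c 1 ℚ.* powℤ q (N ⊖ P)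
ratio-powℤ q N P c g a 1≤q 1≤a h with P ≤? N
... | yes P≤N rewrite ℤₚ.⊖-≥ P≤N = ratio-≤ g a c (q ^ (N ∸ P)) 1 1≤a ≤-refl (*-cancelʳ-≤ (g * 1) _ (q ^ P) {{m^n≢0 q P {{ℕ.>-nonZero 1≤q}}}} (begin
  g * 1 * q ^ P                     ≡⟨ cong (_* q ^ P) (*-identityʳ g) ⟩
  g * q ^ P                         ≤⟨ h ⟩
  c * (a * q ^ N)                   ≡⟨ cong (λ z → c * (a * z)) (trans (cong (q ^_) (sym (m∸n+n≡m P≤N))) (^-distribˡ-+-* q (N ∸ P) P)) ⟩
  c * (a * (q ^ (N ∸ P) * q ^ P))   ≡⟨ solve 4 (λ c a x y → c :* (a :* (x :* y)) := c :* (a :* x) :* y) refl c a (q ^ (N ∸ P)) (q ^ P) ⟩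
  c * (a * q ^ (N ∸ P)) * q ^ P     ∎))
  where
  open ≤-Reasoning
  open +-*-Solver
... | no P≰N rewrite ℤₚ.⊖-< (≰⇒> P≰N) with P ∸ N in eq
-- Excluded because N < P here.
...   | zero  = contradiction-∸ eq
  where
  contradiction-∸ : P ∸ N ≡ 0 → ratio g a ℚ.≤ ratio c 1 ℚ.* powℤ q (+ 0)
  contradiction-∸ e with () ← P≰N (m∸n≡0⇒m≤n e)
...   | suc j = ratio-≤ g a c 1 (q ^ suc j) 1≤a (m^n>0 q {{ℕ.>-nonZero 1≤q}} (suc j)) (*-cancelʳ-≤ (g * q ^ suc j) _ (q ^ N) {{m^n≢0 q N {{ℕ.>-nonZero 1≤q}}}} (begin
  g * q ^ suc j * q ^ N   ≡⟨ *-assoc g (q ^ suc j) (q ^ N) ⟩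
  g * (q ^ suc j * q ^ N)
    ≡⟨ cong (g *_) (trans (sym (^-distribˡ-+-* q (suc j) N)) (cong (q ^_) (trans (cong (_+ N) (sym eq)) (m∸n+n≡m (<⇒≤ (≰⇒> P≰N)))))) ⟩
  g * q ^ P               ≤⟨ h ⟩
  c * (a * q ^ N)         ≡⟨ solve 3 (λ c a x → c :* (a :* x) := c :* (a :* con 1) :* x) refl c a (q ^ N) ⟩
  c * (a * 1) * q ^ N     ∎))
  where
  open ≤-Reasoning
  open +-*-Solver

-- A strict inequality between the integer exponents is worth a full factor q, which is what drives
-- both limits.
shrink : ∀ q x y b a c → 1 ≤ q → suc x ≤ y → b * q ^ y ≤ c * (a * q ^ x) → b * q ≤ c * a
shrink q x y b a c 1≤q x<y h = *-cancelʳ-≤ (b * q) (c * a) (q ^ x) {{m^n≢0 q x {{ℕ.>-nonZero 1≤q}}}} (begin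
  b * q * q ^ x    ≡⟨ *-assoc b q _ ⟩
  b * q ^ suc x    ≤⟨ *-monoʳ-≤ b (^-monoʳ-≤ q {{ℕ.>-nonZero 1≤q}} x<y) ⟩
  b * q ^ y        ≤⟨ h ⟩
  c * (a * q ^ x)  ≡⟨ *-assoc c a _ ⟨
  c * a * q ^ x    ∎)
  where open ≤-Reasoning

eventually-small : ∀ (c : ℕ) ε → 0ℚ ℚ.< ε → ∃ λ (Q : ℕ) → ∀ q b a → Q ≤ q → 1 ≤ a → b * q ≤ c * a → ratio b a ℚ.≤ ε
eventually-small c (mkℚ (+ zero) dm _)    (ℚ.*<* (ℤ.+<+ ()))
eventually-small c (mkℚ -[1+ _ ] dm _)    (ℚ.*<* ())
-- With q ≥ (c+1)(dm+1) the hypothesis gives b/a ≤ 1/(dm+1) ≤ ε. Using c + 1 instead of c keeps the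
-- cancelled factor positive when c is 0.
eventually-small c ε@(mkℚ (+ suc p) dm _) _ = suc c * suc dm , small
  where
  open ≤-Reasoning
  open +-*-Solver
  small : ∀ q b a → suc c * suc dm ≤ q → 1 ≤ a → b * q ≤ c * a → ratio b a ℚ.≤ ε
  small q b (suc a) Q≤q _ h = ℚₚ.toℚᵘ-cancel-≤ (ℚᵘₚ.≤-respˡ-≃ (ℚᵘₚ.≃-sym (toℚᵘ-ratio b a)) (*≤*
    (subst₂ ℤ._≤_ (ℤₚ.pos-* b (suc dm)) (ℤₚ.pos-* (suc p) (suc a)) (ℤ.+≤+ (≤-trans b*den≤a (m≤m+n (suc a) (p * suc a)))))))
    where
    b*den≤a : b * suc dm ≤ suc a
    b*den≤a = *-cancelˡ-≤ (suc c) (begin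
      suc c * (b * suc dm) ≡⟨ solve 3 (λ c b d → c :* (b :* d) := b :* (c :* d)) refl (suc c) b (suc dm) ⟩
      b * (suc c * suc dm) ≤⟨ *-monoʳ-≤ b Q≤q ⟩
      b * q                ≤⟨ h ⟩
      c * suc a            ≤⟨ m≤n+m _ (suc a) ⟩
      suc c * suc a        ∎)

0≤ratio : ∀ a b → 0ℚ ℚ.≤ ratio a b
0≤ratio a zero    = ℚₚ.≤-refl
0≤ratio a (suc b) = ℚₚ.nonNegative⁻¹ (ratio a (suc b)) {{ℚₚ.normalize-nonNeg a (suc b)}}

∣ratio∣ : ∀ a b → ℚ.∣ ratio a b ∣ ≡ ratio a b
∣ratio∣ a b = ℚₚ.0≤p⇒∣p∣≡p (0≤ratio a b)

ratio-complement : ∀ g b a → 1 ≤ a → g + b ≡ a → ℚ.∣ ratio g a ℚ.- 1ℚ ∣ ≡ ratio b a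
ratio-complement g b (suc a) _ e = trans (cong ℚ.∣_∣ difference) (trans (ℚₚ.∣-p∣≡∣p∣ (ratio b (suc a))) (∣ratio∣ b (suc a)))
  where
  total : ratio g (suc a) ℚ.+ ratio b (suc a) ≡ 1ℚ
  total = ℚₚ.toℚᵘ-injective (ℚᵘₚ.≃-trans (ℚₚ.toℚᵘ-homo-+ (ratio g (suc a)) (ratio b (suc a)))
    (ℚᵘₚ.≃-trans (ℚᵘₚ.+-cong (toℚᵘ-ratio g a) (toℚᵘ-ratio b a)) (*≡* core)))
    where
    core : (+ g ℤ.* + suc a ℤ.+ + b ℤ.* + suc a) ℤ.* + 1 ≡ + 1 ℤ.* + (suc a * suc a)
    core = trans (ℤₚ.*-identityʳ _) (trans (sym (ℤₚ.*-distribʳ-+ (+ suc a) (+ g) (+ b)))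
      (trans (cong (ℤ._* + suc a) (cong +_ e)) (trans (sym (ℤₚ.pos-* (suc a) (suc a))) (sym (ℤₚ.*-identityˡ _)))))
  difference : ratio g (suc a) ℚ.- 1ℚ ≡ ℚ.- ratio b (suc a)
  difference = begin
    x ℚ.- 1ℚ               ≡⟨ cong (λ z → x ℚ.- z) total ⟨
    x ℚ.- (x ℚ.+ y)        ≡⟨ cong (x ℚ.+_) (ℚₚ.neg-distrib-+ x y) ⟩
    x ℚ.+ (ℚ.- x ℚ.+ ℚ.- y) ≡⟨ ℚₚ.+-assoc x (ℚ.- x) (ℚ.- y) ⟨
    x ℚ.+ ℚ.- x ℚ.+ ℚ.- y  ≡⟨ cong (ℚ._+ ℚ.- y) (ℚₚ.+-inverseʳ x) ⟩
    0ℚ ℚ.+ ℚ.- y           ≡⟨ ℚₚ.+-identityˡ _ ⟩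
    ℚ.- y                  ∎
    where
    open ≡-Reasoning
    x = ratio g (suc a)
    y = ratio b (suc a)

-- Assembly of the three assertions.

Asymptotics : (n k d : ℕ) → Set₁
Asymptotics n k d =
  (∃ λ (C : ℚ) → ∃ λ (Q : ℕ) → ∀ (F : FiniteField) → Q ≤ card F
    → δAlt F n k d ℚ.≤ C ℚ.* powℤ (card F) (threshold n d ℤ.- (+ k)))
  × ((+ k) ℤ.< threshold n d
    → ∀ (ε : ℚ) → 0ℚ ℚ.< ε → ∃ λ (Q : ℕ) → ∀ (F : FiniteField) → Q ≤ card F
    → ℚ.∣ δAlt F n k d ℚ.- 1ℚ ∣ ℚ.≤ ε)
  × (threshold n d ℤ.< (+ k)
    → ∀ (ε : ℚ) → 0ℚ ℚ.< ε → ∃ λ (Q : ℕ) → ∀ (F : FiniteField) → Q ≤ card F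
    → ℚ.∣ δAlt F n k d ∣ ℚ.≤ ε)

asymptotics : ∀ n s m → dbl s ≤ n → suc m ≤ tri n → Asymptotics n (suc m) (2 + dbl s)
asymptotics n s m 2s≤n k≤N =
    (ratio C₁ 1 , 2 * suc m , λ F Q≤q → subst (λ z → δAlt F n (suc m) (2 + dbl s) ℚ.≤ ratio C₁ 1 ℚ.* powℤ (card F) z) (sym exponent)
      (ratio-powℤ (card F) N P C₁ (good F) (total F) (1≤q Q≤q) (Field.count-kSubspaces>0 F n s m 2s≤n k≤N Q≤q) (Field.good-bound F n s m 2s≤n k≤N Q≤q)))
  -- The sum `Q + 2 * suc m` serves as an upper bound for both requirements on q: smallness of the
  -- error and at least half of the tuples independent.
  , (λ k<thr ε 0<ε → let Q , small = eventually-small C₂ ε 0<ε in Q + 2 * suc m , λ F Q≤q →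
      let 2k≤q = ≤-trans (m≤n+m (2 * suc m) Q) Q≤q
          a>0  = Field.count-kSubspaces>0 F n s m 2s≤n k≤N 2k≤q
      in subst (ℚ._≤ ε) (sym (ratio-complement (good F) (bad F) (total F) a>0 (Field.good+bad F n s m 2s≤n k≤N 2k≤q)))
           (small (card F) (bad F) (total F) (≤-trans (m≤m+n Q _) Q≤q) a>0
             (shrink (card F) P N (bad F) (total F) C₂ (1≤q 2k≤q) (below k<thr) (Field.bad-bound F n s m 2s≤n k≤N 2k≤q))))
  , (λ thr<k ε 0<ε → let Q , small = eventually-small C₁ ε 0<ε in Q + 2 * suc m , λ F Q≤q →
      let 2k≤q = ≤-trans (m≤n+m (2 * suc m) Q) Q≤q
          a>0  = Field.count-kSubspaces>0 F n s m 2s≤n k≤N 2k≤q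
      in subst (ℚ._≤ ε) (sym (∣ratio∣ (good F) (total F)))
           (small (card F) (good F) (total F) (≤-trans (m≤m+n Q _) Q≤q) a>0
             (shrink (card F) N P (good F) (total F) C₁ (1≤q 2k≤q) (above thr<k) (Field.good-bound F n s m 2s≤n k≤N 2k≤q))))
  where
  N = tri n
  E = dimLow s n
  P = m + E
  C₁ = 4 * 2 ^ s
  C₂ = 4 * suc m * involutions n
  total good bad : FiniteField → ℕ
  total F = length (LinAlg.kSubspaces F n (suc m))
  good F  = length (filterᵇ (LinAlg.minRankAtLeastᵇ F (2 + dbl s)) (LinAlg.kSubspaces F n (suc m)))
  bad F   = length (filterᵇ (λ S → not (LinAlg.minRankAtLeastᵇ F (2 + dbl s) S)) (LinAlg.kSubspaces F n (suc m)))
  1≤q : ∀ {q} → 2 * suc m ≤ q → 1 ≤ q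
  1≤q = ≤-trans (s≤s z≤n)
  -- The 1 in the threshold cancels the 1 in k = m + 1.
  exponent : threshold n (2 + dbl s) ℤ.- + suc m ≡ N ⊖ P
  exponent = begin
    threshold n (2 + dbl s) ℤ.- + suc m           ≡⟨ cong (ℤ._- + suc m) (threshold-formula n s 2s≤n) ⟩
    + 1 ℤ.+ + N ℤ.- + E ℤ.- (+ 1 ℤ.+ + m)
      ≡⟨ solve 3 (λ N E m → con (+ 1) :+ N :- E :- (con (+ 1) :+ m) := N :- (m :+ E)) refl (+ N) (+ E) (+ m) ⟩
    + N ℤ.- (+ m ℤ.+ + E)                         ≡⟨ ℤₚ.m-n≡m⊖n N P ⟩
    N ⊖ P                                         ∎
    where
    open ≡-Reasoning
    open ℤSolver.+-*-Solver
  cleared : threshold n (2 + dbl s) ℤ.+ + E ≡ + suc N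
  cleared = trans (cong (ℤ._+ + E) (threshold-formula n s 2s≤n)) (solve 2 (λ N E → N :- E :+ E := N) refl (+ suc N) (+ E))
    where open ℤSolver.+-*-Solver
  below : + suc m ℤ.< threshold n (2 + dbl s) → suc P ≤ N
  below h = ℕ.s≤s⁻¹ (ℤₚ.drop‿+<+ (subst (+ suc P ℤ.<_) cleared (ℤₚ.+-monoˡ-< (+ E) h)))
  above : threshold n (2 + dbl s) ℤ.< + suc m → suc N ≤ P
  above h = ℕ.s≤s⁻¹ (ℤₚ.drop‿+<+ (subst (ℤ._< + suc P) cleared (ℤₚ.+-monoˡ-< (+ E) h)))

-- Since e ≥ 1, the factor t - e + 1 is at most t, and the bound on k becomes k ≤ n(n-1)/2, the
-- dimension of Alt_n; this is what makes most k-tuples independent for large q.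
k≤tri : ∀ n e k → 2 ≤ n → 1 ≤ e → 2 * (n / 2) * k ≤ n * (n ∸ 1) * ((n / 2) ∸ e + 1) → k ≤ tri n
k≤tri n e k 2≤n 1≤e h = *-cancelˡ-≤ (2 * t) {{ℕ.>-nonZero (*-mono-≤ (s≤s (z≤n {1})) 1≤t)}} (begin
  2 * t * k                    ≤⟨ h ⟩
  n * (n ∸ 1) * (t ∸ e + 1)    ≤⟨ *-mono-≤ (≤-reflexive (tri-formula n)) t∸e+1≤t ⟩
  tri n * 2 * t                ≡⟨ solve 2 (λ x t → x :* con 2 :* t := con 2 :* t :* x) refl (tri n) t ⟩
  2 * t * tri n                ∎)
  where
  open ≤-Reasoning
  open +-*-Solver
  t = n / 2
  1≤t : 1 ≤ t
  1≤t = /-monoˡ-≤ 2 2≤n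
  t∸e+1≤t : t ∸ e + 1 ≤ t
  t∸e+1≤t = ≤-trans (+-monoˡ-≤ 1 (∸-monoʳ-≤ t 1≤e)) (≤-reflexive (m∸n+n≡m 1≤t))

theorem6p15 : (n e k : ℕ) → 2 ≤ n → 1 ≤ e → 2 * e ≤ n → 1 ≤ k
    → 2 * (n / 2) * k ≤ n * (n ∸ 1) * ((n / 2) ∸ e + 1)
    → (∃ λ (C : ℚ) → ∃ λ (Q : ℕ) → ∀ (F : FiniteField) → Q ≤ card F
    → δAlt F n k (2 * e)
    ℚ.≤ C ℚ.* powℤ (card F) (threshold n (2 * e) ℤ.- (+ k)))
    × ((+ k) ℤ.< threshold n (2 * e)
    → ∀ (ε : ℚ) → 0ℚ ℚ.< ε → ∃ λ (Q : ℕ) → ∀ (F : FiniteField) → Q ≤ card F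
    → ℚ.∣ δAlt F n k (2 * e) ℚ.- 1ℚ ∣ ℚ.≤ ε)
    × (threshold n (2 * e) ℤ.< (+ k)
    → ∀ (ε : ℚ) → 0ℚ ℚ.< ε → ∃ λ (Q : ℕ) → ∀ (F : FiniteField) → Q ≤ card F
    → ℚ.∣ δAlt F n k (2 * e) ∣ ℚ.≤ ε)
theorem6p15 n (suc s) (suc m) 2≤n 1≤e 2e≤n _ h =
  -- With e = s + 1, rank below 2e means rank at most 2s for alternating matrices; `dbl (suc s)`
  -- unfolds to the form `2 + dbl s` used throughout.
  subst (Asymptotics n (suc m)) (sym (2*≡dbl (suc s)))
    (asymptotics n s m (≤-trans (m≤n+m (dbl s) 2) (≤-trans (≤-reflexive (sym (2*≡dbl (suc s)))) 2e≤n))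
      (k≤tri n (suc s) (suc m) 2≤n 1≤e h))
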